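{- For each $b \in \{2,4\} \cup \{5,10,15,20,\ldots\}$, let $M_b$ be the largest finite distance that a four-digit base-$b$ number is from a (non-zero) fixed point of the Kaprekar function $K_b$; precisely, $M_b$ is the least integer $m \ge 0$ such that $K_b^m(x) = K_b^{m+1}(x)$ for all $x \in S_b$. Then: (i) $M_2 = 1$, $M_4 = 3$, $M_5 = 4$, $M_{10} = 7$, and $M_{20} = 10$. (ii) If $b = 5m \cdot 2^n$ for some odd integer $m > 1$ and some integer $n \ge 0$, then $M_b = n+2$. (iii) If $b = 5 \cdot 2^n$ and $n \ge 3$, then $$M_b = \begin{cases} 4n+6 & \text{if } n \equiv 0 \pmod 4,\\ 3n+5 & \text{if } n \equiv 1 \pmod 4,\\ 3n+5 & \text{if } n \equiv 2 \pmod 4,\\ 5n+6 & \text{if } n \equiv 3 \pmod 4. \end{cases}$$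
   Context: Let $b \ge 2$ be an integer. A four-digit base-$b$ number is an integer $x$ with $0 \le x < b^4$, written with exactly four base-$b$ digits (leading zeros allowed). The Kaprekar function $K_b$ maps such an $x$ to $K_b(x) = D - A$, where $D$ is the integer whose four base-$b$ digits are the digits of $x$ (with multiplicity, including leading zeros) arranged in descending order, and $A$ is the integer whose digits are the same digits arranged in ascending order. The result is again regarded as a four-digit base-$b$ number. $K_b^t$ denotes the $t$-fold iterate, with $K_b^0$ the identity. $S_b$ is the set of four-digit base-$b$ numbers $x$ for which the sequence $K_b^t(x)$ is eventually a non-zero constant as $t$ increases. -}

module Defs where

open import Data.List.Base using (List; []; _∷_; foldl; reverse)
open import Data.List.Sort.InsertionSort.Base
  using () renaming (sort to sortBy)
open import Data.Nat.Base
open import Data.Nat.GeneralisedArithmetic using (iterate)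
open import Data.Nat.Properties using (≤-decTotalOrder)
open import Data.Product.Base using (_×_; ∃-syntax)
open import Relation.Binary.PropositionalEquality.Core using (_≡_; _≢_)

-- Digit lists are written most significant digit first.

digits : (b : ℕ) .{{_ : NonZero b}} → ℕ → List ℕ
digits b x =
  x / b / b / b % b ∷ x / b / b % b ∷ x / b % b ∷ x % b ∷ []

fromDigits : ℕ → List ℕ → ℕ
fromDigits b = foldl (λ acc d → acc * b + d) 0

-- The library's generic `Data.List.Sort.sort` is abstract and does not
-- compute, hence the concrete insertion sort.

ascending : List ℕ → List ℕ
ascending = sortBy ≤-decTotalOrder

descending : List ℕ → List ℕ
descending ds = reverse (ascending ds)

-- A four-digit number is a natural number x with x < b ^ 4; K b is only
-- meaningful on these, and its values on them are again such numbers.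
-- The minuend is never the smaller, so ∸ is ordinary subtraction here.

K : (b : ℕ) .{{_ : NonZero b}} → ℕ → ℕ
K b x = fromDigits b (descending (digits b x))
      ∸ fromDigits b (ascending (digits b x))

K^ : (b : ℕ) .{{_ : NonZero b}} → ℕ → ℕ → ℕ
K^ b t x = iterate (K b) x t

S : (b : ℕ) .{{_ : NonZero b}} → ℕ → Set
S b x = x < b ^ 4 ×
  (∃[ c ] c ≢ 0 × ∃[ T ] (∀ t → T ≤ t → K^ b t x ≡ c))

StableAt : (b : ℕ) .{{_ : NonZero b}} → ℕ → Set
StableAt b m = ∀ x → S b x → K^ b m x ≡ K^ b (suc m) x

-- The number M_b is given by its graph: IsM b m says that M_b exists and
-- equals m.

IsM : (b : ℕ) .{{_ : NonZero b}} → ℕ → Set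
IsM b m = StableAt b m × (∀ m′ → StableAt b m′ → m ≤ m′)

{-# OPTIONS --safe #-}
module Submission where

-- The Kaprekar map depends only on the differences p = d - a and q = c - b of
-- the sorted digits a ≤ b ≤ c ≤ d, and on such unordered pairs it applies the
-- tent map T x = ∣ 2 x - B ∣ to both entries, except when p or q is 0 or when
-- T p ≡ T q.  In base B = 5 k the non-zero fixed point is the 2-cycle k ↔ 3 k
-- of T.  If B = 5 m 2 ^ n with m odd, a T-step raises 2-adic valuations below
-- n by 1, so every m x with 5 ∤ x falls into the 2-cycle in at
-- most n + 1 steps.
--
-- If m > 1, the exceptional steps never produce two multiples of m, so only
-- tent steps matter.  If m = 1, the residue classes ± 1, ± 2, 0 modulo 5 of
-- the two entries decide what happens: opposite classes reach the fixed point
-- within n + 1 steps, equal classes merge to (u + 1 , u - 1), and a multiple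
-- of 5 becomes 0, after which (0 , p) bounces to (p - 1 , B - p).  A run of
-- tent steps of full length n ends in multiples of 2 ^ n, so that after it
-- only a few configurations remain, and 2 ^ n modulo 5, that is n
-- modulo 4, decides how many such runs can follow one another.

open import Defs
open import Data.Nat.Base using (ℕ; NonZero; _+_; _*_; _^_; _≤_; _<_; _%_)
open import Data.Product.Base using (_×_)
open import Relation.Binary.PropositionalEquality.Core using (_≡_)

open import Data.List.Base using (List; []; _∷_; length)
open import Data.List.Relation.Binary.Permutation.Propositional
  using (_↭_; ↭-refl; ↭-sym; ↭-trans; ↭-swap; ↭-prep; ↭⇒↭ₛ)
open import Data.List.Relation.Binary.Permutation.Propositional.Properties
  using (↭-length; All-resp-↭)
open import Data.List.Relation.Binary.Pointwise using (Pointwise-≡⇒≡)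
open import Data.List.Relation.Unary.All using (All; []; _∷_)
open import Data.List.Relation.Unary.Linked using ([]; [-]; _∷_)
open import Data.List.Relation.Unary.Sorted.TotalOrder using (Sorted)
open import Data.List.Relation.Unary.Sorted.TotalOrder.Properties using (↗↭↗⇒≋)
open import Data.Nat.Base
  hiding (ℕ; NonZero; _+_; _*_; _^_; _≤_; _<_; _%_)
open import Data.Nat.Divisibility
open import Data.Nat.DivMod hiding (_mod_; _div_)
open import Data.Nat.GeneralisedArithmetic using (iterate)
open import Data.Nat.Primality using (Prime; prime?; euclidsLemma)
open import Data.Nat.Properties
open import Data.List.Sort.InsertionSort.Properties ≤-decTotalOrder using (sort-↭; sort-↗)
open import Data.Nat.Tactic.RingSolver using (solve-∀)
open import Data.Product.Base using (_,_; ∃-syntax; proj₁; proj₂; swap)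
open import Data.Product.Properties using (≡-dec)
open import Data.Sum.Base using (_⊎_; inj₁; inj₂; [_,_]′; map)
open import Data.Unit.Base using (tt)
open import Function.Base using (id)
open import Relation.Binary.Definitions using (DecidableEquality; tri<; tri≈; tri>)
open import Relation.Binary.PropositionalEquality
  hiding (_≡_)
open import Relation.Nullary.Decidable
  using (Dec; yes; no; True; toWitness; from-yes; from-no; ¬?; _⊎-dec_; _×-dec_)
open import Relation.Nullary.Negation using (¬_; contradiction)

-- By `K-value`, `K x` is an injective function of the pair of `x`, so `K^ (t + 1) x` is the
-- non-zero constant exactly when the pair at time `t` is fixed. Hence, in base `5 k`, `M_b` is one
-- more than the longest time that a pair needs.
--
-- The obstacle is that many orbits never reach the fixed pair. The upper bounds are therefore
-- conditional (`Within`): a configuration on another cycle satisfies every bound, and such cycles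
-- cut off some of the possible chains of runs.
--
-- The sign in `T x ≡ ± 2 x` is unpredictable, so along tent steps only the square modulo 5 is
-- followed, but merges and bounces shift entries by 1 and need the residue itself. It is available
-- because an entry that starts a later run is a multiple `c k` of `k = 2 ^ n`, and class and parity
-- leave only one `c`.
--
-- In bases 2 and 4 the exceptional steps have fixed pairs of their own; these bases are settled by
-- evaluation.

private
  variable
    A : Set

iterate-+ : ∀ (f : A → A) x i j → iterate f x (i + j) ≡ iterate f (iterate f x i) j
iterate-+ f x zero    j = refl
iterate-+ f x (suc i) j = iterate-+ f (f x) i j

iterate-suc : ∀ (f : A → A) x i → iterate f x (suc i) ≡ f (iterate f x i)
iterate-suc f x i = trans (cong (iterate f x) (+-comm 1 i)) (iterate-+ f x i 1)

-- Residues modulo 5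

-- Squares separate the residues ±1, ±2 and 0 modulo 5, and are blind to signs.
cls : ℕ → ℕ
cls x = x * x % 5

neg : ℕ → ℕ
neg c = 4 * c % 5

residues : ∀ x → x % 5 ≡ 0 ⊎ x % 5 ≡ 1 ⊎ x % 5 ≡ 2 ⊎ x % 5 ≡ 3 ⊎ x % 5 ≡ 4
residues x with x % 5 | m%n<n x 5
... | 0 | _ = inj₁ refl
... | 1 | _ = inj₂ (inj₁ refl)
... | 2 | _ = inj₂ (inj₂ (inj₁ refl))
... | 3 | _ = inj₂ (inj₂ (inj₂ (inj₁ refl)))
... | 4 | _ = inj₂ (inj₂ (inj₂ (inj₂ refl)))
... | suc (suc (suc (suc (suc _)))) | s≤s (s≤s (s≤s (s≤s (s≤s ()))))

≡-mod5 : ∀ {x y} a b → x + a * 5 ≡ y + b * 5 → x % 5 ≡ y % 5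
≡-mod5 {x} {y} a b eq = trans (sym ([m+kn]%n≡m%n x a 5))
  (trans (cong (_% 5) eq) ([m+kn]%n≡m%n y b 5))

cls-% : ∀ x → cls x ≡ cls (x % 5)
cls-% x = %-distribˡ-* x x 5

cls-+5* : ∀ r q → cls (r + q * 5) ≡ cls r
cls-+5* r q = trans (cls-% (r + q * 5)) (trans (cong cls ([m+kn]%n≡m%n r q 5)) (sym (cls-% r)))

-- Merges and bounces replace an entry by its neighbours, whose classes depend on the residue of the
-- entry and not only on its class.
neighbours : ∀ r p → p % 5 ≡ suc r →
             cls (p ∸ 1) ≡ cls r × cls p ≡ cls (suc r) × cls (suc p) ≡ cls (2 + r) × suc (p ∸ 1) ≡ p
neighbours r p eq with p / 5 | trans (m≡m%n+[m/n]*n p 5) (cong (_+ p / 5 * 5) eq)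
... | q | refl = cls-+5* r q , cls-+5* (suc r) q , cls-+5* (2 + r) q , refl

cls-cases : ∀ x → cls x ≡ 0 ⊎ cls x ≡ 1 ⊎ cls x ≡ 4
cls-cases x with x % 5 | cls-% x | residues x
... | _ | eq | inj₁ refl                             = inj₁ eq
... | _ | eq | inj₂ (inj₁ refl)                      = inj₂ (inj₁ eq)
... | _ | eq | inj₂ (inj₂ (inj₁ refl))               = inj₂ (inj₂ eq)
... | _ | eq | inj₂ (inj₂ (inj₂ (inj₁ refl)))        = inj₂ (inj₂ eq)
... | _ | eq | inj₂ (inj₂ (inj₂ (inj₂ refl)))        = inj₂ (inj₁ eq)

5-prime : Prime 5
5-prime = from-yes (prime? 5)

cls≡0⇒5∣ : ∀ x → cls x ≡ 0 → 5 ∣ x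
cls≡0⇒5∣ x eq = [ id , id ]′ (euclidsLemma x x 5-prime (m%n≡0⇒n∣m (x * x) 5 eq))

5∣⇒cls≡0 : ∀ {x} → 5 ∣ x → cls x ≡ 0
5∣⇒cls≡0 (divides q refl) = cls-+5* 0 q

cls-* : ∀ x y → cls (x * y) ≡ cls x * cls y % 5
cls-* x y = trans (cong (_% 5) (lemma x y)) (%-distribˡ-* (x * x) (y * y) 5)
  where
  lemma : ∀ x y → x * y * (x * y) ≡ x * x * (y * y)
  lemma = solve-∀

neg-cls : ∀ x → neg (cls x) ≡ 4 * (x * x) % 5
neg-cls x = sym (%-distribˡ-* 4 (x * x) 5)

cls-∸ : ∀ {b x} → 5 ∣ b → x ≤ b → cls (b ∸ x) ≡ cls x
cls-∸ {b} {x} (divides q refl) x≤b = ≡-mod5 (2 * x * q) (q * q * 5) (begin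
  y * y + 2 * x * q * 5           ≡⟨ l₁ x y q ⟩
  y * y + 2 * x * (q * 5)         ≡⟨ cong (λ z → y * y + 2 * x * z) (m∸n+n≡m x≤b) ⟨
  y * y + 2 * x * (y + x)         ≡⟨ l₂ x y ⟩
  x * x + (y + x) * (y + x)       ≡⟨ cong (λ z → x * x + z * z) (m∸n+n≡m x≤b) ⟩
  x * x + q * 5 * (q * 5)         ≡⟨ l₃ x q ⟩
  x * x + q * q * 5 * 5           ∎)
  where
  open ≡-Reasoning
  y = q * 5 ∸ x
  l₁ : ∀ x y q → y * y + 2 * x * q * 5 ≡ y * y + 2 * x * (q * 5)
  l₁ = solve-∀
  l₂ : ∀ x y → y * y + 2 * x * (y + x) ≡ x * x + (y + x) * (y + x)
  l₂ = solve-∀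
  l₃ : ∀ x q → x * x + q * 5 * (q * 5) ≡ x * x + q * q * 5 * 5
  l₃ = solve-∀

2∣2^ : ∀ {n} → 0 < n → 2 ∣ 2 ^ n
2∣2^ {suc n} _ = m∣m*n (2 ^ n)

5∣2^*⇒5∣ : ∀ a x → 5 ∣ 2 ^ a * x → 5 ∣ x
5∣2^*⇒5∣ zero    x h = subst (5 ∣_) (*-identityˡ x) h
5∣2^*⇒5∣ (suc a) x h with euclidsLemma 2 (2 ^ a * x) 5-prime (subst (5 ∣_) (*-assoc 2 (2 ^ a) x) h)
... | inj₁ 5∣2 = contradiction 5∣2 (from-no (5 ∣? 2))
... | inj₂ h′  = 5∣2^*⇒5∣ a x h′

5*2^∣ : ∀ a {x} → 5 ∣ x → 2 ^ a ∣ x → 5 * 2 ^ a ∣ x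
5*2^∣ a 5∣x (divides w refl) =
  *-pres-∣ (5∣2^*⇒5∣ a w (subst (5 ∣_) (*-comm w (2 ^ a)) 5∣x)) (∣-refl {2 ^ a})

∣∧<⇒≡0 : ∀ {d x} → d ∣ x → x < d → x ≡ 0
∣∧<⇒≡0 {x = zero}  _   _   = refl
∣∧<⇒≡0 {x = suc x} d∣x x<d = contradiction (∣⇒≤ d∣x) (<⇒≱ x<d)

-- The tent map

T : ℕ → ℕ → ℕ
T B x = ∣ 2 * x - B ∣

T^ : ℕ → ℕ → ℕ → ℕ
T^ B i x = iterate (T B) x i

∣-∣-cases : ∀ a b → a ≡ b + ∣ a - b ∣ ⊎ a + ∣ a - b ∣ ≡ b
∣-∣-cases a b with ≤-total a b
... | inj₁ a≤b = inj₂ (trans (cong (a +_) (m≤n⇒∣m-n∣≡n∸m a≤b)) (m+[n∸m]≡n a≤b))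
... | inj₂ b≤a = inj₁ (sym (trans (cong (b +_) (m≤n⇒∣n-m∣≡n∸m b≤a)) (m+[n∸m]≡n b≤a)))

∣m+n-m∣≡n : ∀ m n → ∣ m + n - m ∣ ≡ n
∣m+n-m∣≡n m n = trans (∣-∣-comm (m + n) m) (∣m-m+n∣≡n m n)

∣-∣-square : ∀ a b → ∣ a - b ∣ * ∣ a - b ∣ + 2 * a * b ≡ a * a + b * b
∣-∣-square a b with ∣ a - b ∣ | ∣-∣-cases a b
... | d | inj₁ refl = lemma b d
  where
  lemma : ∀ b d → d * d + 2 * (b + d) * b ≡ (b + d) * (b + d) + b * b
  lemma = solve-∀
... | d | inj₂ refl = lemma a d
  where
  lemma : ∀ a d → d * d + 2 * a * (a + d) ≡ a * a + (a + d) * (a + d)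
  lemma = solve-∀

T-cases : ∀ B x → 2 * x ≡ B + T B x ⊎ 2 * x + T B x ≡ B
T-cases B x = ∣-∣-cases (2 * x) B

T-above : ∀ {B} x {s} → 2 * x ≡ B + s → T B x ≡ s
T-above {B} x {s} eq = trans (cong (∣_- B ∣) eq) (∣m+n-m∣≡n B s)

T-below : ∀ {B} x {s} → 2 * x + s ≡ B → T B x ≡ s
T-below {B} x {s} eq = trans (cong (∣ 2 * x -_∣) (sym eq)) (∣m-m+n∣≡n (2 * x) s)

T-scale : ∀ c B x → T (c * B) (c * x) ≡ c * T B x
T-scale c B x = trans (cong (∣_- c * B ∣) (lemma c x)) (sym (*-distribˡ-∣-∣ c (2 * x) B))
  where
  lemma : ∀ c x → 2 * (c * x) ≡ c * (2 * x)
  lemma = solve-∀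

T^-scale : ∀ c B i x → T^ (c * B) i (c * x) ≡ c * T^ B i x
T^-scale c B zero    x = refl
T^-scale c B (suc i) x =
  trans (cong (T^ (c * B) i) (T-scale c B x)) (T^-scale c B i (T B x))

-- The point 0 has to be excluded, as `T B 0` is `B`.
T-< : ∀ {B x} → 0 < x → x < B → T B x < B
T-< {B} {x} 0<x x<B with T-cases B x
... | inj₁ eq = +-cancelˡ-< B (T B x) B (begin-strict
  B + T B x ≡⟨ eq ⟨
  2 * x     <⟨ *-monoʳ-< 2 x<B ⟩
  2 * B     ≡⟨ cong (B +_) (+-identityʳ B) ⟩
  B + B     ∎)
  where open ≤-Reasoning
... | inj₂ eq = begin-strict
  T B x         <⟨ m<n+m (T B x) {2 * x} (≤-trans 0<x (m≤m+n x (x + 0))) ⟩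
  2 * x + T B x ≡⟨ eq ⟩
  B             ∎
  where open ≤-Reasoning

T-even : ∀ {B} x → 2 ∣ B → 2 ∣ T B x
T-even {B} x 2∣B with T-cases B x
... | inj₁ eq = ∣m+n∣m⇒∣n (subst (2 ∣_) eq (m∣m*n x)) 2∣B
... | inj₂ eq = ∣m+n∣m⇒∣n (subst (2 ∣_) (sym eq) 2∣B) (m∣m*n x)

-- T x ≡ ± 2 x modulo 5, and 4 = - 1 exchanges the squares 1 and 4.
cls-T : ∀ {B} x → 5 ∣ B → cls (T B x) ≡ neg (cls x)
cls-T {B} x (divides q refl) =
  trans (≡-mod5 (4 * x * q) (q * q * 5) (trans (l₁ (T B x) x q) (trans (∣-∣-square (2 * x) B) (l₂ x q))))
    (sym (neg-cls x))
  where
  l₁ : ∀ t x q → t * t + 4 * x * q * 5 ≡ t * t + 2 * (2 * x) * (q * 5)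
  l₁ = solve-∀
  l₂ : ∀ x q → 2 * x * (2 * x) + q * 5 * (q * 5) ≡ 4 * (x * x) + q * q * 5 * 5
  l₂ = solve-∀

neg^-0 : ∀ i → iterate neg 0 i ≡ 0
neg^-0 zero    = refl
neg^-0 (suc i) = neg^-0 i

cls-T^ : ∀ {B} → 5 ∣ B → ∀ i x → cls (T^ B i x) ≡ iterate neg (cls x) i
cls-T^ 5∣B zero    x = refl
cls-T^ {B} 5∣B (suc i) x =
  trans (cls-T^ 5∣B i (T B x)) (cong (λ c → iterate neg c i) (cls-T x 5∣B))

-- `T x` and `T y` are the absolute values of `2 x - B` and `2 y - B`, whose difference is
-- `2 (x - y)`. Opposite signs give the first alternative, equal signs the second.
T-diff : ∀ B x y → 2 * ∣ x - y ∣ ≡ T B x + T B y ⊎ 2 * ∣ x - y ∣ ≡ ∣ T B x - T B y ∣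
T-diff B x y with T B x | T-cases B x | T B y | T-cases B y
... | s | inj₁ p | t | inj₁ q = inj₂ (trans (*-distribˡ-∣-∣ 2 x y)
  (trans (cong₂ ∣_-_∣ p q) (∣m+n-m+o∣≡∣n-o∣ B s t)))
... | s | inj₂ p | t | inj₂ q = inj₂ (trans (*-distribˡ-∣-∣ 2 x y) (begin
  ∣ 2 * x - 2 * y ∣                           ≡⟨ ∣m+n-m+o∣≡∣n-o∣ s (2 * x) (2 * y) ⟨
  ∣ s + 2 * x - s + 2 * y ∣                   ≡⟨ cong (∣_- s + 2 * y ∣) eq ⟩
  ∣ 2 * y + t - s + 2 * y ∣                   ≡⟨ cong (∣ 2 * y + t -_∣) (+-comm s (2 * y)) ⟩
  ∣ 2 * y + t - 2 * y + s ∣                   ≡⟨ ∣m+n-m+o∣≡∣n-o∣ (2 * y) t s ⟩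
  ∣ t - s ∣                                   ≡⟨ ∣-∣-comm t s ⟩
  ∣ s - t ∣                                   ∎))
  where
  open ≡-Reasoning
  eq : s + 2 * x ≡ 2 * y + t
  eq = trans (+-comm s (2 * x)) (trans p (sym q))
... | s | inj₁ p | t | inj₂ q = inj₁ (trans (*-distribˡ-∣-∣ 2 x y)
  (trans (cong (∣_- 2 * y ∣) (trans p (trans (cong (_+ s) (sym q)) (lemma y t s)))) (∣m+n-m∣≡n (2 * y) (s + t))))
  where
  lemma : ∀ y t s → 2 * y + t + s ≡ 2 * y + (s + t)
  lemma = solve-∀
... | s | inj₂ p | t | inj₁ q = inj₁ (trans (*-distribˡ-∣-∣ 2 x y)
  (trans (cong (∣ 2 * x -_∣) (trans q (trans (cong (_+ t) (sym p)) (+-assoc (2 * x) s t)))) (∣m-m+n∣≡n (2 * x) (s + t))))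

-- The signed numbers `2 x - B` and `2 y - B` add up to `2 (x + y - B)`; now equal signs give the
-- first alternative.
T-sum : ∀ B x y → 2 * ∣ x + y - B ∣ ≡ T B x + T B y ⊎ 2 * ∣ x + y - B ∣ ≡ ∣ T B x - T B y ∣
T-sum B x y with T B x | T-cases B x | T B y | T-cases B y
... | s | inj₁ p | t | inj₁ q = inj₁ (trans (*-distribˡ-∣-∣ 2 (x + y) B)
  (trans (cong (∣_- 2 * B ∣) (trans (*-distribˡ-+ 2 x y) (trans (cong₂ _+_ p q) (lemma B s t)))) (∣m+n-m∣≡n (2 * B) (s + t))))
  where
  lemma : ∀ B s t → B + s + (B + t) ≡ 2 * B + (s + t)
  lemma = solve-∀
... | s | inj₂ p | t | inj₂ q = inj₁ (trans (*-distribˡ-∣-∣ 2 (x + y) B)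
  (trans (cong (∣ 2 * (x + y) -_∣) (trans (l₁ B) (trans (cong₂ _+_ (sym p) (sym q)) (l₂ x y s t)))) (∣m-m+n∣≡n (2 * (x + y)) (s + t))))
  where
  l₁ : ∀ B → 2 * B ≡ B + B
  l₁ = solve-∀
  l₂ : ∀ x y s t → 2 * x + s + (2 * y + t) ≡ 2 * (x + y) + (s + t)
  l₂ = solve-∀
... | s | inj₁ p | t | inj₂ q = inj₂ (trans (*-distribˡ-∣-∣ 2 (x + y) B) (begin
  ∣ 2 * (x + y) - 2 * B ∣               ≡⟨ cong (∣_- 2 * B ∣) (trans (*-distribˡ-+ 2 x y) (cong (_+ 2 * y) p)) ⟩
  ∣ B + s + 2 * y - 2 * B ∣             ≡⟨ cong (λ z → ∣ B + s + 2 * y - B + z ∣) (trans (+-identityʳ B) (sym q)) ⟩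
  ∣ B + s + 2 * y - B + (2 * y + t) ∣   ≡⟨ cong₂ ∣_-_∣ (lemma B s y) (sym (+-assoc B (2 * y) t)) ⟩
  ∣ B + 2 * y + s - B + 2 * y + t ∣     ≡⟨ ∣m+n-m+o∣≡∣n-o∣ (B + 2 * y) s t ⟩
  ∣ s - t ∣                             ∎))
  where
  open ≡-Reasoning
  lemma : ∀ B s y → B + s + 2 * y ≡ B + 2 * y + s
  lemma = solve-∀
... | s | inj₂ p | t | inj₁ q = inj₂ (trans (*-distribˡ-∣-∣ 2 (x + y) B) (begin
  ∣ 2 * (x + y) - 2 * B ∣               ≡⟨ cong (∣_- 2 * B ∣) (trans (*-distribˡ-+ 2 x y) (cong (2 * x +_) q)) ⟩
  ∣ 2 * x + (B + t) - 2 * B ∣           ≡⟨ cong (λ z → ∣ 2 * x + (B + t) - B + z ∣) (trans (+-identityʳ B) (sym p)) ⟩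
  ∣ 2 * x + (B + t) - B + (2 * x + s) ∣ ≡⟨ cong₂ ∣_-_∣ (lemma B t x) (sym (+-assoc B (2 * x) s)) ⟩
  ∣ B + 2 * x + t - B + 2 * x + s ∣     ≡⟨ ∣m+n-m+o∣≡∣n-o∣ (B + 2 * x) t s ⟩
  ∣ t - s ∣                             ≡⟨ ∣-∣-comm t s ⟩
  ∣ s - t ∣                             ∎))
  where
  open ≡-Reasoning
  lemma : ∀ B t x → 2 * x + (B + t) ≡ B + 2 * x + t
  lemma = solve-∀

-- The Kaprekar map on pairs of digit differences

State : Set
State = ℕ × ℕ

infix 4 _~_

_~_ : State → State → Set
s ~ s′ = s ≡ s′ ⊎ s ≡ swap s′

~-sym : ∀ {s s′} → s ~ s′ → s′ ~ s
~-sym (inj₁ refl) = inj₁ refl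
~-sym (inj₂ refl) = inj₂ refl

~-trans : ∀ {s s′ s″} → s ~ s′ → s′ ~ s″ → s ~ s″
~-trans (inj₁ refl) q           = q
~-trans (inj₂ refl) (inj₁ refl) = inj₂ refl
~-trans (inj₂ refl) (inj₂ refl) = inj₁ refl

-- The successor of a pair (x , y) with T x ≡ T y ≡ u.
merge : ℕ → State
merge zero    = 1 , 1
merge (suc u) = 2 + u , u

-- The successor of the pairs (0 , p) and (p , 0) in base B.
bounce : ℕ → ℕ → State
bounce B p = p ∸ 1 , B ∸ p

-- For sorted digits a ≤ b ≤ c ≤ d the Kaprekar map only depends on the pair
-- (d - a , c - b), and G describes its action on such (unordered) pairs.
G : ℕ → State → State
G B (zero  , zero)  = 0 , 0
G B (zero  , suc y) = bounce B (suc y)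
G B (suc x , zero)  = bounce B (suc x)
G B (suc x , suc y) with T B (suc x) ≟ T B (suc y)
... | yes _ = merge (T B (suc x))
... | no  _ = T B (suc x) , T B (suc y)

G^ : ℕ → ℕ → State → State
G^ B i s = iterate (G B) s i

G-pure : ∀ B x y → x ≢ 0 → y ≢ 0 → T B x ≢ T B y → G B (x , y) ≡ (T B x , T B y)
G-pure B zero    y       x≢0 _   _   = contradiction refl x≢0
G-pure B (suc x) zero    _   y≢0 _   = contradiction refl y≢0
G-pure B (suc x) (suc y) _   _   t≢t with T B (suc x) ≟ T B (suc y)
... | yes t≡t = contradiction t≡t t≢t
... | no  _   = refl

G-merge : ∀ B x y → x ≢ 0 → y ≢ 0 → T B x ≡ T B y → G B (x , y) ≡ merge (T B x)
G-merge B zero    y       x≢0 _   _   = contradiction refl x≢0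
G-merge B (suc x) zero    _   y≢0 _   = contradiction refl y≢0
G-merge B (suc x) (suc y) _   _   t≡t with T B (suc x) ≟ T B (suc y)
... | yes _   = refl
... | no  t≢t = contradiction t≡t t≢t

G-bounceˡ : ∀ B p → p ≢ 0 → G B (0 , p) ≡ bounce B p
G-bounceˡ B zero    p≢0 = contradiction refl p≢0
G-bounceˡ B (suc p) _   = refl

G-bounceʳ : ∀ B p → p ≢ 0 → G B (p , 0) ≡ bounce B p
G-bounceʳ B zero    p≢0 = contradiction refl p≢0
G-bounceʳ B (suc p) _   = refl

G-swap : ∀ B s → G B (swap s) ~ G B s
G-swap B (zero  , zero)  = inj₁ refl
G-swap B (zero  , suc y) = inj₁ refl
G-swap B (suc x , zero)  = inj₁ refl
G-swap B (suc x , suc y) with T B (suc x) ≟ T B (suc y)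
... | yes t≡t = inj₁ (trans (G-merge B (suc y) (suc x) (λ ()) (λ ()) (sym t≡t)) (cong merge (sym t≡t)))
... | no  t≢t = inj₂ (G-pure B (suc y) (suc x) (λ ()) (λ ()) (≢-sym t≢t))

G-~ : ∀ B {s s′} → s ~ s′ → G B s ~ G B s′
G-~ B (inj₁ refl)      = inj₁ refl
G-~ B {s′ = s} (inj₂ refl) = G-swap B s

G^-~ : ∀ B i {s s′} → s ~ s′ → G^ B i s ~ G^ B i s′
G^-~ B zero    s~s′ = s~s′
G^-~ B (suc i) s~s′ = G^-~ B i (G-~ B s~s′)

G^-pure : ∀ {B} i x y →
  (∀ j → j < i → T^ B j x ≢ 0 × T^ B j y ≢ 0 × T^ B (suc j) x ≢ T^ B (suc j) y) →
  G^ B i (x , y) ≡ (T^ B i x , T^ B i y)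
G^-pure zero    x y h = refl
G^-pure {B} (suc i) x y h with h 0 z<s
... | x≢0 , y≢0 , t≢t =
  trans (cong (G^ B i) (G-pure B x y x≢0 y≢0 t≢t))
        (G^-pure i (T B x) (T B y) (λ j j<i → h (suc j) (s<s j<i)))

-- In base 5 k the non-zero fixed point of the Kaprekar map belongs to the
-- 2-cycle k ↔ 3 k of the tent map.
Fixed : ℕ → State → Set
Fixed k s = s ~ (3 * k , k)

T-k : ∀ k → T (5 * k) k ≡ 3 * k
T-k k = T-below k (lemma k)
  where
  lemma : ∀ k → 2 * k + 3 * k ≡ 5 * k
  lemma k = sym (*-distribʳ-+ k 2 3)

T-3k : ∀ k → T (5 * k) (3 * k) ≡ k
T-3k k = T-above (3 * k) (trans (sym (*-assoc 2 3 k)) (+-comm k (5 * k)))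

k≢3k : ∀ {k} .{{_ : NonZero k}} → k ≢ 3 * k
k≢3k {k@(suc _)} eq = m+1+n≢m k (sym eq)

3k≢0 : ∀ {k} .{{_ : NonZero k}} → 3 * k ≢ 0
3k≢0 {suc _} ()

module _ {k : ℕ} .{{_ : NonZero k}} where

  private
    B = 5 * k

  fixed-G : ∀ {s} → Fixed k s → Fixed k (G B s)
  fixed-G {s} fx = ~-trans (G-~ B fx) (inj₂ (trans
    (G-pure B (3 * k) k 3k≢0 (≢-nonZero⁻¹ k) (λ eq → k≢3k (trans (sym (T-3k k)) (trans eq (T-k k)))))
    (cong₂ _,_ (T-3k k) (T-k k))))

  fixed-G^ : ∀ i {s} → Fixed k s → Fixed k (G^ B i s)
  fixed-G^ zero    fx = fx
  fixed-G^ (suc i) fx = fixed-G^ i (fixed-G fx)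

  fixed-≤ : ∀ {i j s} → i ≤ j → Fixed k (G^ B i s) → Fixed k (G^ B j s)
  fixed-≤ {i} {j} {s} i≤j fx = subst (Fixed k)
    (trans (sym (iterate-+ (G B) s i (j ∸ i))) (cong (λ t → G^ B t s) (m+[n∸m]≡n i≤j)))
    (fixed-G^ (j ∸ i) fx)

-- Conditional bounds on the time to reach the fixed pair

record Within (k N : ℕ) (s : State) : Set where
  constructor within
  field reach : ∀ t → Fixed k (G^ (5 * k) t s) → Fixed k (G^ (5 * k) N s)

open Within public

module _ {k : ℕ} .{{_ : NonZero k}} where

  private
    B = 5 * k

  within-≤ : ∀ {N N′ s} → N ≤ N′ → Within k N s → Within k N′ s
  within-≤ {s = s} N≤N′ w = within λ t fx → fixed-≤ {s = s} N≤N′ (reach w t fx)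

  within-reach : ∀ {N s} → Fixed k (G^ B N s) → Within k N s
  within-reach fx = within λ _ _ → fx

  within-G^ : ∀ i {N s s′} → G^ B i s ≡ s′ → Within k N s′ → Within k (i + N) s
  within-G^ i {N} {s} refl w = within λ t fx → subst (Fixed k) (sym (iterate-+ (G B) s i N))
    (reach w t (subst (Fixed k) (iterate-+ (G B) s i t) (fixed-≤ {s = s} (m≤n+m t i) fx)))

  within-step : ∀ {N s s′} → G B s ≡ s′ → Within k N s′ → Within k (suc N) s
  within-step = within-G^ 1

  within-swap : ∀ {N x y} → Within k N (x , y) → Within k N (y , x)
  within-swap {N} w = within λ t fx →
    ~-trans (G^-~ B N (inj₂ refl)) (reach w t (~-trans (G^-~ B t (inj₂ refl)) fx))

  G^-* : ∀ r {s} → G^ B r s ≡ s → ∀ m → G^ B (m * r) s ≡ s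
  G^-* r eq zero    = refl
  G^-* r {s} eq (suc m) =
    trans (iterate-+ (G B) s r (m * r)) (trans (cong (G^ B (m * r)) eq) (G^-* r eq m))

  -- The fixed pair is never left again, but a cycle returns to `s` at arbitrarily late times, so
  -- the condition in `Within` fails and every `N` will do.
  within-cycle : ∀ r {N s} → G^ B (suc r) s ≡ s → ¬ Fixed k s → Within k N s
  within-cycle r {s = s} eq ¬fx = within λ t fx →
    contradiction (subst (Fixed k) (G^-* (suc r) eq t) (fixed-≤ {s = s} (m≤m*n t (suc r)) fx)) ¬fx

-- From four-digit numbers to pairs

gaps : List ℕ → State
gaps (a ∷ b ∷ c ∷ d ∷ []) = d ∸ a , c ∸ b
gaps _                    = 0 , 0

data Sorted₄ (B : ℕ) : List ℕ → Set where
  sorted₄ : ∀ {a b c d} → a ≤ b → b ≤ c → c ≤ d → d < B → Sorted₄ B (a ∷ b ∷ c ∷ d ∷ [])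

mkSorted₄ : ∀ {B xs} → Sorted ≤-totalOrder xs → length xs ≡ 4 → All (_< B) xs → Sorted₄ B xs
mkSorted₄ (a≤b ∷ b≤c ∷ c≤d ∷ [-]) refl (_ ∷ _ ∷ _ ∷ d<B ∷ []) = sorted₄ a≤b b≤c c≤d d<B

ascending-unique : ∀ {xs a b c d} → xs ↭ a ∷ b ∷ c ∷ d ∷ [] → a ≤ b → b ≤ c → c ≤ d →
                   ascending xs ≡ a ∷ b ∷ c ∷ d ∷ []
ascending-unique {xs} p a≤b b≤c c≤d = Pointwise-≡⇒≡
  (↗↭↗⇒≋ ≤-totalOrder (sort-↗ xs) (a≤b ∷ b≤c ∷ c≤d ∷ [-]) (↭⇒↭ₛ (↭-trans (sort-↭ xs) p)))

m*n+o/n : ∀ m n {o} .{{_ : NonZero n}} → o < n → (m * n + o) / n ≡ m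
m*n+o/n m n {o} o<n = begin
  (m * n + o) / n     ≡⟨ +-distrib-/-∣ˡ o (n∣m*n m) ⟩
  m * n / n + o / n   ≡⟨ cong₂ _+_ (m*n/n≡m m n) (m<n⇒m/n≡0 o<n) ⟩
  m + 0               ≡⟨ +-identityʳ m ⟩
  m                   ∎
  where open ≡-Reasoning

m*n+o%n : ∀ m n {o} .{{_ : NonZero n}} → o < n → (m * n + o) % n ≡ o
m*n+o%n m n {o} o<n = trans (%-remove-+ˡ o (n∣m*n m)) (m<n⇒m%n≡m o<n)

m*n+o<l*n : ∀ {m n o l} → m < l → o < n → m * n + o < l * n
m*n+o<l*n {m} {n} {o} {l} m<l o<n = begin-strict
  m * n + o   <⟨ +-monoʳ-< (m * n) o<n ⟩
  m * n + n   ≡⟨ +-comm (m * n) n ⟩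
  suc m * n   ≤⟨ *-monoˡ-≤ n m<l ⟩
  l * n       ∎
  where open ≤-Reasoning

-- The value of `K` in terms of the pair

module _ (B : ℕ) .{{_ : NonZero B}} where

  pair : ℕ → State
  pair x = gaps (ascending (digits B x))

  digits-fromDigits : ∀ {a b c d} → a < B → b < B → c < B → d < B →
    digits B (fromDigits B (a ∷ b ∷ c ∷ d ∷ [])) ≡ a ∷ b ∷ c ∷ d ∷ []
  digits-fromDigits {a} {b} {c} {d} a< b< c< d<
    rewrite m*n+o/n ((a * B + b) * B + c) B d< | m*n+o%n ((a * B + b) * B + c) B d<
          | m*n+o/n (a * B + b) B c< | m*n+o%n (a * B + b) B c<
          | m*n+o/n a B b< | m*n+o%n a B b<
          | m<n⇒m%n≡m a< = refl

  fromDigits-< : ∀ {a b c d} → a < B → b < B → c < B → d < B →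
    fromDigits B (a ∷ b ∷ c ∷ d ∷ []) < B ^ 4
  fromDigits-< {a} {b} {c} {d} a< b< c< d< = subst (((a * B + b) * B + c) * B + d <_) (lemma B)
    (m*n+o<l*n (m*n+o<l*n (m*n+o<l*n a< b<) c<) d<)
    where
    lemma : ∀ b → b * b * b * b ≡ b * (b * (b * (b * 1)))
    lemma = solve-∀

  gaps-digits : ∀ {x xs a b c d} → digits B x ≡ xs → xs ↭ a ∷ b ∷ c ∷ d ∷ [] →
                a ≤ b → b ≤ c → c ≤ d → pair x ≡ (d ∸ a , c ∸ b)
  gaps-digits refl p a≤b b≤c c≤d = cong gaps (ascending-unique p a≤b b≤c c≤d)

  ascending-digits : ∀ x → Sorted₄ B (ascending (digits B x))
  ascending-digits x = mkSorted₄ (sort-↗ xs) (↭-length (sort-↭ xs))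
    (All-resp-↭ (↭-sym (sort-↭ xs)) (m%n<n _ B ∷ m%n<n _ B ∷ m%n<n _ B ∷ m%n<n _ B ∷ []))
    where xs = digits B x

  value : State → ℕ
  value (p , q) = p * (B * B * B ∸ 1) + q * ((B ∸ 1) * B)

  B³-1 : suc (B * B * B ∸ 1) ≡ B * B * B
  B³-1 = m+[n∸m]≡n (>-nonZero⁻¹ (B * B * B) {{m*n≢0 (B * B) B {{m*n≢0 B B}}}})

  B²-B : (B ∸ 1) * B + B ≡ B * B
  B²-B = trans (+-comm ((B ∸ 1) * B) B) (cong (_* B) (m+[n∸m]≡n (>-nonZero⁻¹ B)))

  -- The subtracted parts of `B³ - 1` and `B² - B` are moved to the left, which leaves an identity
  -- without truncated subtraction for the ring solver.
  value-spec : ∀ p q → value (p , q) + (p + q * B) ≡ p * (B * B * B) + q * (B * B)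
  value-spec p q = begin
    p * M + q * L + (p + q * B)    ≡⟨ lemma p q M L B ⟩
    p * suc M + q * (L + B)        ≡⟨ cong₂ (λ u v → p * u + q * v) B³-1 B²-B ⟩
    p * (B * B * B) + q * (B * B)  ∎
    where
    open ≡-Reasoning
    M = B * B * B ∸ 1
    L = (B ∸ 1) * B
    lemma : ∀ p q M L B → p * M + q * L + (p + q * B) ≡ p * suc M + q * (L + B)
    lemma = solve-∀

  value-unique : ∀ p q v → v + (p + q * B) ≡ p * (B * B * B) + q * (B * B) → v ≡ value (p , q)
  value-unique p q v eq = +-cancelʳ-≡ (p + q * B) _ _ (trans eq (sym (value-spec p q)))

  K-value : ∀ x → K B x ≡ value (pair x)
  K-value x with ascending (digits B x) | ascending-digits x
  ... | a ∷ b ∷ c ∷ d ∷ [] | sorted₄ a≤b b≤c c≤d _ = value-unique (d ∸ a) (c ∸ b) _ (begin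
    hi ∸ lo + (p + q * B)                                      ≡⟨ cong (λ h → h ∸ lo + (p + q * B)) hi≡ ⟩
    lo + value (p , q) ∸ lo + (p + q * B)                      ≡⟨ cong (_+ (p + q * B)) (m+n∸m≡n lo (value (p , q))) ⟩
    value (p , q) + (p + q * B)                                ≡⟨ value-spec p q ⟩
    p * (B * B * B) + q * (B * B)                              ∎)
    where
    open ≡-Reasoning
    p  = d ∸ a
    q  = c ∸ b
    hi = ((d * B + c) * B + b) * B + a
    lo = ((a * B + b) * B + c) * B + d
    lemma : ∀ a b p q B →
      (((a + p) * B + (b + q)) * B + b) * B + a + (p + q * B) ≡
      ((a * B + b) * B + (b + q)) * B + (a + p) + (p * (B * B * B) + q * (B * B))
    lemma = solve-∀
    d≡ : a + p ≡ d
    d≡ = m+[n∸m]≡n (≤-trans a≤b (≤-trans b≤c c≤d))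
    c≡ : b + q ≡ c
    c≡ = m+[n∸m]≡n b≤c
    hi≡ : hi ≡ lo + value (p , q)
    hi≡ = +-cancelʳ-≡ (p + q * B) _ _ (begin
      hi + (p + q * B)                          ≡⟨ cong₂ (λ c d → ((d * B + c) * B + b) * B + a + (p + q * B)) c≡ d≡ ⟨
      (((a + p) * B + (b + q)) * B + b) * B + a + (p + q * B) ≡⟨ lemma a b p q B ⟩
      ((a * B + b) * B + (b + q)) * B + (a + p) + (p * (B * B * B) + q * (B * B)) ≡⟨ cong₂ (λ c d → ((a * B + b) * B + c) * B + d + (p * (B * B * B) + q * (B * B))) c≡ d≡ ⟩
      lo + (p * (B * B * B) + q * (B * B))      ≡⟨ cong (lo +_) (value-spec p q) ⟨
      lo + (value (p , q) + (p + q * B))        ≡⟨ +-assoc lo _ _ ⟨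
      lo + value (p , q) + (p + q * B)          ∎)

  pair-ordered : ∀ x → proj₂ (pair x) ≤ proj₁ (pair x)
  pair-ordered x with ascending (digits B x) | ascending-digits x
  ... | a ∷ b ∷ c ∷ d ∷ [] | sorted₄ a≤b _ c≤d _ = ∸-mono c≤d a≤b

  pair-< : ∀ x → proj₁ (pair x) < B
  pair-< x with ascending (digits B x) | ascending-digits x
  ... | a ∷ b ∷ c ∷ d ∷ [] | sorted₄ _ _ _ d<B = ≤-<-trans (m∸n≤m d a) d<B

  -- Supplies a number for every unordered pair, so that lower bounds can be found on pairs.
  pair-fromDigits₂ : ∀ x y → x < B → y < B → pair (fromDigits B (x ∷ y ∷ 0 ∷ 0 ∷ [])) ~ (x , y)
  pair-fromDigits₂ x y x<B y<B = [ below , above ]′ (≤-total x y)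
    where
    0<B : 0 < B
    0<B = >-nonZero⁻¹ B
    eq : digits B (fromDigits B (x ∷ y ∷ 0 ∷ 0 ∷ [])) ≡ x ∷ y ∷ 0 ∷ 0 ∷ []
    eq = digits-fromDigits x<B y<B 0<B 0<B
    rot : ∀ {u v} → u ∷ v ∷ 0 ∷ 0 ∷ [] ↭ 0 ∷ 0 ∷ u ∷ v ∷ []
    rot {u} {v} = ↭-trans (↭-prep u (↭-trans (↭-swap v 0 ↭-refl) (↭-prep 0 (↭-swap v 0 ↭-refl))))
                  (↭-trans (↭-swap u 0 ↭-refl) (↭-prep 0 (↭-swap u 0 ↭-refl)))
    below : x ≤ y → pair (fromDigits B (x ∷ y ∷ 0 ∷ 0 ∷ [])) ~ (x , y)
    below x≤y = inj₂ (gaps-digits eq rot z≤n z≤n x≤y)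
    above : y ≤ x → pair (fromDigits B (x ∷ y ∷ 0 ∷ 0 ∷ [])) ~ (x , y)
    above y≤x = inj₁ (gaps-digits eq (↭-trans rot (↭-prep 0 (↭-prep 0 (↭-swap x y ↭-refl)))) z≤n z≤n y≤x)

-- Sorting the digits of a value of `K`

infixl 5 _⨾_
_⨾_ : {xs ys zs : List ℕ} → xs ↭ ys → ys ↭ zs → xs ↭ zs
_⨾_ = ↭-trans

sw₁ : ∀ {a b c d : ℕ} → a ∷ b ∷ c ∷ d ∷ [] ↭ b ∷ a ∷ c ∷ d ∷ []
sw₁ = ↭-swap _ _ ↭-refl

sw₂ : ∀ {a b c d : ℕ} → a ∷ b ∷ c ∷ d ∷ [] ↭ a ∷ c ∷ b ∷ d ∷ []
sw₂ = ↭-prep _ (↭-swap _ _ ↭-refl)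

sw₃ : ∀ {a b c d : ℕ} → a ∷ b ∷ c ∷ d ∷ [] ↭ a ∷ b ∷ d ∷ c ∷ []
sw₃ = ↭-prep _ (↭-prep _ (↭-swap _ _ ↭-refl))

halve-≡ : ∀ {l m} → l + l ≡ m + m → l ≡ m
halve-≡ {l} {m} eq = *-cancelˡ-≡ l m 2 (trans (lemma l) (trans eq (sym (lemma m))))
  where
  lemma : ∀ l → 2 * l ≡ l + l
  lemma = solve-∀

-- The digits come in two pairs, of sums B and B - 2, symmetric around their means.
gaps-symmetric : ∀ {xs l u m v} → xs ↭ l + u ∷ l ∷ m + v ∷ m ∷ [] →
  l + l + u ≡ suc m + suc m + v →
  (u ≢ v × gaps (ascending xs) ~ (u , v)) ⊎ (u ≡ v × gaps (ascending xs) ≡ merge u)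
gaps-symmetric {xs} {l} {u} {m} {v} p eq with <-cmp l (suc m)
... | tri< l<1+m l≢ _ = inj₁ (u≢v , inj₁ (trans
        (cong gaps (ascending-unique p₁ (≤-pred l<1+m) (m≤m+n m v)
          (≤-trans (n≤1+n (m + v)) (+-cancelˡ-≤ (suc m) _ _ (begin
            suc m + suc (m + v) ≡⟨ +-assoc (suc m) (suc m) v ⟨
            suc m + suc m + v   ≡⟨ eq ⟨
            l + l + u           ≡⟨ +-assoc l l u ⟩
            l + (l + u)         ≤⟨ +-monoˡ-≤ (l + u) (<⇒≤ l<1+m) ⟩
            suc m + (l + u)     ∎)))))
        (cong₂ _,_ (m+n∸m≡n l u) (m+n∸m≡n m v))))
  where
  open ≤-Reasoning
  u≢v : u ≢ v
  u≢v refl = l≢ (halve-≡ (+-cancelʳ-≡ u (l + l) (suc m + suc m) eq))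
  p₁ : xs ↭ l ∷ m ∷ m + v ∷ l + u ∷ []
  p₁ = p ⨾ sw₁ ⨾ sw₂ ⨾ sw₃ ⨾ sw₂
... | tri> _ l≢ 1+m<l = inj₁ (u≢v , inj₂ (trans
        (cong gaps (ascending-unique p₁ (≤-trans (n≤1+n m) (<⇒≤ 1+m<l)) (m≤m+n l u)
          (+-cancelˡ-≤ (2 + m) _ _ (begin
            2 + m + (l + u)     ≤⟨ +-monoˡ-≤ (l + u) 1+m<l ⟩
            l + (l + u)         ≡⟨ +-assoc l l u ⟨
            l + l + u           ≡⟨ eq ⟩
            suc m + suc m + v   ≡⟨ +-assoc (suc m) (suc m) v ⟩
            suc m + suc (m + v) ≡⟨ +-suc (suc m) (m + v) ⟩
            2 + m + (m + v)     ∎))))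
        (cong₂ _,_ (m+n∸m≡n m v) (m+n∸m≡n l u))))
  where
  open ≤-Reasoning
  u≢v : u ≢ v
  u≢v refl = l≢ (halve-≡ (+-cancelʳ-≡ u (l + l) (suc m + suc m) eq))
  p₁ : xs ↭ m ∷ l ∷ l + u ∷ m + v ∷ []
  p₁ = p ⨾ sw₁ ⨾ sw₂ ⨾ sw₃ ⨾ sw₂ ⨾ sw₁ ⨾ sw₃
... | tri≈ _ refl _ with +-cancelˡ-≡ (suc m + suc m) u v eq
... | refl = inj₂ (refl , merged u p)
  where
  merged : ∀ u → xs ↭ suc m + u ∷ suc m ∷ m + u ∷ m ∷ [] → gaps (ascending xs) ≡ merge u
  merged zero p = trans
    (cong gaps (ascending-unique p₁ (≤-reflexive (sym (+-identityʳ m))) (≤-trans (≤-reflexive (+-identityʳ m)) (n≤1+n m)) (≤-reflexive (sym (+-identityʳ (suc m))))))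
    (cong₂ _,_ (trans (cong (_∸ m) (trans (+-identityʳ (suc m)) (+-comm 1 m))) (m+n∸m≡n m 1))
               (trans (cong (suc m ∸_) (+-identityʳ m)) (trans (cong (_∸ m) (+-comm 1 m)) (m+n∸m≡n m 1))))
    where
    p₁ : xs ↭ m ∷ m + 0 ∷ suc m ∷ suc m + 0 ∷ []
    p₁ = p ⨾ sw₁ ⨾ sw₂ ⨾ sw₃ ⨾ sw₂ ⨾ sw₁ ⨾ sw₂
  merged (suc w) p = trans
    (cong gaps (ascending-unique p₁ (n≤1+n m) (≤-trans (m≤m+n (suc m) w) (≤-reflexive (sym (+-suc m w)))) (n≤1+n (m + suc w))))
    (cong₂ _,_ (trans (cong (_∸ m) (lemma m w)) (m+n∸m≡n m (2 + w)))
               (trans (cong (_∸ suc m) (+-suc m w)) (m+n∸m≡n (suc m) w)))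
    where
    lemma : ∀ m w → suc (m + suc w) ≡ m + (2 + w)
    lemma = solve-∀
    p₁ : xs ↭ m ∷ suc m ∷ m + suc w ∷ suc m + suc w ∷ []
    p₁ = p ⨾ sw₁ ⨾ sw₂ ⨾ sw₃ ⨾ sw₂ ⨾ sw₁

data Halves (x y u : ℕ) : Set where
  above : ∀ {l} → x ≡ l + u → y ≡ l → Halves x y u
  below : ∀ {l} → x ≡ l → y ≡ l + u → Halves x y u

halves : ∀ B x y → x + y ≡ B → Halves x y (T B x)
halves B x y eq with T-cases B x
... | inj₁ p = above {l = y} (+-cancelʳ-≡ (x + y) x (y + T B x) (begin
  x + (x + y)       ≡⟨ l₁ x y ⟩
  2 * x + y         ≡⟨ cong (_+ y) (trans p (cong (_+ T B x) (sym eq))) ⟩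
  x + y + T B x + y ≡⟨ l₂ x y (T B x) ⟩
  y + T B x + (x + y) ∎)) refl
  where
  open ≡-Reasoning
  l₁ : ∀ x y → x + (x + y) ≡ 2 * x + y
  l₁ = solve-∀
  l₂ : ∀ x y t → x + y + t + y ≡ y + t + (x + y)
  l₂ = solve-∀
... | inj₂ p = below {l = x} refl (+-cancelˡ-≡ x y (x + T B x) (trans eq (trans (sym p) (lemma x (T B x)))))
  where
  lemma : ∀ x t → 2 * x + t ≡ x + (x + t)
  lemma = solve-∀

module _ (B : ℕ) .{{_ : NonZero B}} where

  -- The intervals between `p` and `f` and between `q` and `e` have midpoints `B / 2` and
  -- `B / 2 - 1`, and their lengths `T B p` and `T B (suc q)` have the same parity. Different
  -- lengths therefore differ by at least 2, so one interval contains the other and the gaps are the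
  -- two lengths. Equal lengths `u` give intervals shifted by 1, with gaps `u + 1` and `u - 1`, or
  -- `(1 , 1)` if `u` is 0.
  pair-symmetric : ∀ p q e f → p + f ≡ B → suc q + suc e ≡ B → p ≢ 0 →
    gaps (ascending (p ∷ q ∷ e ∷ f ∷ [])) ~ G B (p , suc q)
  pair-symmetric p q e f pf qe p≢0 = go (halves B p f pf) (halves B (suc q) (suc e) qe)
    where
    xs = p ∷ q ∷ e ∷ f ∷ []
    u = T B p
    v = T B (suc q)
    finish : ∀ {l m} → xs ↭ l + u ∷ l ∷ m + v ∷ m ∷ [] → l + l + u ≡ suc m + suc m + v →
      gaps (ascending xs) ~ G B (p , suc q)
    finish perm eq with gaps-symmetric perm eq
    ... | inj₁ (u≢v , r) = ~-trans r (inj₁ (sym (G-pure B p (suc q) p≢0 (λ ()) u≢v)))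
    ... | inj₂ (u≡v , r) = inj₁ (trans r (sym (G-merge B p (suc q) p≢0 (λ ()) u≡v)))
    l₁ : ∀ l u → l + l + u ≡ l + u + l
    l₁ = solve-∀
    l₂ : ∀ l u → l + l + u ≡ l + (l + u)
    l₂ = solve-∀
    listed : ∀ {p′ q′ e′ f′} → p ≡ p′ → suc q ≡ suc q′ → suc e ≡ suc e′ → f ≡ f′ →
      xs ↭ p′ ∷ q′ ∷ e′ ∷ f′ ∷ []
    listed refl refl refl refl = ↭-refl
    summed : ∀ {p′ q′ e′ f′ t} → p ≡ p′ → suc q ≡ q′ → suc e ≡ e′ → f ≡ f′ →
      t ≡ q′ + e′ → p′ + f′ ≡ t
    summed refl refl refl refl t≡ = trans pf (trans (sym qe) (sym t≡))
    go : Halves p f u → Halves (suc q) (suc e) v → gaps (ascending xs) ~ G B (p , suc q)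
    go (above {l} p≡ f≡) (above {suc m} q≡ e≡) = finish {l} {m}
      (listed p≡ q≡ e≡ f≡ ⨾ sw₃ ⨾ sw₂)
      (trans (l₁ l u) (summed p≡ q≡ e≡ f≡ (l₁ (suc m) v)))
    go (above {l} p≡ f≡) (below {suc m} q≡ e≡) = finish {l} {m}
      (listed p≡ q≡ e≡ f≡ ⨾ sw₃ ⨾ sw₂ ⨾ sw₃)
      (trans (l₁ l u) (summed p≡ q≡ e≡ f≡ (l₂ (suc m) v)))
    go (below {l} p≡ f≡) (above {suc m} q≡ e≡) = finish {l} {m}
      (listed p≡ q≡ e≡ f≡ ⨾ sw₃ ⨾ sw₂ ⨾ sw₁)
      (trans (l₂ l u) (summed p≡ q≡ e≡ f≡ (l₁ (suc m) v)))
    go (below {l} p≡ f≡) (below {suc m} q≡ e≡) = finish {l} {m}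
      (listed p≡ q≡ e≡ f≡ ⨾ sw₂ ⨾ sw₃ ⨾ sw₂ ⨾ sw₁)
      (trans (l₂ l u) (summed p≡ q≡ e≡ f≡ (l₂ (suc m) v)))

module _ (B : ℕ) .{{_ : NonZero B}} where

  -- For `q > 0` the digits of `value B (p , q)` are `p`, `q - 1`, `B - q - 1`, `B - p`. For
  -- `q = 0 < p` the borrow runs through both middle digits and they are `p - 1`, `B - 1`, `B - 1`,
  -- `B - p`, which is the bounce.
  pair-value : ∀ p q → q ≤ p → p < B → pair B (value B (p , q)) ~ G B (p , q)
  pair-value zero zero _ 0<B =
    inj₁ (gaps-digits B (digits-fromDigits B 0<B 0<B 0<B 0<B) ↭-refl z≤n z≤n z≤n)
  pair-value (suc p) zero _ p<B = [ small , large ]′ (≤-total p f)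
    where
    f = B ∸ suc p
    β = B ∸ 1
    1+β≡B : suc β ≡ B
    1+β≡B = m+[n∸m]≡n (>-nonZero⁻¹ B)
    f+p≡B : f + suc p ≡ B
    f+p≡B = m∸n+n≡m (<⇒≤ p<B)
    β≡ : β ≡ f + p
    β≡ = suc-injective (trans 1+β≡B (trans (sym f+p≡B) (+-suc f p)))
    β<B : β < B
    β<B = ≤-reflexive 1+β≡B
    f<B : f < B
    f<B = ≤-trans (s≤s (m≤m+n f p)) (≤-trans (≤-reflexive (sym (+-suc f p))) (≤-reflexive f+p≡B))
    l₁ : ∀ b p f β → ((p * b + β) * b + β) * b + f + (suc p + 0 * b) ≡ p * (b * b * b) + β * (b * b) + β * b + (f + suc p)
    l₁ = solve-∀
    l₂ : ∀ b p → p * (b * b * b) + b * (b * b) ≡ suc p * (b * b * b) + 0 * (b * b)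
    l₂ = solve-∀
    l₃ : ∀ b p β → p * (b * b * b) + β * (b * b) + β * b + b ≡ p * (b * b * b) + β * (b * b) + suc β * b
    l₃ = solve-∀
    l₄ : ∀ b p β → p * (b * b * b) + β * (b * b) + b * b ≡ p * (b * b * b) + suc β * (b * b)
    l₄ = solve-∀
    value≡ : ((p * B + β) * B + β) * B + f ≡ value B (suc p , 0)
    value≡ = value-unique B (suc p) 0 _ (begin
      ((p * B + β) * B + β) * B + f + (suc p + 0 * B)          ≡⟨ l₁ B p f β ⟩
      p * (B * B * B) + β * (B * B) + β * B + (f + suc p)      ≡⟨ cong (p * (B * B * B) + β * (B * B) + β * B +_) f+p≡B ⟩
      p * (B * B * B) + β * (B * B) + β * B + B                ≡⟨ l₃ B p β ⟩
      p * (B * B * B) + β * (B * B) + suc β * B                ≡⟨ cong (λ c → p * (B * B * B) + β * (B * B) + c * B) 1+β≡B ⟩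
      p * (B * B * B) + β * (B * B) + B * B                    ≡⟨ l₄ B p β ⟩
      p * (B * B * B) + suc β * (B * B)                        ≡⟨ cong (λ c → p * (B * B * B) + c * (B * B)) 1+β≡B ⟩
      p * (B * B * B) + B * (B * B)                            ≡⟨ l₂ B p ⟩
      suc p * (B * B * B) + 0 * (B * B)                        ∎)
      where open ≡-Reasoning
    dig : digits B (value B (suc p , 0)) ≡ p ∷ β ∷ β ∷ f ∷ []
    dig = trans (cong (digits B) (sym value≡)) (digits-fromDigits B (<-trans (n<1+n p) p<B) β<B β<B f<B)
    f≤β : f ≤ β
    f≤β = subst (f ≤_) (sym β≡) (m≤m+n f p)
    p≤β : p ≤ β
    p≤β = subst (p ≤_) (sym β≡) (m≤n+m p f)
    β∸p : β ∸ p ≡ f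
    β∸p = trans (cong (_∸ p) β≡) (m+n∸n≡m f p)
    β∸f : β ∸ f ≡ p
    β∸f = trans (cong (_∸ f) β≡) (m+n∸m≡n f p)
    small : p ≤ f → pair B (value B (suc p , 0)) ~ (p , f)
    small p≤f = inj₂ (trans (gaps-digits B dig (sw₃ ⨾ sw₂) p≤f f≤β ≤-refl) (cong₂ _,_ β∸p β∸f))
    large : f ≤ p → pair B (value B (suc p , 0)) ~ (p , f)
    large f≤p = inj₁ (trans (gaps-digits B dig (sw₃ ⨾ sw₂ ⨾ sw₁) f≤p p≤β ≤-refl) (cong₂ _,_ β∸f β∸p))
  pair-value p (suc q) q<p p<B =
    subst (λ xs → gaps (ascending xs) ~ G B (p , suc q)) (sym dig)
      (pair-symmetric B p q e f p+f (trans (+-comm (suc q) (suc e)) (trans (sym (+-suc e (suc q))) e+q)) p≢0)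
    where
    e = B ∸ (2 + q)
    f = B ∸ p
    p≢0 : p ≢ 0
    p≢0 refl = contradiction q<p λ ()
    p+f : p + f ≡ B
    p+f = m+[n∸m]≡n (<⇒≤ p<B)
    e+q : e + (2 + q) ≡ B
    e+q = m∸n+n≡m (≤-trans (s≤s q<p) p<B)
    l₁ : ∀ b p q e f → ((p * b + q) * b + e) * b + f + (p + suc q * b) ≡ p * (b * b * b) + q * (b * b) + (e + suc q) * b + (p + f)
    l₁ = solve-∀
    l₂ : ∀ b p q e → p * (b * b * b) + q * (b * b) + (e + suc q) * b + b ≡ p * (b * b * b) + q * (b * b) + (e + (2 + q)) * b
    l₂ = solve-∀
    l₃ : ∀ b p q → p * (b * b * b) + q * (b * b) + b * b ≡ p * (b * b * b) + suc q * (b * b)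
    l₃ = solve-∀
    value≡ : ((p * B + q) * B + e) * B + f ≡ value B (p , suc q)
    value≡ = value-unique B p (suc q) _ (begin
      ((p * B + q) * B + e) * B + f + (p + suc q * B)          ≡⟨ l₁ B p q e f ⟩
      p * (B * B * B) + q * (B * B) + (e + suc q) * B + (p + f) ≡⟨ cong (p * (B * B * B) + q * (B * B) + (e + suc q) * B +_) p+f ⟩
      p * (B * B * B) + q * (B * B) + (e + suc q) * B + B      ≡⟨ l₂ B p q e ⟩
      p * (B * B * B) + q * (B * B) + (e + (2 + q)) * B        ≡⟨ cong (λ c → p * (B * B * B) + q * (B * B) + c * B) e+q ⟩
      p * (B * B * B) + q * (B * B) + B * B                    ≡⟨ l₃ B p q ⟩
      p * (B * B * B) + suc q * (B * B)                        ∎)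
      where open ≡-Reasoning
    dig : digits B (value B (p , suc q)) ≡ p ∷ q ∷ e ∷ f ∷ []
    dig = trans (cong (digits B) (sym value≡)) (digits-fromDigits B p<B
      (<-trans q<p p<B)
      (subst (e <_) e+q (m<m+n e z<s))
      (subst (f <_) p+f (m<n+m f (n≢0⇒n>0 p≢0))))

  pair-K : ∀ x → pair B (K B x) ~ G B (pair B x)
  pair-K x = subst (λ y → pair B y ~ G B (pair B x)) (sym (K-value B x))
    (pair-value (proj₁ (pair B x)) (proj₂ (pair B x)) (pair-ordered B x) (pair-< B x))

  pair-K^ : ∀ t x → pair B (K^ B t x) ~ G^ B t (pair B x)
  pair-K^ zero    x = inj₁ refl
  pair-K^ (suc t) x = ~-trans (pair-K^ t (K B x)) (G^-~ B t (pair-K x))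

  -- As `q (B² - B) < B³ - 1` for `q < B`, the second entry never makes up for a unit in the first.
  value-< : 1 < B → ∀ {p q p′} q′ → q < B → p < p′ → value B (p , q) < value B (p′ , q′)
  value-< 1<B {p} {q} {p′} q′ q<B p<p′ = begin-strict
    p * M + q * L      <⟨ +-monoʳ-< (p * M) qL<M ⟩
    p * M + M          ≡⟨ +-comm (p * M) M ⟩
    suc p * M          ≤⟨ *-monoˡ-≤ M p<p′ ⟩
    p′ * M             ≤⟨ m≤m+n (p′ * M) (q′ * L) ⟩
    p′ * M + q′ * L    ∎
    where
    open ≤-Reasoning
    M = B * B * B ∸ 1
    L = (B ∸ 1) * B
    qL<M : q * L < M
    qL<M = ≤-pred (begin
      2 + q * L           ≤⟨ +-mono-≤ (*-mono-≤ {2} {B} {1} {B} 1<B (>-nonZero⁻¹ B)) (*-monoʳ-≤ q (m≤m+n L B)) ⟩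
      B * B + q * (L + B) ≡⟨ cong (λ c → B * B + q * c) (B²-B B) ⟩
      B * B + q * (B * B) ≤⟨ *-monoˡ-≤ (B * B) q<B ⟩
      B * (B * B)         ≡⟨ *-assoc B B B ⟨
      B * B * B           ≡⟨ B³-1 B ⟨
      suc M               ∎)

  value-injective : 1 < B → ∀ {p q p′ q′} → q < B → q′ < B →
    value B (p , q) ≡ value B (p′ , q′) → (p , q) ≡ (p′ , q′)
  value-injective 1<B {p} {q} {p′} {q′} q<B q′<B eq with <-cmp p p′
  ... | tri< p<p′ _ _ = contradiction eq (<⇒≢ (value-< 1<B q′ q<B p<p′))
  ... | tri> _ _ p′<p = contradiction (sym eq) (<⇒≢ (value-< 1<B q q′<B p′<p))
  ... | tri≈ _ refl _ = cong (p ,_)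
    (*-cancelʳ-≡ q q′ ((B ∸ 1) * B) {{m*n≢0 (B ∸ 1) B {{>-nonZero (m<n⇒0<n∸m 1<B)}}}}
      (+-cancelˡ-≡ (p * (B * B * B ∸ 1)) _ _ eq))

-- Uniqueness of the fixed pair, and from times of pairs to `M_b`

K^-constant : ∀ b .{{_ : NonZero b}} {x c} t₀ → K^ b t₀ x ≡ c → K b c ≡ c → ∀ t → t₀ ≤ t → K^ b t x ≡ c
K^-constant b {x} {c} t₀ at Kc t t₀≤t = begin
  K^ b t x                  ≡⟨ cong (iterate (K b) x) (m+[n∸m]≡n t₀≤t) ⟨
  K^ b (t₀ + (t ∸ t₀)) x    ≡⟨ iterate-+ (K b) x t₀ (t ∸ t₀) ⟩
  K^ b (t ∸ t₀) (K^ b t₀ x) ≡⟨ cong (K^ b (t ∸ t₀)) at ⟩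
  K^ b (t ∸ t₀) c           ≡⟨ stay (t ∸ t₀) ⟩
  c                         ∎
  where
  open ≡-Reasoning
  stay : ∀ i → K^ b i c ≡ c
  stay zero    = refl
  stay (suc i) = trans (cong (K^ b i) Kc) (stay i)

module _ {k : ℕ} .{{_ : NonZero k}} where

  private
    B = 5 * k
    instance
      B≢0 : NonZero B
      B≢0 = m*n≢0 5 k

  5k≢ : ∀ {c} .{{_ : NonZero c}} → c < 5 → B ≢ c
  5k≢ {c} c<5 eq = contradiction (subst (5 ∣_) eq (m∣m*n k)) (>⇒∤ c<5)

  1<5k : 1 < B
  1<5k = ≤-trans (s≤s (s≤s z≤n)) (*-monoʳ-≤ 5 (>-nonZero⁻¹ k))

  bounce-moves : ∀ p → p ≢ 0 → ¬ bounce B p ~ (0 , p)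
  bounce-moves zero    p≢0 _         = p≢0 refl
  bounce-moves (suc p) _   (inj₁ eq) with cong proj₁ eq
  ... | refl = 5k≢ {2} (s≤s (s≤s (s≤s z≤n)))
    (trans (sym (m∸n+n≡m (<⇒≤ 1<5k))) (cong (_+ 1) (cong proj₂ eq)))
  bounce-moves (suc p) _   (inj₂ eq) = 1+n≢n (sym (cong proj₁ eq))

  -- Solving the equations leaves only `(1 , 1)` in base 2 and `(3 , 1)` in base 4, just as
  -- `bounce-moves` leaves only `(0 , 1)` in base 2. None of these bases is a multiple of 5.
  merge-moves : ∀ x y → T B x ≡ T B y → ¬ merge (T B x) ≡ (x , y)
  merge-moves x y eq fx with T B x | T-cases B x | T B y | T-cases B y
  merge-moves x y refl refl | zero | inj₁ p | _ | _ =
    5k≢ {2} (s≤s (s≤s (s≤s z≤n))) (trans (sym (+-identityʳ B)) (sym p))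
  merge-moves x y refl refl | zero | inj₂ p | _ | _ = 5k≢ {2} (s≤s (s≤s (s≤s z≤n))) (sym p)
  merge-moves x y refl refl | suc w | inj₁ p | _ | q =
    [ (λ q → m≢1+m+n (2 * w) {3} (trans q (trans (cong (_+ suc w) B≡) (l₂ w))))
    , (λ q → 5k≢ {4} ≤-refl (trans B≡ (cong (3 +_) (*-cancelˡ-≡ w 1 2
        (+-cancelʳ-≡ (suc w) _ _ (trans q (trans B≡ (l₃ w)))))))) ]′ q
    where
    l₁ : ∀ w → 2 * (2 + w) ≡ 3 + w + suc w
    l₁ = solve-∀
    l₂ : ∀ w → 3 + w + suc w ≡ suc (2 * w + 3)
    l₂ = solve-∀
    l₃ : ∀ w → 3 + w ≡ 2 * 1 + suc w
    l₃ = solve-∀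
    B≡ : B ≡ 3 + w
    B≡ = +-cancelʳ-≡ (suc w) _ _ (trans (sym p) (l₁ w))
  merge-moves x y refl refl | suc w | inj₂ p | _ | q =
    [ (λ q → m≢1+m+n (2 * w) {5 + 2 * w} (trans q (trans (cong (_+ suc w) (sym p)) (l₁ w))))
    , (λ q → m+1+n≢m w {1} (trans (+-comm w 2) (*-cancelˡ-≡ (2 + w) w 2
        (+-cancelʳ-≡ (suc w) _ _ (trans p (sym q)))))) ]′ q
    where
    l₁ : ∀ w → 2 * (2 + w) + suc w + suc w ≡ suc (2 * w + (5 + 2 * w))
    l₁ = solve-∀

  2-cycle : ∀ {x y} → 2 * x ≡ B + y → 2 * y + x ≡ B → (x , y) ≡ (3 * k , k)
  2-cycle {x} {y} p q = cong₂ _,_ (trans x≡ (cong (3 *_) y≡)) y≡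
    where
    l₁ : ∀ x → 2 * x ≡ x + x
    l₁ = solve-∀
    l₂ : ∀ x y → 2 * y + x + y ≡ 3 * y + x
    l₂ = solve-∀
    l₃ : ∀ y → 2 * y + 3 * y ≡ 5 * y
    l₃ = solve-∀
    x≡ : x ≡ 3 * y
    x≡ = +-cancelʳ-≡ x _ _ (trans (sym (l₁ x)) (trans p (trans (cong (_+ y) (sym q)) (l₂ x y))))
    y≡ : y ≡ k
    y≡ = *-cancelˡ-≡ y k 5 (trans (sym (l₃ y)) (trans (cong (2 * y +_) (sym x≡)) q))

  -- If both entries were fixed by the tent map, both would satisfy `3 x = B` and the pair would
  -- merge. If they are exchanged, the larger entry lies on the upper branch and the smaller one on
  -- the lower branch, and `2-cycle` solves the system.
  fixed-unique : ∀ {x y} → x < B → y < B → (x , y) ≢ (0 , 0) → G B (x , y) ~ (x , y) →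
                 Fixed k (x , y)
  fixed-unique {zero} {zero} _ _ s≢0 _ = contradiction refl s≢0
  fixed-unique {zero} {suc y} _ _ _ fx = contradiction fx (bounce-moves (suc y) λ ())
  fixed-unique {suc x} {zero} _ _ _ fx =
    contradiction (~-trans fx (inj₂ refl)) (bounce-moves (suc x) λ ())
  fixed-unique {x@(suc _)} {y@(suc _)} x<B y<B _ fx with T B x ≟ T B y
  fixed-unique {x@(suc _)} {y@(suc _)} x<B y<B _ (inj₁ fx) | yes eq =
    contradiction fx (merge-moves x y eq)
  fixed-unique {x@(suc _)} {y@(suc _)} x<B y<B _ (inj₂ fx) | yes eq =
    contradiction (trans (cong merge (sym eq)) fx) (merge-moves y x (sym eq))
  fixed-unique {x@(suc _)} {y@(suc _)} x<B y<B _ (inj₁ fx) | no t≢t =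
    contradiction (cong (T B) (*-cancelˡ-≡ x y 3 (trans (3x≡B x x<B (cong proj₁ fx)) (sym (3x≡B y y<B (cong proj₂ fx)))))) t≢t
    where
    l₁ : ∀ x → 2 * x ≡ x + x
    l₁ = solve-∀
    l₂ : ∀ x → 3 * x ≡ 2 * x + x
    l₂ = solve-∀
    3x≡B : ∀ x → x < B → T B x ≡ x → 3 * x ≡ B
    3x≡B x x<B t with T-cases B x
    ... | inj₁ p = contradiction (+-cancelʳ-≡ x x B (trans (sym (l₁ x)) (trans p (cong (B +_) t)))) (<⇒≢ x<B)
    ... | inj₂ p = trans (l₂ x) (trans (cong (2 * x +_) (sym t)) p)
  fixed-unique {x@(suc _)} {y@(suc _)} x<B y<B _ (inj₂ fx) | no t≢t
    = go (T-cases B x) (T-cases B y)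
    where
    Tx≡y = cong proj₁ fx
    Ty≡x = cong proj₂ fx
    l₁ : ∀ x → 2 * x ≡ x + x
    l₁ = solve-∀
    l₂ : ∀ x y → 2 * x + y ≡ x + (x + y)
    l₂ = solve-∀
    l₃ : ∀ x y → 2 * y + x ≡ y + (x + y)
    l₃ = solve-∀
    order : ∀ {x y} → x < B → 2 * x ≡ B + y → y < x
    order {x} {y} x<B p = +-cancelˡ-< B y x (subst (_< B + x) (trans (sym (l₁ x)) p) (+-monoˡ-< x x<B))
    go : 2 * x ≡ B + T B x ⊎ 2 * x + T B x ≡ B → 2 * y ≡ B + T B y ⊎ 2 * y + T B y ≡ B → Fixed k (x , y)
    go p q rewrite Tx≡y | Ty≡x = go′ p q
      where
      go′ : 2 * x ≡ B + y ⊎ 2 * x + y ≡ B → 2 * y ≡ B + x ⊎ 2 * y + x ≡ B → Fixed k (x , y)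
      go′ (inj₁ p) (inj₁ q) = contradiction (order x<B p) (<-asym (order y<B q))
      go′ (inj₁ p) (inj₂ q) = inj₁ (2-cycle p q)
      go′ (inj₂ p) (inj₁ q) = inj₂ (cong swap (2-cycle q p))
      go′ (inj₂ p) (inj₂ q) = contradiction (cong (T B)
        (+-cancelʳ-≡ (x + y) x y (trans (sym (l₂ x y)) (trans p (trans (sym q) (l₃ x y)))))) t≢t

  private
    c₀ = value B (3 * k , k)

    c₀≢0 : c₀ ≢ 0
    c₀≢0 eq = 3k≢0 {k} (m*n≡0⇒m≡0 (3 * k) (B * B * B ∸ 1) {{>-nonZero M>0}} (m+n≡0⇒m≡0 _ eq))
      where
      M>0 : 0 < B * B * B ∸ 1
      M>0 = m<n⇒0<n∸m (*-mono-≤ (*-mono-≤ {1} {B} (<⇒≤ 1<5k) (<⇒≤ 1<5k)) 1<5k)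

    k<c*k : ∀ c → 1 < c → k < c * k
    k<c*k c 1<c = subst (k <_) (*-comm k c) (m<m*n k c 1<c)

    k<5k : k < B
    k<5k = k<c*k 5 (s≤s (s≤s z≤n))

    fixed-pair : ∀ x → Fixed k (pair B x) → pair B x ≡ (3 * k , k)
    fixed-pair x (inj₁ eq) = eq
    fixed-pair x (inj₂ eq) = contradiction (subst (λ s → proj₂ s ≤ proj₁ s) eq (pair-ordered B x))
      (<⇒≱ (k<c*k 3 (s≤s (s≤s z≤n))))

    K-fixed : ∀ x → Fixed k (pair B x) → K B x ≡ c₀
    K-fixed x fx = trans (K-value B x) (cong (value B) (fixed-pair x fx))

    constant⇒fixed : ∀ {c} → c ≢ 0 → K B c ≡ c → Fixed k (pair B c)
    constant⇒fixed {c} c≢0 Kc = fixed-unique (pair-< B c) (≤-<-trans (pair-ordered B c) (pair-< B c))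
      (λ eq → c≢0 (trans (sym Kc) (trans (K-value B c) (cong (value B) eq))))
      (~-sym (subst (λ z → pair B z ~ G B (pair B c)) Kc (pair-K B c)))

  -- Pairs need at most `suc N` steps and one of them needs exactly that many; the number follows
  -- its pair one step later, which makes `2 + N`.
  isM : ∀ N → (∀ x y → x < B → y < B → Within k (suc N) (x , y)) →
        ∀ x y → x < B → y < B → ¬ Fixed k (G^ B N (x , y)) → Fixed k (G^ B (suc N) (x , y)) →
        IsM B (2 + N)
  isM N upper x y x<B y<B ¬fx fx = stable , least
    where
    stable : StableAt B (2 + N)
    stable z (_ , c , c≢0 , t , const) = begin
      K^ B (2 + N) z        ≡⟨ iterate-suc (K B) z (suc N) ⟩
      K B (K^ B (suc N) z)  ≡⟨ K-fixed _ at ⟩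
      c₀                    ≡⟨ K-fixed _ at′ ⟨
      K B (K^ B (2 + N) z)  ≡⟨ iterate-suc (K B) z (2 + N) ⟨
      K^ B (3 + N) z        ∎
      where
      open ≡-Reasoning
      s = pair B z
      Kc : K B c ≡ c
      Kc = trans (cong (K B) (sym (const t ≤-refl))) (trans (sym (iterate-suc (K B) z t)) (const (suc t) (n≤1+n t)))
      reached : Fixed k (G^ B t s)
      reached = ~-trans (~-sym (pair-K^ B t z))
        (subst (λ d → Fixed k (pair B d)) (sym (const t ≤-refl)) (constant⇒fixed c≢0 Kc))
      in-time : Fixed k (G^ B (suc N) s)
      in-time = reach (upper (proj₁ s) (proj₂ s) (pair-< B z) (≤-<-trans (pair-ordered B z) (pair-< B z))) t reached
      at : Fixed k (pair B (K^ B (suc N) z))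
      at = ~-trans (pair-K^ B (suc N) z) in-time
      at′ : Fixed k (pair B (K^ B (2 + N) z))
      at′ = ~-trans (pair-K^ B (2 + N) z) (fixed-≤ {s = s} (n≤1+n (suc N)) in-time)

    z₀ = fromDigits B (x ∷ y ∷ 0 ∷ 0 ∷ [])
    0<B : 0 < B
    0<B = >-nonZero⁻¹ B
    pair^ : ∀ t → pair B (K^ B t z₀) ~ G^ B t (x , y)
    pair^ t = ~-trans (pair-K^ B t z₀) (G^-~ B t (pair-fromDigits₂ B x y x<B y<B))
    late : ∀ t → 2 + N ≤ t → K^ B t z₀ ≡ c₀
    late (suc t) (s≤s N<t) = trans (iterate-suc (K B) z₀ t)
      (K-fixed _ (~-trans (pair^ t) (fixed-≤ {s = x , y} N<t fx)))
    z₀∈S : S B z₀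
    z₀∈S = fromDigits-< B x<B y<B 0<B 0<B , c₀ , c₀≢0 , 2 + N , late

    least : ∀ m → StableAt B m → 2 + N ≤ m
    least m st with 2 + N ≤? m
    ... | yes le = le
    -- Stability at some `m ≤ suc N` would put the constant at time `suc N` already, and by
    -- injectivity of `value` the pair would be fixed at time `N`.
    ... | no nle = contradiction
      (~-trans (~-sym (pair^ N)) (inj₁ (value-injective B 1<5k (≤-<-trans (pair-ordered B w) (pair-< B w)) k<5k
        (trans (sym (K-value B w)) (trans (sym (iterate-suc (K B) z₀ N)) K^≡c₀)))))
      ¬fx
      where
      w = K^ B N z₀
      m≤1+N : m ≤ suc N
      m≤1+N = ≤-pred (≰⇒> nle)
      c = K^ B m z₀
      Kc : K B c ≡ c
      Kc = trans (sym (iterate-suc (K B) z₀ m)) (sym (st z₀ z₀∈S))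
      from-m : ∀ t → m ≤ t → K^ B t z₀ ≡ c
      from-m = K^-constant B m refl Kc
      K^≡c₀ : K^ B (suc N) z₀ ≡ c₀
      K^≡c₀ = trans (from-m (suc N) m≤1+N) (trans (sym (from-m (2 + N) (≤-trans m≤1+N (n≤1+n (suc N))))) (late (2 + N) ≤-refl))

-- Base 5 · 2 ^ n

neg^-cases : ∀ i → (iterate neg 1 i ≡ 1 × iterate neg 4 i ≡ 4) ⊎ (iterate neg 1 i ≡ 4 × iterate neg 4 i ≡ 1)
neg^-cases zero    = inj₁ (refl , refl)
neg^-cases (suc i) = [ (λ (p , q) → inj₂ (q , p)) , (λ (p , q) → inj₁ (q , p)) ]′ (neg^-cases i)

neg-cls≢0 : ∀ x → cls x ≢ 0 → neg (cls x) ≢ 0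
neg-cls≢0 x c≢0 eq with cls x | cls-cases x
... | _ | inj₁ refl        = c≢0 refl
... | _ | inj₂ (inj₁ refl) = contradiction eq λ ()
... | _ | inj₂ (inj₂ refl) = contradiction eq λ ()

neg-cls-injective : ∀ x y → neg (cls x) ≡ neg (cls y) → cls x ≡ cls y
neg-cls-injective x y eq with cls x | cls-cases x | cls y | cls-cases y
... | _ | inj₁ refl        | _ | inj₁ refl        = refl
... | _ | inj₁ refl        | _ | inj₂ (inj₁ refl) = contradiction eq λ ()
... | _ | inj₁ refl        | _ | inj₂ (inj₂ refl) = contradiction eq λ ()
... | _ | inj₂ (inj₁ refl) | _ | inj₁ refl        = contradiction eq λ ()
... | _ | inj₂ (inj₁ refl) | _ | inj₂ (inj₁ refl) = refl
... | _ | inj₂ (inj₁ refl) | _ | inj₂ (inj₂ refl) = contradiction eq λ ()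
... | _ | inj₂ (inj₂ refl) | _ | inj₁ refl        = contradiction eq λ ()
... | _ | inj₂ (inj₂ refl) | _ | inj₂ (inj₁ refl) = contradiction eq λ ()
... | _ | inj₂ (inj₂ refl) | _ | inj₂ (inj₂ refl) = refl

cls-≢0 : ∀ {x} → cls x ≢ 0 → x ≢ 0
cls-≢0 c≢0 refl = c≢0 refl

cls-2^ : ∀ i → cls (2 ^ i) ≡ iterate neg 1 i
cls-2^ zero    = refl
cls-2^ (suc i) = trans (cls-* 2 (2 ^ i)) (trans (cong neg (cls-2^ i)) (sym (iterate-suc neg 1 i)))

∣-∣%2 : ∀ a b → ∣ a - b ∣ % 2 ≡ (a + b) % 2
∣-∣%2 a b with ∣ a - b ∣ | ∣-∣-cases a b
... | d | inj₁ refl = sym (trans (cong (_% 2) (lemma b d)) ([m+kn]%n≡m%n d b 2))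
  where
  lemma : ∀ b d → b + d + b ≡ d + b * 2
  lemma = solve-∀
... | d | inj₂ refl = sym (trans (cong (_% 2) (lemma a d)) ([m+kn]%n≡m%n d a 2))
  where
  lemma : ∀ a d → a + (a + d) ≡ d + a * 2
  lemma = solve-∀

module _ (n : ℕ) where

  private
    k = 2 ^ n
    B = 5 * k
    τ = T^ B
    instance
      k≢0 : NonZero k
      k≢0 = m^n≢0 2 n
      B≢0 : NonZero B
      B≢0 = m*n≢0 5 k

  5∣B : 5 ∣ B
  5∣B = m∣m*n k

  -- For `i < n` both `2 * 2 ^ i * w` and `B` carry the factor `2 ^ suc i`; this gives the runs
  -- their length `n`.
  T-2^ : ∀ i l w → suc i + l ≡ n → T B (2 ^ i * w) ≡ 2 ^ suc i * ∣ w - 5 * 2 ^ l ∣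
  T-2^ i l w refl = trans (cong₂ ∣_-_∣ (sym (*-assoc 2 (2 ^ i) w)) B≡)
    (sym (*-distribˡ-∣-∣ (2 ^ suc i) w (5 * 2 ^ l)))
    where
    lemma : ∀ a b → 5 * (a * b) ≡ a * (5 * b)
    lemma = solve-∀
    B≡ : B ≡ 2 ^ suc i * (5 * 2 ^ l)
    B≡ = trans (cong (5 *_) (^-distribˡ-+-* 2 (suc i) l)) (lemma (2 ^ suc i) (2 ^ l))

  -- Up to this point an even number is subtracted from the cofactor in each step, which keeps its
  -- parity.
  T^-2^ : ∀ i l y → i + suc l ≡ n → ∃[ w ] τ i y ≡ 2 ^ i * w × w % 2 ≡ y % 2
  T^-2^ zero    l y _  = y , sym (*-identityˡ y) , refl
  T^-2^ (suc i) l y eq with T^-2^ i (suc l) y (trans (+-suc i (suc l)) eq)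
  ... | w , p , q = ∣ w - 5 * 2 ^ suc l ∣ ,
    trans (iterate-suc (T B) y i) (trans (cong (T B) p) (T-2^ i (suc l) w eq)) , (begin
      ∣ w - 5 * 2 ^ suc l ∣ % 2         ≡⟨ ∣-∣%2 w (5 * 2 ^ suc l) ⟩
      (w + 5 * (2 * 2 ^ l)) % 2         ≡⟨ cong (_% 2) (lemma w (2 ^ l)) ⟩
      (w + 5 * 2 ^ l * 2) % 2           ≡⟨ [m+kn]%n≡m%n w (5 * 2 ^ l) 2 ⟩
      w % 2                             ≡⟨ q ⟩
      y % 2                             ∎)
    where
    open ≡-Reasoning
    lemma : ∀ w a → w + 5 * (2 * a) ≡ w + 5 * a * 2
    lemma = solve-∀

  -- The `n`-th step subtracts 5 itself from the cofactor. It is the only odd subtraction of the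
  -- run, so the parity flips once; for `n = 0` there is no such step.
  T^-end : ∀ y → ∃[ c ] τ n y ≡ k * c × (0 < n → c % 2 ≡ suc y % 2)
  T^-end y = go n refl
    where
    open ≡-Reasoning
    lemma : ∀ w → w + 5 ≡ suc w + 2 * 2
    lemma = solve-∀
    go : ∀ m → m ≡ n → ∃[ c ] τ m y ≡ 2 ^ m * c × (0 < m → c % 2 ≡ suc y % 2)
    go zero    _  = y , sym (*-identityˡ y) , λ ()
    go (suc m) eq with T^-2^ m 0 y (trans (+-comm m 1) eq)
    ... | w , p , q = ∣ w - 5 ∣ ,
      trans (iterate-suc (T B) y m) (trans (cong (T B) p) (T-2^ m 0 w (trans (+-identityʳ (suc m)) eq))) ,
      λ _ → begin
        ∣ w - 5 ∣ % 2         ≡⟨ ∣-∣%2 w 5 ⟩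
        (w + 5) % 2           ≡⟨ cong (_% 2) (lemma w) ⟩
        (suc w + 2 * 2) % 2   ≡⟨ [m+kn]%n≡m%n (suc w) 2 2 ⟩
        (1 + w) % 2           ≡⟨ %-distribˡ-+ 1 w 2 ⟩
        (1 + w % 2) % 2       ≡⟨ cong (λ r → (1 + r) % 2) q ⟩
        (1 + y % 2) % 2       ≡⟨ %-distribˡ-+ 1 y 2 ⟨
        suc y % 2             ∎

  cls-T^≢0 : ∀ i y → cls y ≢ 0 → cls (τ i y) ≢ 0
  cls-T^≢0 zero    y c≢0 = c≢0
  cls-T^≢0 (suc i) y c≢0 =
    cls-T^≢0 i (T B y) (λ eq → neg-cls≢0 y c≢0 (trans (sym (cls-T y 5∣B)) eq))

  T^-< : ∀ i {y} → y < B → cls y ≢ 0 → τ i y < B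
  T^-< zero    y<B _   = y<B
  T^-< (suc i) {y} y<B c≢0 = T^-< i (T-< (n≢0⇒n>0 (cls-≢0 c≢0)) y<B) (cls-T^≢0 1 y c≢0)

  cls-k : cls k ≡ 1 ⊎ cls k ≡ 4
  cls-k = [ (λ (p , _) → inj₁ (trans (cls-2^ n) p)) , (λ (p , _) → inj₂ (trans (cls-2^ n) p)) ]′ (neg^-cases n)

  neg^n-1 : iterate neg 1 n ≡ cls k
  neg^n-1 = sym (cls-2^ n)

  neg^n-4 : iterate neg 4 n ≡ neg (cls k)
  neg^n-4 = trans (iterate-suc neg 1 n) (cong neg neg^n-1)

  coefficient-1 : ∀ {κ} c → κ ≡ 1 ⊎ κ ≡ 4 → c < 5 → κ * cls c % 5 ≡ κ → c ≡ 1 ⊎ c ≡ 4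
  coefficient-1 0 (inj₁ refl) _ ()
  coefficient-1 0 (inj₂ refl) _ ()
  coefficient-1 1 _ _ _ = inj₁ refl
  coefficient-1 2 (inj₁ refl) _ ()
  coefficient-1 2 (inj₂ refl) _ ()
  coefficient-1 3 (inj₁ refl) _ ()
  coefficient-1 3 (inj₂ refl) _ ()
  coefficient-1 4 _ _ _ = inj₂ refl
  coefficient-1 (suc (suc (suc (suc (suc _))))) _ (s≤s (s≤s (s≤s (s≤s (s≤s ()))))) _

  coefficient-4 : ∀ {κ} c → κ ≡ 1 ⊎ κ ≡ 4 → c < 5 → κ * cls c % 5 ≡ neg κ → c ≡ 2 ⊎ c ≡ 3
  coefficient-4 0 (inj₁ refl) _ ()
  coefficient-4 0 (inj₂ refl) _ ()
  coefficient-4 1 (inj₁ refl) _ ()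
  coefficient-4 1 (inj₂ refl) _ ()
  coefficient-4 2 _ _ _ = inj₁ refl
  coefficient-4 3 _ _ _ = inj₂ refl
  coefficient-4 4 (inj₁ refl) _ ()
  coefficient-4 4 (inj₂ refl) _ ()
  coefficient-4 (suc (suc (suc (suc (suc _))))) _ (s≤s (s≤s (s≤s (s≤s (s≤s ()))))) _

  end-< : ∀ {y c} → y < B → cls y ≢ 0 → τ n y ≡ k * c → c < 5
  end-< {c = c} y<B c≢0 eq = *-cancelˡ-< k c 5 (subst₂ _<_ eq (*-comm 5 k) (T^-< n y<B c≢0))

  end-cls : ∀ {y c} → τ n y ≡ k * c → cls k * cls c % 5 ≡ iterate neg (cls y) n
  end-cls {y} {c} eq = trans (sym (cls-* k c)) (trans (cong cls (sym eq)) (cls-T^ 5∣B n y))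

  -- Each of the `n` steps negates the class, and so does each of the `n` factors 2 of `k`. The
  -- negations cancel, and `c` has the class of `y`.
  end-1 : ∀ {y c} → y < B → cls y ≡ 1 → τ n y ≡ k * c → c ≡ 1 ⊎ c ≡ 4
  end-1 {y} {c} y<B cy eq = coefficient-1 c cls-k
    (end-< y<B (λ cy′ → contradiction (trans (sym cy) cy′) λ ()) eq)
    (trans (end-cls {y} eq) (trans (cong (λ d → iterate neg d n) cy) neg^n-1))

  end-4 : ∀ {y c} → y < B → cls y ≡ 4 → τ n y ≡ k * c → c ≡ 2 ⊎ c ≡ 3
  end-4 {y} {c} y<B cy eq = coefficient-4 c cls-k
    (end-< y<B (λ cy′ → contradiction (trans (sym cy) cy′) λ ()) eq)
    (trans (end-cls {y} eq) (trans (cong (λ d → iterate neg d n) cy) neg^n-4))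

  even⇒odd : ∀ {y} → y % 2 ≡ 0 → suc y % 2 ≡ 1
  even⇒odd {y} e = trans (%-distribˡ-+ 1 y 2) (cong (λ r → (1 + r) % 2) e)

  odd⇒even : ∀ {y} → y % 2 ≡ 1 → suc y % 2 ≡ 0
  odd⇒even {y} e = trans (%-distribˡ-+ 1 y 2) (cong (λ r → (1 + r) % 2) e)

  -- The class does not separate `c` from `5 - c`, but these have different parities, and the parity
  -- of `y` fixes that of `c`.
  T^n-even-1 : 0 < n → ∀ {y} → y < B → cls y ≡ 1 → y % 2 ≡ 0 → τ n y ≡ k
  T^n-even-1 0<n {y} y<B cy e with T^-end y
  ... | c , p , q with end-1 y<B cy p
  ... | inj₁ refl = trans p (*-identityʳ k)
  ... | inj₂ refl = contradiction (trans (q 0<n) (even⇒odd {y} e)) λ ()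

  T^n-odd-4 : 0 < n → ∀ {y} → y < B → cls y ≡ 4 → y % 2 ≡ 1 → τ n y ≡ 2 * k
  T^n-odd-4 0<n {y} y<B cy e with T^-end y
  ... | c , p , q with end-4 y<B cy p
  ... | inj₁ refl = trans p (*-comm k 2)
  ... | inj₂ refl = contradiction (trans (q 0<n) (odd⇒even {y} e)) λ ()

  T-multiple : ∀ c → T B (k * c) ≡ k * T 5 c
  T-multiple c = trans (cong (λ b → T b (k * c)) (*-comm 5 k)) (T-scale k 5 c)

  -- One more step folds `c` and `5 - c` together: `T 5 1` and `T 5 4` are both 3, so the class
  -- alone decides. Likewise `T 5 2` and `T 5 3` are both 1.
  T^1+n-1 : ∀ {y} → y < B → cls y ≡ 1 → τ (suc n) y ≡ 3 * k
  T^1+n-1 {y} y<B cy with T^-end y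
  ... | c , p , _ = trans (iterate-suc (T B) y n) (trans (cong (T B) p) (trans (T-multiple c)
    (trans (cong (k *_) ([ cong (T 5) , cong (T 5) ]′ (end-1 y<B cy p))) (*-comm k 3))))

  T^1+n-4 : ∀ {y} → y < B → cls y ≡ 4 → τ (suc n) y ≡ k
  T^1+n-4 {y} y<B cy with T^-end y
  ... | c , p , _ = trans (iterate-suc (T B) y n) (trans (cong (T B) p) (trans (T-multiple c)
    (trans (cong (k *_) ([ cong (T 5) , cong (T 5) ]′ (end-4 y<B cy p))) (*-identityʳ k))))

  -- Negation is injective on classes and keeps non-zero classes non-zero, so neither a zero nor a
  -- merge can ever occur.
  opposite-pure : ∀ x y → cls x ≢ 0 → cls y ≢ 0 → cls x ≢ cls y →
    ∀ i → τ i x ≢ 0 × τ i y ≢ 0 × τ (suc i) x ≢ τ (suc i) y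
  opposite-pure x y cx cy x≢y i = cls-≢0 (cls-T^≢0 i x cx) , cls-≢0 (cls-T^≢0 i y cy) ,
    λ eq → apart (suc i) x y x≢y (cong cls eq)
    where
    apart : ∀ i x y → cls x ≢ cls y → cls (τ i x) ≢ cls (τ i y)
    apart zero    x y x≢y = x≢y
    apart (suc i) x y x≢y = apart i (T B x) (T B y) λ eq →
      x≢y (neg-cls-injective x y (trans (sym (cls-T x 5∣B)) (trans eq (cls-T y 5∣B))))

  opposite-classes : ∀ i x y → cls x ≢ 0 → cls y ≢ 0 → cls x ≢ cls y → G^ B i (x , y) ≡ (τ i x , τ i y)
  opposite-classes i x y cx cy x≢y = G^-pure i x y (λ j _ → opposite-pure x y cx cy x≢y j)

  opposite-parities : ∀ x y → x % 2 ≢ y % 2 → ∀ i → i < n → τ i x ≢ τ i y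
  opposite-parities x y x≢y i i<n eq
    with T^-2^ i (n ∸ suc i) x (trans (+-suc i (n ∸ suc i)) (m+[n∸m]≡n i<n))
       | T^-2^ i (n ∸ suc i) y (trans (+-suc i (n ∸ suc i)) (m+[n∸m]≡n i<n))
  ... | w , p , q | w′ , p′ , q′ = x≢y (trans (sym q) (trans (cong (_% 2)
    (*-cancelˡ-≡ w w′ (2 ^ i) {{m^n≢0 2 i}} (trans (sym p) (trans eq p′)))) q′))

  opposite-parities-end : 0 < n → ∀ x y → x % 2 ≢ y % 2 → τ n x ≢ τ n y
  opposite-parities-end 0<n x y x≢y eq with T^-end x | T^-end y
  ... | c , p , q | c′ , p′ , q′ = x≢y (suc-%2-injective x y (trans (sym (q 0<n)) (trans (cong (_% 2)
    (*-cancelˡ-≡ c c′ k (trans (sym p) (trans eq p′)))) (q′ 0<n))))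
    where
    suc-%2-injective : ∀ x y → suc x % 2 ≡ suc y % 2 → x % 2 ≡ y % 2
    suc-%2-injective x y eq = begin
      x % 2                         ≡⟨ [m+kn]%n≡m%n x 1 2 ⟨
      (x + 2) % 2                   ≡⟨ cong (_% 2) (+-comm x 2) ⟩
      (1 + suc x) % 2               ≡⟨ %-distribˡ-+ 1 (suc x) 2 ⟩
      (1 + suc x % 2) % 2           ≡⟨ cong (λ r → (1 + r) % 2) eq ⟩
      (1 + suc y % 2) % 2           ≡⟨ %-distribˡ-+ 1 (suc y) 2 ⟨
      (1 + suc y) % 2               ≡⟨ cong (_% 2) (+-comm 2 y) ⟩
      (y + 2) % 2                   ≡⟨ [m+kn]%n≡m%n y 1 2 ⟩
      y % 2                         ∎
      where open ≡-Reasoning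

  -- The pair is still unmerged after n steps, but T ^ (n + 1) only depends on the class.
  same-class : 0 < n → ∀ {x y} → x % 2 ≢ y % 2 → cls x ≢ 0 → cls x ≡ cls y → x < B → y < B →
               G^ B (suc n) (x , y) ≡ merge (τ (suc n) x)
  same-class 0<n {x} {y} x≢y cx x≡y x<B y<B = begin
    G^ B (suc n) (x , y)  ≡⟨ iterate-suc (G B) (x , y) n ⟩
    G B (G^ B n (x , y))  ≡⟨ cong (G B) (G^-pure n x y unmerged) ⟩
    G B (τ n x , τ n y)   ≡⟨ G-merge B (τ n x) (τ n y) (cls-≢0 (cls-T^≢0 n x cx)) (cls-≢0 (cls-T^≢0 n y cy)) merged ⟩
    merge (T B (τ n x))   ≡⟨ cong merge (iterate-suc (T B) x n) ⟨
    merge (τ (suc n) x)   ∎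
    where
    open ≡-Reasoning
    cy : cls y ≢ 0
    cy = subst (_≢ 0) x≡y cx
    merged : T B (τ n x) ≡ T B (τ n y)
    merged = trans (sym (iterate-suc (T B) x n)) (trans
      ([ (λ c0 → contradiction c0 cx) ,
         [ (λ c1 → trans (T^1+n-1 x<B c1) (sym (T^1+n-1 y<B (trans (sym x≡y) c1)))) ,
           (λ c4 → trans (T^1+n-4 x<B c4) (sym (T^1+n-4 y<B (trans (sym x≡y) c4)))) ]′ ]′ (cls-cases x))
      (iterate-suc (T B) y n))
    unmerged : ∀ j → j < n → τ j x ≢ 0 × τ j y ≢ 0 × τ (suc j) x ≢ τ (suc j) y
    unmerged j j<n = cls-≢0 (cls-T^≢0 j x cx) , cls-≢0 (cls-T^≢0 j y cy) ,
      [ opposite-parities x y x≢y (suc j) , (λ { refl → opposite-parities-end 0<n x y x≢y }) ]′ (m≤n⇒m<n∨m≡n j<n)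

  odd-orbit : ∀ x → x % 2 ≡ 1 → ∀ i → i < n → τ i x ≢ 0
  odd-orbit x odd i i<n eq with T^-2^ i (n ∸ suc i) x (trans (+-suc i (n ∸ suc i)) (m+[n∸m]≡n i<n))
  ... | w , p , q with m*n≡0⇒m≡0∨n≡0 (2 ^ i) (trans (sym p) eq)
  ... | inj₁ 2^i≡0 = contradiction 2^i≡0 (≢-nonZero⁻¹ (2 ^ i) {{m^n≢0 2 i}})
  ... | inj₂ refl  = contradiction (trans q odd) λ ()

  -- The final cofactor is divisible by 5, as the orbit stays in class 0 and `k` is prime to 5, and
  -- it is less than 5.
  odd-multiple-end : ∀ {x} → x % 2 ≡ 1 → cls x ≡ 0 → x < B → τ n x ≡ 0
  odd-multiple-end {x} odd cx x<B with T^-end x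
  ... | c , p , _ = trans p (trans (cong (k *_) c≡0) (*-zeroʳ k))
    where
    -- `T^-<` is restricted to non-zero classes. Here it is the odd cofactor that keeps the orbit
    -- away from 0 before step `n`.
    bounded : ∀ i → i ≤ n → τ i x < B
    bounded zero    _   = x<B
    bounded (suc i) i<n = subst (_< B) (sym (iterate-suc (T B) x i))
      (T-< (n≢0⇒n>0 (odd-orbit x odd i i<n)) (bounded i (<⇒≤ i<n)))
    cls0 : cls (τ n x) ≡ 0
    cls0 = trans (cls-T^ 5∣B n x) (trans (cong (λ d → iterate neg d n) cx) (neg^-0 n))
    c≡0 : c ≡ 0
    c≡0 = ∣∧<⇒≡0 (5∣2^*⇒5∣ n c (subst (5 ∣_) p (cls≡0⇒5∣ (τ n x) cls0)))
      (*-cancelˡ-< k c 5 (subst₂ _<_ p (*-comm 5 k) (bounded n ≤-refl)))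

  odd-multiple-pure : ∀ x y → x % 2 ≡ 1 → cls x ≡ 0 → cls y ≢ 0 →
    ∀ j → j < n → τ j x ≢ 0 × τ j y ≢ 0 × τ (suc j) x ≢ τ (suc j) y
  odd-multiple-pure x y odd cx cy j j<n = odd-orbit x odd j j<n , cls-≢0 (cls-T^≢0 j y cy) ,
    λ eq → cls-T^≢0 (suc j) y cy (trans (cong cls (sym eq)) (trans (cls-T^ 5∣B (suc j) x)
      (trans (cong (λ d → iterate neg d (suc j)) cx) (neg^-0 (suc j)))))

  odd-multipleˡ : ∀ {x y} → x % 2 ≡ 1 → cls x ≡ 0 → x < B → cls y ≢ 0 →
                  G^ B (suc n) (x , y) ≡ bounce B (τ n y)
  odd-multipleˡ {x} {y} odd cx x<B cy = begin
    G^ B (suc n) (x , y)  ≡⟨ iterate-suc (G B) (x , y) n ⟩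
    G B (G^ B n (x , y))  ≡⟨ cong (G B) (G^-pure n x y (odd-multiple-pure x y odd cx cy)) ⟩
    G B (τ n x , τ n y)   ≡⟨ cong (λ z → G B (z , τ n y)) (odd-multiple-end odd cx x<B) ⟩
    G B (0 , τ n y)       ≡⟨ G-bounceˡ B (τ n y) (cls-≢0 (cls-T^≢0 n y cy)) ⟩
    bounce B (τ n y)      ∎
    where open ≡-Reasoning

  odd-multipleʳ : ∀ {x y} → x % 2 ≡ 1 → cls x ≡ 0 → x < B → cls y ≢ 0 →
                  G^ B (suc n) (y , x) ≡ bounce B (τ n y)
  odd-multipleʳ {x} {y} odd cx x<B cy = begin
    G^ B (suc n) (y , x)  ≡⟨ iterate-suc (G B) (y , x) n ⟩
    G B (G^ B n (y , x))  ≡⟨ cong (G B) (G^-pure n y x λ j j<n → let p , q , r = odd-multiple-pure x y odd cx cy j j<n in q , p , ≢-sym r) ⟩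
    G B (τ n y , τ n x)   ≡⟨ cong (λ z → G B (τ n y , z)) (odd-multiple-end odd cx x<B) ⟩
    G B (τ n y , 0)       ≡⟨ G-bounceʳ B (τ n y) (cls-≢0 (cls-T^≢0 n y cy)) ⟩
    bounce B (τ n y)      ∎
    where open ≡-Reasoning

  opposite-end : ∀ {x y} → x < B → y < B → cls x ≢ 0 → cls y ≢ 0 → cls x ≢ cls y →
                 Fixed k (τ (suc n) x , τ (suc n) y)
  opposite-end {x} {y} x<B y<B cx cy x≢y = go (cls-cases x) (cls-cases y)
    where
    go : cls x ≡ 0 ⊎ cls x ≡ 1 ⊎ cls x ≡ 4 → cls y ≡ 0 ⊎ cls y ≡ 1 ⊎ cls y ≡ 4 →
         Fixed k (τ (suc n) x , τ (suc n) y)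
    go (inj₁ c) _ = contradiction c cx
    go _ (inj₁ c) = contradiction c cy
    go (inj₂ (inj₁ c)) (inj₂ (inj₁ d)) = contradiction (trans c (sym d)) x≢y
    go (inj₂ (inj₂ c)) (inj₂ (inj₂ d)) = contradiction (trans c (sym d)) x≢y
    go (inj₂ (inj₁ c)) (inj₂ (inj₂ d)) = inj₁ (cong₂ _,_ (T^1+n-1 x<B c) (T^1+n-4 y<B d))
    go (inj₂ (inj₂ c)) (inj₂ (inj₁ d)) = inj₂ (cong₂ _,_ (T^1+n-4 x<B c) (T^1+n-1 y<B d))

-- Parity and divisibility of differences

suc-%2 : ∀ x → suc x % 2 ≡ suc (x % 2) % 2
suc-%2 x = %-distribˡ-+ 1 x 2

parity-cases : ∀ x → x % 2 ≡ 0 ⊎ x % 2 ≡ 1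
parity-cases x with x % 2 | m%n<n x 2
... | 0           | _                = inj₁ refl
... | 1           | _                = inj₂ refl
... | suc (suc _) | s≤s (s≤s ())

%2≢suc%2 : ∀ x → x % 2 ≢ suc x % 2
%2≢suc%2 x eq with trans eq (suc-%2 x)
... | eq′ with x % 2 | parity-cases x
... | _ | inj₁ refl = contradiction eq′ λ ()
... | _ | inj₂ refl = contradiction eq′ λ ()

suc-even⇒odd : ∀ x → suc x % 2 ≡ 0 → x % 2 ≡ 1
suc-even⇒odd x e with parity-cases x
... | inj₁ e′ = contradiction (trans e′ (sym e)) (%2≢suc%2 x)
... | inj₂ o  = o

∸-%2 : ∀ {b p} → 2 ∣ b → p ≤ b → (b ∸ p) % 2 ≡ p % 2
∸-%2 {b} {p} 2∣b p≤b = begin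
  (b ∸ p) % 2             ≡⟨ [m+kn]%n≡m%n (b ∸ p) p 2 ⟨
  (b ∸ p + p * 2) % 2     ≡⟨ cong (_% 2) (lemma (b ∸ p) p) ⟩
  (b ∸ p + p + p) % 2     ≡⟨ cong (λ z → (z + p) % 2) (m∸n+n≡m p≤b) ⟩
  (b + p) % 2             ≡⟨ %-remove-+ˡ p 2∣b ⟩
  p % 2                   ∎
  where
  open ≡-Reasoning
  lemma : ∀ a p → a + p * 2 ≡ a + p + p
  lemma = solve-∀

≡⇒≢ : ∀ {x y z : ℕ} → x ≡ y → y ≢ z → x ≢ z
≡⇒≢ refl y≢z = y≢z

∣∣-∣ : ∀ {d m n} → d ∣ m → d ∣ n → d ∣ ∣ m - n ∣
∣∣-∣ {m = m} {n} d∣m d∣n with ∣-∣-cases m n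
... | inj₁ eq = ∣m+n∣m⇒∣n (subst (_ ∣_) eq d∣m) d∣n
... | inj₂ eq = ∣m+n∣m⇒∣n (subst (_ ∣_) (sym eq) d∣n) d∣m

%≡⇒∣∣-∣ : ∀ {d} .{{_ : NonZero d}} m n → m % d ≡ n % d → d ∣ ∣ m - n ∣
%≡⇒∣∣-∣ {d} m n eq = divides ∣ m / d - n / d ∣ (begin
  ∣ m - n ∣                                         ≡⟨ cong₂ ∣_-_∣ (m≡m%n+[m/n]*n m d) (m≡m%n+[m/n]*n n d) ⟩
  ∣ m % d + m / d * d - n % d + n / d * d ∣         ≡⟨ cong (λ r → ∣ m % d + m / d * d - r + n / d * d ∣) eq ⟨
  ∣ m % d + m / d * d - m % d + n / d * d ∣         ≡⟨ ∣m+n-m+o∣≡∣n-o∣ (m % d) (m / d * d) (n / d * d) ⟩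
  ∣ m / d * d - n / d * d ∣                         ≡⟨ *-distribʳ-∣-∣ d (m / d) (n / d) ⟨
  ∣ m / d - n / d ∣ * d                             ∎)
  where open ≡-Reasoning

cls-≡ : ∀ x y → cls x ≡ cls y → 5 ∣ ∣ x - y ∣ ⊎ 5 ∣ x + y
cls-≡ x y eq = euclidsLemma ∣ x - y ∣ (x + y) 5-prime
  (subst (5 ∣_) factor (%≡⇒∣∣-∣ (x * x) (y * y) eq))
  where
  open ≡-Reasoning
  l₁ : ∀ x y → x * y + x * x ≡ x * (x + y)
  l₁ = solve-∀
  l₂ : ∀ x y → x * y + y * y ≡ y * (x + y)
  l₂ = solve-∀
  factor : ∣ x * x - y * y ∣ ≡ ∣ x - y ∣ * (x + y)
  factor = begin
    -- Adding `x * y` to both squares makes each side a multiple of `x + y`, so the factorisation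
    -- needs no case distinction on signs.
    ∣ x * x - y * y ∣                     ≡⟨ ∣m+n-m+o∣≡∣n-o∣ (x * y) (x * x) (y * y) ⟨
    ∣ x * y + x * x - x * y + y * y ∣     ≡⟨ cong₂ ∣_-_∣ (l₁ x y) (l₂ x y) ⟩
    ∣ x * (x + y) - y * (x + y) ∣         ≡⟨ *-distribʳ-∣-∣ (x + y) x y ⟨
    ∣ x - y ∣ * (x + y)                   ∎

∣-∣-< : ∀ {m n b} → m < b → n < b → ∣ m - n ∣ < b
∣-∣-< {m} {n} m<b n<b = ≤-<-trans (∣m-n∣≤m⊔n m n) (⊔-lub m<b n<b)

-- One full run from a bounced or merged pair

module Exact (n : ℕ) (0<n : 0 < n) where

  private
    k = 2 ^ n
    B = 5 * k
    instance
      k≢0 : NonZero k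
      k≢0 = m^n≢0 2 n
      B≢0 : NonZero B
      B≢0 = m*n≢0 5 k

  2∣B : 2 ∣ B
  2∣B = ∣n⇒∣m*n 5 (2∣2^ 0<n)

  ∸<B : ∀ {p} → p ≢ 0 → p < B → B ∸ p < B
  ∸<B {p} p≢0 p<B = ∸-monoʳ-< {B} {p} {0} (n≢0⇒n>0 p≢0) (<⇒≤ p<B)

  cls-B∸ : ∀ {p} → p < B → cls (B ∸ p) ≡ cls p
  cls-B∸ p<B = cls-∸ (5∣B n) (<⇒≤ p<B)

  even-< : ∀ u → u % 2 ≡ 0 → u < B → suc u < B
  even-< u even u<B = ≤∧≢⇒< u<B λ eq →
    %2≢suc%2 u (trans even (sym (trans (cong (_% 2) eq) (n∣m⇒m%n≡0 B 2 2∣B))))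

  pred-< : ∀ {p} → p < B → p ∸ 1 < B
  pred-< {p} p<B = ≤-<-trans (m∸n≤m p 1) p<B

  %5⇒≢0 : ∀ {r} p → p % 5 ≡ suc r → p ≢ 0
  %5⇒≢0 _ () refl

  pred-odd : ∀ r p → p % 5 ≡ suc r → p % 2 ≡ 0 → (p ∸ 1) % 2 ≡ 1
  pred-odd r p p≡ even = suc-even⇒odd (p ∸ 1) (trans (cong (_% 2) (proj₂ (proj₂ (proj₂ (neighbours r p p≡))))) even)

  suc-odd : ∀ u → u % 2 ≡ 0 → suc u % 2 ≡ 1
  suc-odd u even = trans (suc-%2 u) (cong (λ r → suc r % 2) even)

  merge≡ : ∀ u → u ≢ 0 → merge u ≡ (suc u , u ∸ 1)
  merge≡ zero    u≢0 = contradiction refl u≢0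
  merge≡ (suc u) _   = refl

  OppositePair : State → Set
  OppositePair (x , y) = x < B × y < B × cls x ≢ 0 × cls y ≢ 0 × cls x ≢ cls y

  -- Modulo 5 the entries `p - 1` and `B - p` are 1 and 3 for `p ≡ 2`, and 3 and 1 for `p ≡ 4`.
  bounce-opposite : ∀ p → p % 5 ≡ 2 ⊎ p % 5 ≡ 4 → p < B → OppositePair (bounce B p)
  bounce-opposite p (inj₁ p≡2) p<B with neighbours 1 p p≡2
  ... | c⁻ , c , _ , _ = pred-< p<B , ∸<B (%5⇒≢0 p p≡2) p<B , ≡⇒≢ c⁻ (λ ()) , ≡⇒≢ c′ (λ ()) ,
    λ eq → contradiction (trans (sym c⁻) (trans eq c′)) λ ()
    where c′ = trans (cls-B∸ p<B) c
  bounce-opposite p (inj₂ p≡4) p<B with neighbours 3 p p≡4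
  ... | c⁻ , c , _ , _ = pred-< p<B , ∸<B (%5⇒≢0 p p≡4) p<B , ≡⇒≢ c⁻ (λ ()) , ≡⇒≢ c′ (λ ()) ,
    λ eq → contradiction (trans (sym c⁻) (trans eq c′)) λ ()
    where c′ = trans (cls-B∸ p<B) c

  -- Both entries are 2 modulo 5, and since `B` is even they have different parities; the common
  -- value after `suc n` tent steps is `k`.
  bounce-equal : ∀ p → p % 5 ≡ 3 → p < B → G^ B (suc n) (bounce B p) ≡ merge k
  bounce-equal p p≡3 p<B with neighbours 2 p p≡3
  ... | c⁻ , c , _ , suc-pred = trans
    (same-class n 0<n {p ∸ 1} {B ∸ p}
      (λ eq → %2≢suc%2 (p ∸ 1) (trans eq (trans (∸-%2 2∣B (<⇒≤ p<B)) (cong (_% 2) (sym suc-pred)))))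
      (≡⇒≢ c⁻ λ ()) (trans c⁻ (sym (trans (cls-B∸ p<B) c))) (pred-< p<B) (∸<B (%5⇒≢0 p p≡3) p<B))
    (cong merge (T^1+n-4 n (pred-< p<B) c⁻))

  -- The odd multiple `p - 1` of 5 vanishes after `n` steps, when the even entry `B - p` of class 1
  -- has become `k`.
  bounce-multiple : ∀ p → p % 5 ≡ 1 → p % 2 ≡ 0 → p < B → G^ B (suc n) (bounce B p) ≡ bounce B k
  bounce-multiple p p≡1 even p<B with neighbours 0 p p≡1
  ... | c⁻ , c , _ , _ = trans
    (odd-multipleˡ n (pred-odd 0 p p≡1 even) c⁻ (pred-< p<B) (≡⇒≢ c′ λ ()))
    (cong (bounce B) (T^n-even-1 n 0<n (∸<B (%5⇒≢0 p p≡1) p<B) c′ (trans (∸-%2 2∣B (<⇒≤ p<B)) even)))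
    where c′ = trans (cls-B∸ p<B) c

  merge-opposite : ∀ u → u % 5 ≡ 2 ⊎ u % 5 ≡ 3 → u % 2 ≡ 0 → u < B → OppositePair (merge u)
  merge-opposite u (inj₁ u≡2) even u<B with neighbours 1 u u≡2
  ... | c⁻ , _ , c⁺ , _ = subst OppositePair (sym (merge≡ u (%5⇒≢0 u u≡2)))
    (even-< u even u<B , pred-< u<B , ≡⇒≢ c⁺ (λ ()) , ≡⇒≢ c⁻ (λ ()) ,
      λ eq → contradiction (trans (sym c⁺) (trans eq c⁻)) λ ())
  merge-opposite u (inj₂ u≡3) even u<B with neighbours 2 u u≡3
  ... | c⁻ , _ , c⁺ , _ = subst OppositePair (sym (merge≡ u (%5⇒≢0 u u≡3)))
    (even-< u even u<B , pred-< u<B , ≡⇒≢ c⁺ (λ ()) , ≡⇒≢ c⁻ (λ ()) ,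
      λ eq → contradiction (trans (sym c⁺) (trans eq c⁻)) λ ())

  -- One of `u + 1` and `u - 1` is an odd multiple of 5; the other is odd and `± 2` modulo 5, so it
  -- has become `2 k` when the first vanishes.
  merge-multiple : ∀ u → u % 5 ≡ 1 ⊎ u % 5 ≡ 4 → u % 2 ≡ 0 → u < B →
                   G^ B (suc n) (merge u) ≡ bounce B (2 * k)
  merge-multiple u (inj₁ u≡1) even u<B with neighbours 0 u u≡1
  ... | c⁻ , _ , c⁺ , _ = trans (cong (G^ B (suc n)) (merge≡ u (%5⇒≢0 u u≡1))) (trans
    (odd-multipleʳ n (pred-odd 0 u u≡1 even) c⁻ (pred-< u<B) (≡⇒≢ c⁺ λ ()))
    (cong (bounce B) (T^n-odd-4 n 0<n (even-< u even u<B) c⁺ (suc-odd u even))))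
  merge-multiple u (inj₂ u≡4) even u<B with neighbours 3 u u≡4
  ... | c⁻ , _ , c⁺ , _ = trans (cong (G^ B (suc n)) (merge≡ u (%5⇒≢0 u u≡4))) (trans
    (odd-multipleˡ n (suc-odd u even) c⁺ (even-< u even u<B) (≡⇒≢ c⁻ λ ()))
    (cong (bounce B) (T^n-odd-4 n 0<n (pred-< u<B) c⁻ (pred-odd 3 u u≡4 even))))

  reach-oppositePair : ∀ {s} → OppositePair s → Fixed k (G^ B (suc n) s)
  reach-oppositePair {x , y} (x<B , y<B , cx , cy , x≢y) = subst (Fixed k)
    (sym (opposite-classes n (suc n) x y cx cy x≢y)) (opposite-end n x<B y<B cx cy x≢y)

  within-oppositePair : ∀ {s} → OppositePair s → Within k (suc n) s
  within-oppositePair opp = within-reach (reach-oppositePair opp)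

-- Upper bounds, given the times from `merge k`, `bounce k` and `bounce 2 k`

module Upper (n : ℕ) (0<n : 0 < n) (e′ f′ M : ℕ)
  (merge-k   : Within (2 ^ n) e′ (merge (2 ^ n)))
  (bounce-k  : Within (2 ^ n) e′ (bounce (5 * 2 ^ n) (2 ^ n)))
  (bounce-2k : Within (2 ^ n) f′ (bounce (5 * 2 ^ n) (2 * 2 ^ n)))
  (e≤M : 3 + n + e′ ≤ M) (f≤M : 2 + n + f′ ≤ M)
  where

  open Exact n 0<n

  private
    k = 2 ^ n
    B = 5 * k
    -- For `p` and `u` even and prime to 5, one run takes `bounce p` to the fixed pair, `merge k` or
    -- `bounce k`, and `merge u` to the fixed pair or `bounce 2 k`; `e` and `f` add this run to the
    -- time that remains. `M` leaves room for two further steps before `e` and for one before `f`.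
    e = suc n + e′
    f = suc n + f′
    instance
      k≢0 : NonZero k
      k≢0 = m^n≢0 2 n
      B≢0 : NonZero B
      B≢0 = m*n≢0 5 k

  multiple-≡0 : ∀ {x} → cls x ≡ 0 → 2 ^ n ∣ x → x < B → x ≡ 0
  multiple-≡0 {x} cx 2^n∣x x<B = ∣∧<⇒≡0 (5*2^∣ n (cls≡0⇒5∣ x cx) 2^n∣x) x<B

  2^∣-T : ∀ a r {x} → suc a + r ≡ n → 2 ^ a ∣ x → 2 ^ suc a ∣ T B x
  2^∣-T a r eq (divides w refl) = subst (2 ^ suc a ∣_)
    (trans (sym (T-2^ n a r w eq)) (cong (T B) (*-comm (2 ^ a) w))) (m∣m*n {2 ^ suc a} ∣ w - 5 * 2 ^ r ∣)

  within-bounce-even : ∀ p → p % 2 ≡ 0 → p < B → cls p ≢ 0 → Within k e (bounce B p)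
  within-bounce-even p even p<B cp with residues p
  ... | inj₁ p≡0 = contradiction (trans (cls-% p) (cong cls p≡0)) cp
  ... | inj₂ (inj₁ p≡1) = within-G^ (suc n) (bounce-multiple p p≡1 even p<B) bounce-k
  ... | inj₂ (inj₂ (inj₁ p≡2)) = within-≤ (m≤m+n (suc n) e′) (within-oppositePair (bounce-opposite p (inj₁ p≡2) p<B))
  ... | inj₂ (inj₂ (inj₂ (inj₁ p≡3))) = within-G^ (suc n) (bounce-equal p p≡3 p<B) merge-k
  ... | inj₂ (inj₂ (inj₂ (inj₂ p≡4))) = within-≤ (m≤m+n (suc n) e′) (within-oppositePair (bounce-opposite p (inj₂ p≡4) p<B))

  -- Each step raises the power of 2 that is known to divide `x`, and no positive `x < B` is a
  -- multiple of `5 * 2 ^ n`, so `x` vanishes in at most `r` steps. The other entry is then a value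
  -- of `T` and hence even, as `within-bounce-even` requires.
  within-multiple : ∀ a r x y → a + r ≡ n → 2 ^ a ∣ x → cls x ≡ 0 → x ≢ 0 → x < B →
                    cls y ≢ 0 → y < B → Within k (suc r + e) (x , y)
  within-multiple a zero x y a≡n 2^a∣x cx x≢0 x<B _ _ = contradiction
    (multiple-≡0 cx (subst (λ a → 2 ^ a ∣ x) (trans (sym (+-identityʳ a)) a≡n) 2^a∣x) x<B) x≢0
  within-multiple a (suc r) x y a+r≡n 2^a∣x cx x≢0 x<B cy y<B with T B x ≟ 0
  ... | yes Tx≡0 = within-≤ (s≤s (s≤s (m≤n+m e r))) (within-step pure (within-step
      (G-bounceˡ B (T B y) (cls-≢0 cTy))
      (within-bounce-even (T B y) (n∣m⇒m%n≡0 (T B y) 2 (T-even y 2∣B)) (T^-< n 1 y<B cy) cTy)))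
    where
    cTy : cls (T B y) ≢ 0
    cTy = cls-T^≢0 n 1 y cy
    pure : G B (x , y) ≡ (0 , T B y)
    pure = trans (G-pure B x y x≢0 (cls-≢0 cy) (λ eq → cls-≢0 cTy (trans (sym eq) Tx≡0)))
                 (cong (_, T B y) Tx≡0)
  ... | no Tx≢0 = within-step
      (G-pure B x y x≢0 (cls-≢0 cy) (λ eq → cls-T^≢0 n 1 y cy (trans (cong cls (sym eq)) cTx)))
      (within-multiple (suc a) r (T B x) (T B y) eq (2^∣-T a r eq 2^a∣x) cTx Tx≢0
        (T-< (n≢0⇒n>0 x≢0) x<B) (cls-T^≢0 n 1 y cy) (T^-< n 1 y<B cy))
    where
    eq : suc a + r ≡ n
    eq = trans (sym (+-suc a r)) a+r≡n
    cTx : cls (T B x) ≡ 0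
    cTx = trans (cls-T x (5∣B n)) (cong neg cx)

  -- If `p ≡ 1` has unknown parity, `p - 1` may carry any power of 2, so `within-multiple` takes the
  -- place of `bounce-multiple`.
  within-bounce : ∀ p → p < B → cls p ≢ 0 → Within k (suc n + e) (bounce B p)
  within-bounce p p<B cp with residues p
  ... | inj₁ p≡0 = contradiction (trans (cls-% p) (cong cls p≡0)) cp
  ... | inj₂ (inj₂ (inj₁ p≡2)) = within-≤ (m≤m+n (suc n) e) (within-oppositePair (bounce-opposite p (inj₁ p≡2) p<B))
  ... | inj₂ (inj₂ (inj₂ (inj₁ p≡3))) = within-≤ (m≤n+m e (suc n)) (within-G^ (suc n) (bounce-equal p p≡3 p<B) merge-k)
  ... | inj₂ (inj₂ (inj₂ (inj₂ p≡4))) = within-≤ (m≤m+n (suc n) e) (within-oppositePair (bounce-opposite p (inj₂ p≡4) p<B))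
  within-bounce (suc (suc w)) p<B cp | inj₂ (inj₁ p≡1) =
    within-multiple 0 n (suc w) (B ∸ (2 + w)) refl (1∣ suc w) (proj₁ (neighbours 0 (2 + w) p≡1)) (λ ())
      (pred-< p<B) (≡⇒≢ (cls-B∸ p<B) cp) (∸<B (λ ()) p<B)
  -- The bounce of 1 is `(0 , B - 1)`, which bounces at once again, and `B - 1 ≡ 4` leads to
  -- opposite classes.
  within-bounce (suc zero) p<B cp | inj₂ (inj₁ _) = within-≤
    (≤-trans (≤-reflexive (+-comm 1 (suc n))) (+-monoʳ-≤ (suc n) (s≤s z≤n)))
    (within-step (G-bounceˡ B (B ∸ 1) (λ eq → <⇒≱ p<B (m∸n≡0⇒m≤n eq)))
      (within-oppositePair (bounce-opposite (B ∸ 1) (inj₂ B∸1≡4) (∸<B (λ ()) p<B))))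
    where
    B∸1≡4 : (B ∸ 1) % 5 ≡ 4
    B∸1≡4 = %-pred-≡0 {B ∸ 1} {5} (trans (cong (_% 5) (m+[n∸m]≡n (<⇒≤ p<B))) (n∣m⇒m%n≡0 B 5 (5∣B n)))

  -- After the bounce, `B - p` inherits the factors 5 and `2 ^ a` of `p`, while `p - 1` is prime to
  -- 5.
  within-zero-multiple : ∀ a r p → a + r ≡ n → 2 ^ a ∣ p → cls p ≡ 0 → p ≢ 0 → p < B →
                         Within k (2 + r + e) (0 , p)
  within-zero-multiple a r zero    _ _ _ p≢0 _ = contradiction refl p≢0
  within-zero-multiple a r (suc w) a+r≡n 2^a∣p cp p≢0 p<B = within-step refl (within-swap {x = B ∸ suc w} {w}
    (within-multiple a r (B ∸ suc w) w a+r≡n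
      (∣m+n∣m⇒∣n (subst (2 ^ a ∣_) (sym (m+[n∸m]≡n (<⇒≤ p<B))) 2^a∣B) 2^a∣p)
      (trans (cls-B∸ p<B) cp) (λ eq → <⇒≱ p<B (m∸n≡0⇒m≤n eq)) (∸<B p≢0 p<B)
      (≡⇒≢ cw λ ()) (pred-< p<B)))
    where
    2^a∣B : 2 ^ a ∣ B
    2^a∣B = ∣n⇒∣m*n 5 (divides (2 ^ r) (trans (cong (2 ^_) (trans (sym a+r≡n) (+-comm a r))) (^-distribˡ-+-* 2 r a)))
    cw : cls w ≡ 1
    cw = trans (cls-% w) (cong cls (%-pred-≡0 {w} {5} (n∣m⇒m%n≡0 (suc w) 5 (cls≡0⇒5∣ (suc w) cp))))

  within-zero : ∀ p → p < B → Within k (n + M) (0 , p)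
  within-zero zero    _ = within-cycle 0 refl λ
    { (inj₁ eq) → 3k≢0 {k} (sym (cong proj₁ eq)) ; (inj₂ eq) → 3k≢0 {k} (sym (cong proj₂ eq)) }
  within-zero p@(suc _) p<B with cls p ≟ 0
  ... | yes cp = within-≤ (≤-trans (≤-reflexive (lemma n e)) (+-monoʳ-≤ n e≤M))
      (within-zero-multiple 0 n p refl (1∣ p) cp (λ ()) p<B)
    where
    lemma : ∀ n e → 2 + n + e ≡ n + (2 + e)
    lemma = solve-∀
  ... | no cp = within-≤ (≤-trans (≤-reflexive (lemma n e)) (+-monoʳ-≤ n e≤M))
      (within-step refl (within-bounce p p<B cp))
    where
    lemma : ∀ n e → suc (suc n + e) ≡ n + (2 + e)
    lemma = solve-∀

  within-merge : ∀ u → u % 2 ≡ 0 → u < B → cls u ≢ 0 → Within k f (merge u)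
  within-merge u even u<B cu with residues u
  ... | inj₁ u≡0 = contradiction (trans (cls-% u) (cong cls u≡0)) cu
  ... | inj₂ (inj₁ u≡1) = within-G^ (suc n) (merge-multiple u (inj₁ u≡1) even u<B) bounce-2k
  ... | inj₂ (inj₂ (inj₁ u≡2)) = within-≤ (m≤m+n (suc n) f′) (within-oppositePair (merge-opposite u (inj₁ u≡2) even u<B))
  ... | inj₂ (inj₂ (inj₂ (inj₁ u≡3))) = within-≤ (m≤m+n (suc n) f′) (within-oppositePair (merge-opposite u (inj₂ u≡3) even u<B))
  ... | inj₂ (inj₂ (inj₂ (inj₂ u≡4))) = within-G^ (suc n) (merge-multiple u (inj₂ u≡4) even u<B) bounce-2k

  -- One of x - y and x + y is divisible by 5.  By T-diff and T-sum it is
  -- doubled in each step, and the pair merges once it vanishes modulo B.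
  within-same-class : ∀ r x y → x < B → y < B → cls x ≢ 0 → cls x ≡ cls y →
    B ∣ 2 ^ r * ∣ x - y ∣ ⊎ B ∣ 2 ^ r * ∣ x + y - B ∣ → Within k (suc r + f) (x , y)
  within-same-class r x y x<B y<B cx x≡y d with T B x ≟ T B y
  ... | yes eq = within-≤ (s≤s (m≤n+m f r))
    (within-step (G-merge B x y (cls-≢0 cx) (cls-≢0 (subst (_≢ 0) x≡y cx)) eq)
      (within-merge (T B x) (n∣m⇒m%n≡0 (T B x) 2 (T-even x 2∣B)) (T^-< n 1 x<B cx) (cls-T^≢0 n 1 x cx)))
  within-same-class zero x y x<B y<B cx x≡y d | no t≢t = contradiction (d⇒T≡ d) t≢t
    where
    zero-case : ∀ z → z < B → B ∣ 1 * z →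
      2 * z ≡ T B x + T B y ⊎ 2 * z ≡ ∣ T B x - T B y ∣ → T B x ≡ T B y
    zero-case z z<B B∣z eqs with ∣∧<⇒≡0 (subst (B ∣_) (*-identityˡ z) B∣z) z<B
    ... | refl = [ (λ eq → trans (m+n≡0⇒m≡0 (T B x) (sym eq)) (sym (m+n≡0⇒n≡0 (T B x) (sym eq))))
                 , (λ eq → ∣m-n∣≡0⇒m≡n (sym eq)) ]′ eqs
    sum-< : ∣ x + y - B ∣ < B
    sum-< with ∣-∣-cases (x + y) B
    ... | inj₁ eq = +-cancelˡ-< B _ _ (subst (_< B + B) eq (+-mono-< x<B y<B))
    ... | inj₂ eq = subst (∣ x + y - B ∣ <_) eq (m<n+m _ (≤-trans (n≢0⇒n>0 (cls-≢0 cx)) (m≤m+n x y)))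
    d⇒T≡ : B ∣ 1 * ∣ x - y ∣ ⊎ B ∣ 1 * ∣ x + y - B ∣ → T B x ≡ T B y
    d⇒T≡ (inj₁ d) = zero-case ∣ x - y ∣ (∣-∣-< x<B y<B) d (T-diff B x y)
    d⇒T≡ (inj₂ d) = zero-case ∣ x + y - B ∣ sum-< d (T-sum B x y)
  within-same-class (suc r) x y x<B y<B cx x≡y d | no t≢t =
    within-step (G-pure B x y (cls-≢0 cx) (cls-≢0 cy) t≢t)
      (within-same-class r (T B x) (T B y) (T^-< n 1 x<B cx) (T^-< n 1 y<B cy) (cls-T^≢0 n 1 x cx)
        (trans (cls-T x (5∣B n)) (trans (cong neg x≡y) (sym (cls-T y (5∣B n)))))
        ([ (λ d → next ∣ x - y ∣ d (T-diff B x y)) , (λ d → next ∣ x + y - B ∣ d (T-sum B x y)) ]′ d))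
    where
    cy : cls y ≢ 0
    cy = subst (_≢ 0) x≡y cx
    next : ∀ z → B ∣ 2 ^ suc r * z → 2 * z ≡ T B x + T B y ⊎ 2 * z ≡ ∣ T B x - T B y ∣ →
      B ∣ 2 ^ r * ∣ T B x - T B y ∣ ⊎ B ∣ 2 ^ r * ∣ T B x + T B y - B ∣
    next z d eqs = [ (λ eq → inj₂ (subst (B ∣_) (sym (*-distribˡ-∣-∣ (2 ^ r) _ B))
                       (∣∣-∣ (subst (λ t → B ∣ 2 ^ r * t) eq d′) (n∣m*n (2 ^ r)))))
                   , (λ eq → inj₁ (subst (λ t → B ∣ 2 ^ r * t) eq d′)) ]′ eqs
      where
      lemma : ∀ a z → 2 * a * z ≡ a * (2 * z)
      lemma = solve-∀
      d′ : B ∣ 2 ^ r * (2 * z)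
      d′ = subst (B ∣_) (lemma (2 ^ r) z) d

  -- The entries `u ± 1` both have class 1 and their sum is `2 u`. This carries one factor 2 more
  -- than `u`, so for `suc r` missing factors of `u` the run of `within-same-class` starts with `r`.
  within-merge-multiple : ∀ a r u → a + r ≡ n → 2 ^ a ∣ u → cls u ≡ 0 → u ≢ 0 → u < B → u % 2 ≡ 0 →
                          Within k (r + f) (merge u)
  within-merge-multiple a r zero _ _ _ u≢0 _ _ = contradiction refl u≢0
  within-merge-multiple a zero u@(suc _) a≡n 2^a∣u cu u≢0 u<B _ = contradiction
    (multiple-≡0 cu (subst (λ a → 2 ^ a ∣ u) (trans (sym (+-identityʳ a)) a≡n) 2^a∣u) u<B) u≢0
  within-merge-multiple a (suc r) (suc w) a+r≡n 2^a∣u cu u≢0 u<B even =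
    within-same-class r (2 + w) w (even-< (suc w) even u<B) (<-trans (n<1+n w) u<B)
      (≡⇒≢ cv λ ()) (trans cv (sym cw))
      (inj₂ (subst (B ∣_) (sym (*-distribˡ-∣-∣ (2 ^ r) (2 + w + w) B)) (∣∣-∣ B∣ (n∣m*n (2 ^ r)))))
    where
    w≡4 : w % 5 ≡ 4
    w≡4 = %-pred-≡0 {w} {5} (n∣m⇒m%n≡0 (suc w) 5 (cls≡0⇒5∣ (suc w) cu))
    cw : cls w ≡ 1
    cw = trans (cls-% w) (cong cls w≡4)
    cv : cls (2 + w) ≡ 1
    cv = trans (cls-% (2 + w)) (cong cls (trans (%-distribˡ-+ 2 w 5) (cong (λ r → (2 + r) % 5) w≡4)))
    l₁ : ∀ a b → 5 * (a * (2 * b)) ≡ 2 * b * (5 * a)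
    l₁ = solve-∀
    l₂ : ∀ b w → 2 * b * suc w ≡ b * (2 + w + w)
    l₂ = solve-∀
    B≡ : B ≡ 2 ^ suc r * (5 * 2 ^ a)
    B≡ = trans (cong (λ m → 5 * 2 ^ m) (sym a+r≡n))
      (trans (cong (5 *_) (^-distribˡ-+-* 2 a (suc r))) (l₁ (2 ^ a) (2 ^ r)))
    B∣ : B ∣ 2 ^ r * (2 + w + w)
    B∣ = subst₂ _∣_ (sym B≡) (l₂ (2 ^ r) w) (*-monoʳ-∣ (2 ^ suc r) (5*2^∣ a (cls≡0⇒5∣ (suc w) cu) 2^a∣u))

  -- The powers of 2 known to divide the entries grow with each step, so a merge or a zero must
  -- occur before they reach `2 ^ n`. Each outcome is passed on to the lemma for that configuration.
  within-multiples : ∀ a r x y → a + r ≡ n → 2 ^ a ∣ x → 2 ^ a ∣ y → cls x ≡ 0 → cls y ≡ 0 →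
    x ≢ 0 → y ≢ 0 → x < B → y < B → Within k (r + M) (x , y)
  within-multiples a zero x y a≡n 2^a∣x _ cx _ x≢0 _ x<B _ = contradiction
    (multiple-≡0 cx (subst (λ a → 2 ^ a ∣ x) (trans (sym (+-identityʳ a)) a≡n) 2^a∣x) x<B) x≢0
  within-multiples a (suc r) x y a+r≡n 2^a∣x 2^a∣y cx cy x≢0 y≢0 x<B y<B
    with T B x ≟ T B y | T B x ≟ 0 | T B y ≟ 0
  -- `merge 0` is `(1 , 1)`, whose equal entries merge at once again, this time to `merge (T B 1)`
  -- with `T B 1` even and prime to 5.
  ... | yes t≡t | yes Tx≡0 | _ = within-≤ (s≤s (≤-trans f≤M (m≤n+m M r)))
    (within-step (trans (G-merge B x y x≢0 y≢0 t≡t) (cong merge Tx≡0))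
      (within-step (G-merge B 1 1 (λ ()) (λ ()) refl)
        (within-merge (T B 1) (n∣m⇒m%n≡0 (T B 1) 2 (T-even 1 2∣B)) (T-< z<s 1<B)
          (≡⇒≢ (cls-T 1 (5∣B n)) λ ()))))
    where
    1<B : 1 < B
    1<B = ≤-trans (s≤s (s≤s z≤n)) (*-monoʳ-≤ 5 (>-nonZero⁻¹ k))
  ... | yes t≡t | no Tx≢0 | _ = within-≤ (s≤s (+-monoʳ-≤ r (≤-trans (n≤1+n f) f≤M)))
    (within-step (G-merge B x y x≢0 y≢0 t≡t)
      (within-merge-multiple (suc a) r (T B x) eq (2^∣-T a r eq 2^a∣x)
        (trans (cls-T x (5∣B n)) (cong neg cx)) Tx≢0 (T-< (n≢0⇒n>0 x≢0) x<B)
        (n∣m⇒m%n≡0 (T B x) 2 (T-even x 2∣B))))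
    where
    eq : suc a + r ≡ n
    eq = trans (sym (+-suc a r)) a+r≡n
  ... | no t≢t | yes Tx≡0 | _ = within-≤ (s≤s (≤-trans (≤-reflexive (lemma r e)) (+-monoʳ-≤ r e≤M)))
    (within-step (trans (G-pure B x y x≢0 y≢0 t≢t) (cong (_, T B y) Tx≡0))
      (within-zero-multiple (suc a) r (T B y) eq (2^∣-T a r eq 2^a∣y)
        (trans (cls-T y (5∣B n)) (cong neg cy)) (λ Ty≡0 → t≢t (trans Tx≡0 (sym Ty≡0)))
        (T-< (n≢0⇒n>0 y≢0) y<B)))
    where
    eq : suc a + r ≡ n
    eq = trans (sym (+-suc a r)) a+r≡n
    lemma : ∀ r e → 2 + r + e ≡ r + (2 + e)
    lemma = solve-∀
  ... | no t≢t | no Tx≢0 | yes Ty≡0 = within-≤ (s≤s (≤-trans (≤-reflexive (lemma r e)) (+-monoʳ-≤ r e≤M)))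
    (within-step (trans (G-pure B x y x≢0 y≢0 t≢t) (cong (T B x ,_) Ty≡0)) (within-swap
      (within-zero-multiple (suc a) r (T B x) eq (2^∣-T a r eq 2^a∣x)
        (trans (cls-T x (5∣B n)) (cong neg cx)) Tx≢0 (T-< (n≢0⇒n>0 x≢0) x<B))))
    where
    eq : suc a + r ≡ n
    eq = trans (sym (+-suc a r)) a+r≡n
    lemma : ∀ r e → 2 + r + e ≡ r + (2 + e)
    lemma = solve-∀
  ... | no t≢t | no Tx≢0 | no Ty≢0 = within-step (G-pure B x y x≢0 y≢0 t≢t)
    (within-multiples (suc a) r (T B x) (T B y) eq (2^∣-T a r eq 2^a∣x) (2^∣-T a r eq 2^a∣y)
      (trans (cls-T x (5∣B n)) (cong neg cx)) (trans (cls-T y (5∣B n)) (cong neg cy)) Tx≢0 Ty≢0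
      (T-< (n≢0⇒n>0 x≢0) x<B) (T-< (n≢0⇒n>0 y≢0) y<B))
    where
    eq : suc a + r ≡ n
    eq = trans (sym (+-suc a r)) a+r≡n

  private
    5∣⇒B∣ : ∀ z → 5 ∣ z → B ∣ k * z
    5∣⇒B∣ z 5∣z = subst (_∣ k * z) (*-comm k 5) (*-monoʳ-∣ k 5∣z)

  within-all : ∀ x y → x < B → y < B → Within k (n + M) (x , y)
  within-all zero    y       _   y<B = within-zero y y<B
  within-all (suc x) zero    x<B _   = within-swap (within-zero (suc x) x<B)
  within-all x@(suc _) y@(suc _) x<B y<B with cls x ≟ 0 | cls y ≟ 0 | cls x ≟ cls y
  ... | yes cx | yes cy | _ = within-multiples 0 n x y refl (1∣ x) (1∣ y) cx cy (λ ()) (λ ()) x<B y<B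
  ... | yes cx | no cy  | _ = within-≤ (≤-trans (≤-reflexive (sym (+-suc n e))) (+-monoʳ-≤ n (≤-trans (n≤1+n _) e≤M)))
    (within-multiple 0 n x y refl (1∣ x) cx (λ ()) x<B cy y<B)
  ... | no cx  | yes cy | _ = within-≤ (≤-trans (≤-reflexive (sym (+-suc n e))) (+-monoʳ-≤ n (≤-trans (n≤1+n _) e≤M)))
    (within-swap (within-multiple 0 n y x refl (1∣ y) cy (λ ()) y<B cx x<B))
  ... | no cx | no cy | no x≢y = within-≤ (≤-trans (≤-reflexive (+-comm 1 n)) (+-monoʳ-≤ n (≤-trans (s≤s z≤n) f≤M)))
    (within-oppositePair (x<B , y<B , cx , cy , x≢y))
  ... | no cx | no cy | yes x≡y = within-≤ (≤-trans (≤-reflexive (sym (+-suc n f))) (+-monoʳ-≤ n f≤M))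
    (within-same-class n x y x<B y<B cx x≡y (map (5∣⇒B∣ ∣ x - y ∣) (λ d → 5∣⇒B∣ ∣ x + y - B ∣ (∣∣-∣ d (5∣B n))) (cls-≡ x y x≡y)))

-- Bounds by residue of `k`, and starting pairs with a known time

record Exactly (k N : ℕ) (s : State) : Set where
  constructor exactly
  field
    not-yet : ¬ Fixed k (G^ (5 * k) N s)
    fixed   : Fixed k (G^ (5 * k) (suc N) s)

exactly-G^ : ∀ {k} i {N s s′} → G^ (5 * k) i s ≡ s′ → Exactly k N s′ → Exactly k (i + N) s
exactly-G^ {k} i {N} {s} refl (exactly ¬fx fx) = exactly
  (λ fx′ → ¬fx (subst (Fixed k) (iterate-+ (G (5 * k)) s i N) fx′))
  (subst (Fixed k) (trans (sym (iterate-+ (G (5 * k)) s i (suc N)))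
    (cong (λ t → G^ (5 * k) t s) (+-suc i N))) fx)

below-not-fixedˡ : ∀ {k x y} → x < k → ¬ Fixed k (x , y)
below-not-fixedˡ {k} x<k (inj₁ refl) = <⇒≱ x<k (m≤m+n k _)
below-not-fixedˡ x<k (inj₂ refl) = <-irrefl refl x<k

below-not-fixedʳ : ∀ {k x y} → y < k → ¬ Fixed k (x , y)
below-not-fixedʳ y<k (inj₁ refl) = <-irrefl refl y<k
below-not-fixedʳ {k} y<k (inj₂ refl) = <⇒≱ y<k (m≤m+n k _)

module Cases (n : ℕ) (0<n : 0 < n) where

  open Exact n 0<n

  private
    k = 2 ^ n
    B = 5 * k
    instance
      k≢0 : NonZero k
      k≢0 = m^n≢0 2 n
      B≢0 : NonZero B
      B≢0 = m*n≢0 5 k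

  k-even : k % 2 ≡ 0
  k-even = n∣m⇒m%n≡0 k 2 (2∣2^ 0<n)

  2k-even : 2 * k % 2 ≡ 0
  2k-even = n∣m⇒m%n≡0 (2 * k) 2 (m∣m*n k)

  ck<B : ∀ {c} → c < 5 → c * k < B
  ck<B c<5 = *-monoˡ-< k c<5

  k<B : k < B
  k<B = subst (_< B) (*-identityˡ k) (ck<B (s≤s (s≤s z≤n)))

  2k<B : 2 * k < B
  2k<B = ck<B (s≤s (s≤s (s≤s z≤n)))

  *k-%5 : ∀ c {r} → k % 5 ≡ r → c * k % 5 ≡ c % 5 * r % 5
  *k-%5 c eq = trans (%-distribˡ-* c k 5) (cong (λ r → c % 5 * r % 5) eq)

  k-pred-< : k ∸ 1 < k
  k-pred-< = ∸-monoʳ-< {k} {1} {0} z<s (>-nonZero⁻¹ k)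

  Bound : ℕ → Set
  Bound N = ∀ x y → x < B → y < B → Within k N (x , y)

  -- `merge k` leads to `bounce 2 k`, which has opposite classes, whereas `bounce k` returns to
  -- itself after one run and thus satisfies every bound.
  bound-1 : k % 5 ≡ 1 → Bound (n + (3 + n + (suc n + suc n)))
  bound-1 k≡1 = Upper.within-all n 0<n (suc n + suc n) (suc n) (3 + n + (suc n + suc n))
    (within-G^ (suc n) (merge-multiple k (inj₁ k≡1) k-even k<B) bounce-2k)
    (within-cycle n (bounce-multiple k k≡1 k-even k<B) (below-not-fixedˡ k-pred-<))
    bounce-2k ≤-refl
    (≤-trans (+-monoʳ-≤ (2 + n) (m≤m+n (suc n) (suc n))) (n≤1+n _))
    where
    bounce-2k : Within k (suc n) (bounce B (2 * k))
    bounce-2k = within-oppositePair (bounce-opposite (2 * k) (inj₁ (*k-%5 2 k≡1)) 2k<B)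

  bound-2 : k % 5 ≡ 2 → Bound (n + (3 + n + suc n))
  bound-2 k≡2 = Upper.within-all n 0<n (suc n) (suc n) (3 + n + suc n)
    (within-oppositePair (merge-opposite k (inj₁ k≡2) k-even k<B))
    (within-oppositePair (bounce-opposite k (inj₁ k≡2) k<B))
    (within-oppositePair (bounce-opposite (2 * k) (inj₂ (*k-%5 2 k≡2)) 2k<B))
    ≤-refl (n≤1+n _)

  -- The longest chain is `bounce 2 k`, `bounce k`, `merge k`, with one run for each; here the
  -- merges, through `f′`, determine the bound.
  bound-3 : k % 5 ≡ 3 → Bound (n + (2 + n + (suc n + (suc n + suc n))))
  bound-3 k≡3 = Upper.within-all n 0<n (suc n + suc n) (suc n + (suc n + suc n)) (2 + n + (suc n + (suc n + suc n)))
    (within-≤ (m≤m+n (suc n) (suc n)) merge-k) bounce-k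
    (within-G^ (suc n) (bounce-multiple (2 * k) (*k-%5 2 k≡3) 2k-even 2k<B) bounce-k)
    (s≤s (s≤s (≤-trans (≤-reflexive (sym (+-suc n (suc n + suc n)))) (+-monoʳ-≤ n (s≤s (m≤n+m (suc n + suc n) n))))))
    ≤-refl
    where
    merge-k : Within k (suc n) (merge k)
    merge-k = within-oppositePair (merge-opposite k (inj₂ k≡3) k-even k<B)
    bounce-k : Within k (suc n + suc n) (bounce B k)
    bounce-k = within-G^ (suc n) (bounce-equal k k≡3 k<B) merge-k

  -- `merge k` and `bounce 2 k` lead to each other by one run, on a cycle that avoids the fixed
  -- pair. Only `bounce k` contributes.
  bound-4 : k % 5 ≡ 4 → Bound (n + (3 + n + suc n))
  bound-4 k≡4 = Upper.within-all n 0<n (suc n) (suc n + 0) (3 + n + suc n)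
    merge-k
    (within-oppositePair (bounce-opposite k (inj₂ k≡4) k<B))
    (within-G^ (suc n) (bounce-equal (2 * k) (*k-%5 2 k≡4) 2k<B) merge-k)
    ≤-refl
    (≤-trans (≤-reflexive (cong (2 + n +_) (+-identityʳ (suc n)))) (n≤1+n _))
    where
    cycle : G^ B (suc n + suc n) (merge k) ≡ merge k
    cycle = trans (iterate-+ (G B) (merge k) (suc n) (suc n))
      (trans (cong (G^ B (suc n)) (merge-multiple k (inj₂ k≡4) k-even k<B))
             (bounce-equal (2 * k) (*k-%5 2 k≡4) 2k<B))
    merge-k : ∀ {N} → Within k N (merge k)
    merge-k = within-cycle (n + suc n) cycle (λ fx → below-not-fixedʳ k-pred-<
      (subst (Fixed k) (merge≡ k (≢-nonZero⁻¹ k)) fx))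

  odd-not-cycle : ∀ {y} d → y % 2 ≡ 1 → d % 2 ≡ 1 → T^ B n y ≢ d * k
  odd-not-cycle {y} d odd d-odd eq with T^-end n y
  ... | c , p , q = contradiction (trans (sym d-odd) (trans (cong (_% 2)
    (*-cancelˡ-≡ d c k (trans (*-comm k d) (trans (sym eq) p)))) (trans (q 0<n) (odd⇒even n {y} odd)))) λ ()

  -- After `n` steps an odd entry has become an even multiple of `k`, but the fixed pair consists of
  -- the odd multiples `k` and `3 k`; so the last step is indispensable.
  exactly-opposite : ∀ {x y} → OppositePair (x , y) → x % 2 ≡ 1 → Exactly k n (x , y)
  exactly-opposite {x} {y} opp@(_ , _ , cx , cy , x≢y) odd = exactly
    (λ fx → not-fixed (subst (Fixed k) (opposite-classes n n x y cx cy x≢y) fx)) (reach-oppositePair opp)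
    where
    not-fixed : ¬ Fixed k (T^ B n x , T^ B n y)
    not-fixed (inj₁ eq) = odd-not-cycle {x} 3 odd refl (cong proj₁ eq)
    not-fixed (inj₂ eq) = odd-not-cycle {x} 1 odd refl (trans (cong proj₁ eq) (sym (*-identityˡ k)))

  exactly-bounce : ∀ p → p % 5 ≡ 2 ⊎ p % 5 ≡ 4 → p % 2 ≡ 0 → p < B → Exactly k n (bounce B p)
  exactly-bounce p p≡ even p<B = exactly-opposite (bounce-opposite p p≡ p<B)
    ([ (λ p≡2 → pred-odd 1 p p≡2 even) , (λ p≡4 → pred-odd 3 p p≡4 even) ]′ p≡)

  exactly-merge : ∀ u → u % 5 ≡ 2 ⊎ u % 5 ≡ 3 → u % 2 ≡ 0 → u < B → Exactly k n (merge u)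
  exactly-merge u u≡ even u<B = subst (Exactly k n) (sym u+) (exactly-opposite
    (subst OppositePair u+ (merge-opposite u u≡ even u<B)) (suc-odd u even))
    where
    u+ = merge≡ u ([ %5⇒≢0 u , %5⇒≢0 u ]′ u≡)

  T-mirror : ∀ a → a ≤ B → T B (B ∸ a) ≡ T B a
  T-mirror a a≤B with T-cases B a
  ... | inj₁ p = T-below (B ∸ a) (+-cancelʳ-≡ (2 * a) _ _ (begin
    2 * (B ∸ a) + T B a + 2 * a   ≡⟨ l₁ (B ∸ a) a (T B a) ⟩
    2 * (B ∸ a + a) + T B a       ≡⟨ cong (λ b → 2 * b + T B a) (m∸n+n≡m a≤B) ⟩
    2 * B + T B a                 ≡⟨ l₂ B (T B a) ⟩
    B + (B + T B a)               ≡⟨ cong (B +_) p ⟨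
    B + 2 * a                     ∎))
    where
    open ≡-Reasoning
    l₁ : ∀ b a t → 2 * b + t + 2 * a ≡ 2 * (b + a) + t
    l₁ = solve-∀
    l₂ : ∀ b t → 2 * b + t ≡ b + (b + t)
    l₂ = solve-∀
  ... | inj₂ p = T-above (B ∸ a) (+-cancelʳ-≡ (2 * a) _ _ (begin
    2 * (B ∸ a) + 2 * a           ≡⟨ *-distribˡ-+ 2 (B ∸ a) a ⟨
    2 * (B ∸ a + a)               ≡⟨ cong (2 *_) (m∸n+n≡m a≤B) ⟩
    2 * B                         ≡⟨ l₁ B ⟩
    B + B                         ≡⟨ cong (B +_) p ⟨
    B + (2 * a + T B a)           ≡⟨ l₂ B a (T B a) ⟩
    B + T B a + 2 * a             ∎))
    where
    open ≡-Reasoning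
    l₁ : ∀ b → 2 * b ≡ b + b
    l₁ = solve-∀
    l₂ : ∀ b a t → b + (2 * a + t) ≡ b + t + 2 * a
    l₂ = solve-∀

  -- On the lower branch a step gives `B - 2 z`, and by `T-mirror` the next step treats it like
  -- `2 z`. Up to reflection the orbit simply doubles until it passes `B`.
  T^-small : ∀ i z → 2 ^ i * z ≤ B → T^ B (suc i) z ≡ ∣ 2 ^ suc i * z - B ∣
  T^-small zero    z _ = refl
  T^-small (suc i) z le = begin
    T^ B (2 + i) z                    ≡⟨ iterate-suc (T B) z (suc i) ⟩
    T B (T^ B (suc i) z)              ≡⟨ cong (T B) (T^-small i z (≤-trans (*-monoˡ-≤ z (m≤m+n (2 ^ i) _)) le)) ⟩
    T B ∣ 2 ^ suc i * z - B ∣         ≡⟨ cong (T B) (m≤n⇒∣m-n∣≡n∸m le) ⟩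
    T B (B ∸ 2 ^ suc i * z)           ≡⟨ T-mirror (2 ^ suc i * z) le ⟩
    T B (2 ^ suc i * z)               ≡⟨ cong ∣_- B ∣ (*-assoc 2 (2 ^ suc i) z) ⟨
    ∣ 2 ^ (2 + i) * z - B ∣           ∎
    where open ≡-Reasoning

  2^-≤ : ∀ {i} → i ≤ n → 5 * 2 ^ i ≤ B
  2^-≤ i≤n = *-monoʳ-≤ 5 (^-monoʳ-≤ 2 i≤n)

  2^-< : ∀ {i} → i < n → 5 * 2 ^ i < B
  2^-< i<n = *-monoʳ-< 5 (^-monoʳ-< 2 (s≤s (s≤s z≤n)) i<n)

  2^-* : ∀ i m → 2 ^ i * (5 * 2 ^ m) ≡ 5 * 2 ^ (i + m)
  2^-* i m = trans (lemma (2 ^ i) (2 ^ m)) (cong (5 *_) (sym (^-distribˡ-+-* 2 i m)))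
    where
    lemma : ∀ a b → a * (5 * b) ≡ 5 * (a * b)
    lemma = solve-∀

  T^-5*2^ : ∀ i m → suc i + m ≤ n → T^ B (suc i) (5 * 2 ^ m) ≡ B ∸ 5 * 2 ^ (suc i + m)
  T^-5*2^ i m le = begin
    T^ B (suc i) (5 * 2 ^ m)          ≡⟨ T^-small i (5 * 2 ^ m) (≤-trans (≤-reflexive (2^-* i m)) (2^-≤ (≤-trans (n≤1+n _) le))) ⟩
    ∣ 2 ^ suc i * (5 * 2 ^ m) - B ∣   ≡⟨ cong ∣_- B ∣ (2^-* (suc i) m) ⟩
    ∣ 5 * 2 ^ (suc i + m) - B ∣       ≡⟨ m≤n⇒∣m-n∣≡n∸m (2^-≤ le) ⟩
    B ∸ 5 * 2 ^ (suc i + m)           ∎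
    where open ≡-Reasoning

  T^-5*2^-≢0 : ∀ i m → i + m < n → T^ B i (5 * 2 ^ m) ≢ 0
  T^-5*2^-≢0 zero    m _  eq = contradiction (m*n≡0⇒n≡0′ eq) (≢-nonZero⁻¹ (2 ^ m) {{m^n≢0 2 m}})
    where
    m*n≡0⇒n≡0′ : ∀ {x} → 5 * x ≡ 0 → x ≡ 0
    m*n≡0⇒n≡0′ {zero} _ = refl
  T^-5*2^-≢0 (suc i) m lt eq = <⇒≱ (2^-< lt) (m∸n≡0⇒m≤n (trans (sym (T^-5*2^ i m (<⇒≤ lt))) eq))

  -- By `T^-5*2^` each step adds 1 to the exponent in `B - 5 * 2 ^ m`. The first entry vanishes when
  -- its exponent reaches `n`, and the different exponents keep the entries apart until then.
  witness-start : ∀ j l → suc j + suc l ≡ n →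
    G^ B (suc j) (5 * 2 ^ suc l , 5) ≡ (0 , B ∸ 5 * 2 ^ suc j)
  witness-start j l eq = trans
    (G^-pure (suc j) (5 * 2 ^ suc l) 5 pure)
    (cong₂ _,_
      (trans (T^-5*2^ j (suc l) (≤-reflexive eq)) (trans (cong (λ m → B ∸ 5 * 2 ^ m) eq) (n∸n≡0 B)))
      (trans (T^-5*2^ j 0 (≤-trans (≤-reflexive (+-identityʳ (suc j))) j≤n))
             (cong (λ m → B ∸ 5 * 2 ^ m) (+-identityʳ (suc j)))))
    where
    j≤n : suc j ≤ n
    j≤n = subst (suc j ≤_) eq (m≤m+n (suc j) (suc l))
    pure : ∀ i → i < suc j → T^ B i (5 * 2 ^ suc l) ≢ 0 × T^ B i 5 ≢ 0 ×
                             T^ B (suc i) (5 * 2 ^ suc l) ≢ T^ B (suc i) 5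
    pure i i≤j = T^-5*2^-≢0 i (suc l) (subst (i + suc l <_) eq (+-monoˡ-< (suc l) i≤j)) ,
      T^-5*2^-≢0 i 0 (subst (_< n) (sym (+-identityʳ i)) (<-≤-trans i≤j j≤n)) ,
      λ t≡t → contradiction (+-cancelˡ-≡ (suc i) _ _ (2^-injective
        (*-cancelˡ-≡ _ _ 5 (∸-cancelˡ-≡ (2^-≤ le) (2^-≤ le′)
          (trans (sym (T^-5*2^ i (suc l) le)) (trans t≡t (T^-5*2^ i 0 le′))))))) λ ()
      where
      le : suc i + suc l ≤ n
      le = subst (suc i + suc l ≤_) eq (+-monoˡ-≤ (suc l) i≤j)
      le′ : suc i + 0 ≤ n
      le′ = ≤-trans (+-monoʳ-≤ (suc i) z≤n) le
      2^-injective : ∀ {a b} → 2 ^ a ≡ 2 ^ b → a ≡ b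
      2^-injective {a} {b} p = ≤-antisym (2^-cancel-≤ (≤-reflexive p)) (2^-cancel-≤ (≤-reflexive (sym p)))
        where
        2^-cancel-≤ : ∀ {a b} → 2 ^ a ≤ 2 ^ b → a ≤ b
        2^-cancel-≤ {a} {b} p = ≮⇒≥ λ b<a → <⇒≱ (^-monoʳ-< 2 (s≤s (s≤s z≤n)) b<a) p

  -- 5 · 2 ^ j + 1 sits just above a preimage of 0 under T ^ l, where T ^ l has slope 2 ^ l.
  witness-end : ∀ j l → suc j + suc l ≡ n →
    G^ B (suc l) (B ∸ 5 * 2 ^ suc j ∸ 1 , 5 * 2 ^ suc j) ≡ (2 ^ suc l , 0)
  witness-end j l eq = trans
    (G^-pure (suc l) x y pure)
    (cong₂ _,_ Tx (trans (T^-5*2^ l (suc j) (≤-reflexive eq′)) (trans (cong (λ m → B ∸ 5 * 2 ^ m) eq′) (n∸n≡0 B))))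
    where
    open ≡-Reasoning
    y = 5 * 2 ^ suc j
    x = B ∸ y ∸ 1
    eq′ : suc l + suc j ≡ n
    eq′ = trans (+-comm (suc l) (suc j)) eq
    y<B : y < B
    y<B = 2^-< (subst (suc j <_) eq (m<m+n (suc j) z<s))
    x≡ : x ≡ B ∸ suc y
    x≡ = trans (∸-+-assoc B y 1) (cong (B ∸_) (+-comm y 1))
    cy : cls y ≡ 0
    cy = 5∣⇒cls≡0 (m∣m*n (2 ^ suc j))
    cx : cls x ≡ 1
    cx = trans (cong cls x≡) (trans (cls-B∸′ y<B) (trans (cong (λ z → cls (suc z)) (*-comm 5 (2 ^ suc j))) (cls-+5* 1 (2 ^ suc j))))
      where
      cls-B∸′ : ∀ {p} → p < B → cls (B ∸ suc p) ≡ cls (suc p)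
      cls-B∸′ p<B = cls-∸ (5∣B n) p<B
    cy≢0 : ∀ i → cls (T^ B i y) ≡ 0
    cy≢0 i = trans (cls-T^ (5∣B n) i y) (trans (cong (λ c → iterate neg c i) cy) (neg^-0 i))
    cx≢0 : ∀ i → cls (T^ B i x) ≢ 0
    cx≢0 i = cls-T^≢0 n i x (≡⇒≢ cx λ ())
    pure : ∀ i → i < suc l → T^ B i x ≢ 0 × T^ B i y ≢ 0 × T^ B (suc i) x ≢ T^ B (suc i) y
    pure i i≤l = cls-≢0 (cx≢0 i) ,
      T^-5*2^-≢0 i (suc j) (subst (i + suc j <_) eq′ (+-monoˡ-< (suc j) i≤l)) ,
      λ t≡t → cx≢0 (suc i) (trans (cong cls t≡t) (cy≢0 (suc i)))
    lemma : ∀ a b → a * (5 * b) + a ≡ a * suc (5 * b)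
    lemma = solve-∀
    2^l+B : 2 ^ suc l * suc y ≡ B + 2 ^ suc l
    2^l+B = trans (sym (lemma (2 ^ suc l) (2 ^ suc j)))
      (cong (_+ 2 ^ suc l) (trans (2^-* (suc l) (suc j)) (cong (λ m → 5 * 2 ^ m) eq′)))
    small : 2 ^ l * suc y ≤ B
    small = *-cancelˡ-≤ 2 (subst₂ _≤_ (trans (sym 2^l+B) (*-assoc 2 (2 ^ l) (suc y))) (cong (B +_) (sym (+-identityʳ B)))
      (+-monoʳ-≤ B (≤-trans (^-monoʳ-≤ 2 (subst (suc l ≤_) eq′ (m≤m+n (suc l) (suc j)))) (m≤m+n k _))))
    Tx : T^ B (suc l) x ≡ 2 ^ suc l
    Tx = begin
      T^ B l (T B x)                ≡⟨ cong (λ z → T^ B l (T B z)) x≡ ⟩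
      T^ B l (T B (B ∸ suc y))      ≡⟨ cong (T^ B l) (T-mirror (suc y) y<B) ⟩
      T^ B (suc l) (suc y)          ≡⟨ T^-small l (suc y) small ⟩
      ∣ 2 ^ suc l * suc y - B ∣     ≡⟨ cong ∣_- B ∣ 2^l+B ⟩
      ∣ B + 2 ^ suc l - B ∣         ≡⟨ ∣m+n-m∣≡n B (2 ^ suc l) ⟩
      2 ^ suc l                     ∎

  -- Two zeros share a single run: `suc j` steps up to the first zero, a bounce, `suc l` steps up to
  -- the second, and another bounce. The free choice of `l` lets the residue of `2 ^ suc l` modulo 5
  -- start the longest chain.
  witness : ∀ j l → suc j + suc l ≡ n →
    G^ B (suc n + 1) (5 * 2 ^ suc l , 5) ≡ bounce B (2 ^ suc l)
  witness j l eq = begin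
    G^ B (suc n + 1) s                             ≡⟨ cong (λ m → G^ B m s) arith ⟩
    G^ B (suc j + (1 + (suc l + 1))) s             ≡⟨ iterate-+ (G B) s (suc j) _ ⟩
    G^ B (1 + (suc l + 1)) (G^ B (suc j) s)        ≡⟨ cong (G^ B (1 + (suc l + 1))) (witness-start j l eq) ⟩
    G^ B (suc l + 1) (G B (0 , B ∸ y))             ≡⟨ cong (G^ B (suc l + 1)) (G-bounceˡ B (B ∸ y) (λ eq → <⇒≱ y<B (m∸n≡0⇒m≤n eq))) ⟩
    G^ B (suc l + 1) (B ∸ y ∸ 1 , B ∸ (B ∸ y))     ≡⟨ cong (λ z → G^ B (suc l + 1) (B ∸ y ∸ 1 , z)) (m∸[m∸n]≡n (<⇒≤ y<B)) ⟩
    G^ B (suc l + 1) (B ∸ y ∸ 1 , y)               ≡⟨ iterate-+ (G B) (B ∸ y ∸ 1 , y) (suc l) 1 ⟩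
    G B (G^ B (suc l) (B ∸ y ∸ 1 , y))             ≡⟨ cong (G B) (witness-end j l eq) ⟩
    G B (2 ^ suc l , 0)                            ≡⟨ G-bounceʳ B (2 ^ suc l) (≢-nonZero⁻¹ (2 ^ suc l) {{m^n≢0 2 (suc l)}}) ⟩
    bounce B (2 ^ suc l)                           ∎
    where
    open ≡-Reasoning
    s = (5 * 2 ^ suc l , 5)
    y = 5 * 2 ^ suc j
    y<B : y < B
    y<B = 2^-< (subst (suc j <_) eq (m<m+n (suc j) z<s))
    lemma : ∀ j l → suc (suc j + suc l) + 1 ≡ suc j + (1 + (suc l + 1))
    lemma = solve-∀
    arith : suc n + 1 ≡ suc j + (1 + (suc l + 1))
    arith = trans (cong (λ m → suc m + 1) (sym eq)) (lemma j l)

-- Bases 5 · 2 ^ n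

2^-%5 : ∀ n → 2 ^ n % 5 ≡ 2 ^ (n % 4) % 5
2^-%5 n = begin
  2 ^ n % 5                               ≡⟨ cong (λ m → 2 ^ m % 5) (m≡m%n+[m/n]*n n 4) ⟩
  2 ^ (n % 4 + n / 4 * 4) % 5             ≡⟨ cong (_% 5) (^-distribˡ-+-* 2 (n % 4) (n / 4 * 4)) ⟩
  2 ^ (n % 4) * 2 ^ (n / 4 * 4) % 5       ≡⟨ %-distribˡ-* (2 ^ (n % 4)) _ 5 ⟩
  2 ^ (n % 4) % 5 * (2 ^ (n / 4 * 4) % 5) % 5 ≡⟨ cong (λ r → 2 ^ (n % 4) % 5 * r % 5) (period (n / 4)) ⟩
  2 ^ (n % 4) % 5 * 1 % 5                 ≡⟨ cong (_% 5) (*-identityʳ (2 ^ (n % 4) % 5)) ⟩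
  2 ^ (n % 4) % 5 % 5                     ≡⟨ m%n%n≡m%n (2 ^ (n % 4)) 5 ⟩
  2 ^ (n % 4) % 5                         ∎
  where
  open ≡-Reasoning
  period : ∀ q → 2 ^ (q * 4) % 5 ≡ 1
  period zero    = refl
  period (suc q) = trans (cong (_% 5) (^-distribˡ-+-* 2 4 (q * 4)))
    (trans (%-distribˡ-* 16 (2 ^ (q * 4)) 5) (cong (λ r → 16 % 5 * r % 5) (period q)))

-- The factor 3 is the inverse of 2 modulo 5.
halve-%5 : ∀ x {r} → 2 * x % 5 ≡ r → x % 5 ≡ 3 * r % 5
halve-%5 x {r} eq = begin
  x % 5                     ≡⟨ [m+kn]%n≡m%n x x 5 ⟨
  (x + x * 5) % 5           ≡⟨ cong (_% 5) (lemma x) ⟩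
  3 * (2 * x) % 5           ≡⟨ %-distribˡ-* 3 (2 * x) 5 ⟩
  3 * (2 * x % 5) % 5       ≡⟨ cong (λ r → 3 * r % 5) eq ⟩
  3 * r % 5                 ∎
  where
  open ≡-Reasoning
  lemma : ∀ x → x + x * 5 ≡ 3 * (2 * x)
  lemma = solve-∀

isM-exactly : ∀ {k} .{{_ : NonZero k}} .{{_ : NonZero (5 * k)}} {N N′ M x y} →
  N′ ≡ suc N → M ≡ 2 + N →
  (∀ x y → x < 5 * k → y < 5 * k → Within k N′ (x , y)) →
  x < 5 * k → y < 5 * k → Exactly k N (x , y) → IsM (5 * k) M
isM-exactly {N = N} {x = x} {y} refl refl upper x< y< (exactly ¬fx fx) = isM N upper x y x< y< ¬fx fx

module Powers (n : ℕ) (2<n : 2 < n) where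

  private
    k = 2 ^ n
    B = 5 * k
    0<n : 0 < n
    0<n = ≤-trans (s≤s z≤n) 2<n
    instance
      k≢0 : NonZero k
      k≢0 = m^n≢0 2 n
      B≢0 : NonZero B
      B≢0 = m*n≢0 5 k

  open Exact n 0<n
  open Cases n 0<n

  k%5 : ∀ {r} → n % 4 ≡ r → k % 5 ≡ 2 ^ r % 5
  k%5 eq = trans (2^-%5 n) (cong (λ r → 2 ^ r % 5) eq)

  exactly-witness : ∀ j l {N} → suc j + suc l ≡ n → Exactly k N (bounce B (2 ^ suc l)) →
                    Exactly k (suc n + 1 + N) (5 * 2 ^ suc l , 5)
  exactly-witness j l eq = exactly-G^ (suc n + 1) (witness j l eq)

  module _ (j l : ℕ) (eq : suc j + suc l ≡ n) where

    l<n : suc l < n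
    l<n = subst (suc l <_) eq (m<n+m (suc l) z<s)

    2^l<B : 2 ^ suc l < B
    2^l<B = <-≤-trans (^-monoʳ-< 2 (s≤s (s≤s z≤n)) l<n) (<⇒≤ k<B)

    2^l-even : 2 ^ suc l % 2 ≡ 0
    2^l-even = n∣m⇒m%n≡0 (2 ^ suc l) 2 (m∣m*n (2 ^ l))

    x₀<B : 5 * 2 ^ suc l < B
    x₀<B = 2^-< l<n

    5<B : 5 < B
    5<B = 2^-< {0} 0<n

    -- After `witness` the chain is `bounce (2 ^ suc l)`, `merge k`, `bounce 2 k`, each one run from
    -- the next, with opposite classes at the end.
    exactly-0 : k % 5 ≡ 1 → 2 ^ suc l % 5 ≡ 3 →
      Exactly k (suc n + 1 + (suc n + (suc n + n))) (5 * 2 ^ suc l , 5)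
    exactly-0 k≡1 l≡3 = exactly-witness j l eq
      (exactly-G^ (suc n) (bounce-equal (2 ^ suc l) l≡3 2^l<B)
      (exactly-G^ (suc n) (merge-multiple k (inj₁ k≡1) k-even k<B)
      (exactly-bounce (2 * k) (inj₁ (*k-%5 2 k≡1)) 2k-even 2k<B)))

    exactly-1 : k % 5 ≡ 2 → 2 ^ suc l % 5 ≡ 3 →
      Exactly k (suc n + 1 + (suc n + n)) (5 * 2 ^ suc l , 5)
    exactly-1 k≡2 l≡3 = exactly-witness j l eq
      (exactly-G^ (suc n) (bounce-equal (2 ^ suc l) l≡3 2^l<B)
      (exactly-merge k (inj₁ k≡2) k-even k<B))

    exactly-2 : k % 5 ≡ 4 → 2 ^ suc l % 5 ≡ 1 →
      Exactly k (suc n + 1 + (suc n + n)) (5 * 2 ^ suc l , 5)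
    exactly-2 k≡4 l≡1 = exactly-witness j l eq
      (exactly-G^ (suc n) (bounce-multiple (2 ^ suc l) l≡1 2^l-even 2^l<B)
      (exactly-bounce k (inj₂ k≡4) k-even k<B))

  4<B : 4 < B
  4<B = ≤-trans (s≤s ≤-refl) (*-monoʳ-≤ 5 (>-nonZero⁻¹ k))

  3k-even : 3 * k % 2 ≡ 0
  3k-even = trans (%-distribˡ-* 3 k 2) (cong (λ r → 1 * r % 2) k-even)

  -- The entries 1 and 4 have equal class and different parity. They merge to `merge (3 k)`, from
  -- where the chain runs through `bounce 2 k`, `bounce k` and `merge k`: five runs in all.
  exactly-3 : k % 5 ≡ 3 → Exactly k (suc n + (suc n + (suc n + (suc n + n)))) (1 , 4)
  exactly-3 k≡3 =
    exactly-G^ (suc n)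
      (trans (same-class n 0<n {1} {4} (λ ()) (λ ()) refl (<-trans (s≤s (s≤s z≤n)) 4<B) 4<B)
             (cong merge (T^1+n-1 n {1} (<-trans (s≤s (s≤s z≤n)) 4<B) refl)))
    (exactly-G^ (suc n)
      (merge-multiple (3 * k) (inj₂ (*k-%5 3 k≡3)) 3k-even (ck<B (s≤s (s≤s (s≤s (s≤s z≤n))))))
    (exactly-G^ (suc n) (bounce-multiple (2 * k) (*k-%5 2 k≡3) 2k-even 2k<B)
    (exactly-G^ (suc n) (bounce-equal k k≡3 k<B)
    (exactly-merge k (inj₂ k≡3) k-even k<B))))

  -- Here `2 ^ suc l` is half of `k ≡ 1` and hence 3 modulo 5, as `bounce-equal` requires.
  M-0 : ∀ l → 1 + suc l ≡ n → n % 4 ≡ 0 → IsM B (4 * n + 6)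
  M-0 l eq r = isM-exactly (a n) (b n) (bound-1 (k%5 r)) (x₀<B 0 l eq) (5<B 0 l eq)
    (exactly-0 0 l eq (k%5 r) (halve-%5 (2 ^ suc l) (trans (cong (λ m → 2 ^ m % 5) eq) (k%5 r))))
    where
    a : ∀ n → n + (3 + n + (suc n + suc n)) ≡ suc (suc n + 1 + (suc n + (suc n + n)))
    a = solve-∀
    b : ∀ n → 4 * n + 6 ≡ 2 + (suc n + 1 + (suc n + (suc n + n)))
    b = solve-∀

  private
    quarter : ∀ l {r} → 2 + suc l ≡ n → k % 5 ≡ r → 2 ^ suc l % 5 ≡ 3 * (3 * r % 5) % 5
    quarter l eq k≡ = halve-%5 (2 ^ suc l) (halve-%5 (2 ^ (2 + l)) (trans (cong (λ m → 2 ^ m % 5) eq) k≡))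
    a : ∀ n → n + (3 + n + suc n) ≡ suc (suc n + 1 + (suc n + n))
    a = solve-∀
    b : ∀ n → 3 * n + 5 ≡ 2 + (suc n + 1 + (suc n + n))
    b = solve-∀

  -- A quarter of `k ≡ 2` is 3 modulo 5, so `j` is 1; in `M-2` a quarter of `k ≡ 4` is 1. Since
  -- `3 ≤ n`, the exponent `n - 2` is positive.
  M-1 : ∀ l → 2 + suc l ≡ n → n % 4 ≡ 1 → IsM B (3 * n + 5)
  M-1 l eq r = isM-exactly (a n) (b n) (bound-2 (k%5 r)) (x₀<B 1 l eq) (5<B 1 l eq)
    (exactly-1 1 l eq (k%5 r) (quarter l eq (k%5 r)))

  M-2 : ∀ l → 2 + suc l ≡ n → n % 4 ≡ 2 → IsM B (3 * n + 5)
  M-2 l eq r = isM-exactly (a n) (b n) (bound-4 (k%5 r)) (x₀<B 1 l eq) (5<B 1 l eq)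
    (exactly-2 1 l eq (k%5 r) (quarter l eq (k%5 r)))

  M-3 : n % 4 ≡ 3 → IsM B (5 * n + 6)
  M-3 r = isM-exactly (a′ n) (b′ n) (bound-3 (k%5 r)) (<-trans (s≤s (s≤s z≤n)) 4<B) 4<B
    (exactly-3 (k%5 r))
    where
    a′ : ∀ n → n + (2 + n + (suc n + (suc n + suc n))) ≡ suc (suc n + (suc n + (suc n + (suc n + n))))
    a′ = solve-∀
    b′ : ∀ n → 5 * n + 6 ≡ 2 + (suc n + (suc n + (suc n + (suc n + n))))
    b′ = solve-∀

-- Bases 5 m · 2 ^ n

-- A merge raises an entry to `T B x + 1`, which must still be below `B`.
2+T≤ : ∀ {B x} → 0 < x → x < B → 2 + T B x ≤ B
2+T≤ {B} {x} 0<x x<B with T-cases B x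
... | inj₁ eq = +-cancelˡ-≤ B _ _ (begin
  B + (2 + T B x)   ≡⟨ trans (sym (+-assoc B 2 _)) (trans (cong (_+ T B x) (+-comm B 2)) (+-assoc 2 B _)) ⟩
  2 + (B + T B x)   ≡⟨ cong (2 +_) eq ⟨
  2 + 2 * x         ≡⟨ *-distribˡ-+ 2 1 x ⟨
  2 * suc x         ≤⟨ *-monoʳ-≤ 2 x<B ⟩
  2 * B             ≡⟨ cong (B +_) (+-identityʳ B) ⟩
  B + B             ∎)
  where open ≤-Reasoning
... | inj₂ eq = subst (2 + T B x ≤_) eq (+-monoˡ-≤ (T B x) (*-monoʳ-≤ 2 0<x))

module Scaled (m n : ℕ) (m-odd : m % 2 ≡ 1) (1<m : 1 < m) where

  private
    k₀ = 2 ^ n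
    B₀ = 5 * k₀
    k  = m * k₀
    B  = 5 * k
    τ  = T^ B₀
    instance
      m≢0 : NonZero m
      m≢0 = >-nonZero (<-trans z<s 1<m)
      k₀≢0 : NonZero k₀
      k₀≢0 = m^n≢0 2 n
      k≢0 : NonZero k
      k≢0 = m*n≢0 m k₀
      B≢0 : NonZero B
      B≢0 = m*n≢0 5 k

  B≡ : B ≡ m * B₀
  B≡ = lemma m k₀
    where
    lemma : ∀ a b → 5 * (a * b) ≡ a * (5 * b)
    lemma = solve-∀

  m∣B : m ∣ B
  m∣B = subst (m ∣_) (sym B≡) (m∣m*n B₀)

  T-m* : ∀ x → T B (m * x) ≡ m * T B₀ x
  T-m* x = trans (cong (λ b → T b (m * x)) B≡) (T-scale m B₀ x)

  T^-m* : ∀ i x → T^ B i (m * x) ≡ m * τ i x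
  T^-m* i x = trans (cong (λ b → T^ b i (m * x)) B≡) (T^-scale m B₀ i x)

  -- On such pairs `G` acts as `m` times the tent map of base `5 * 2 ^ n`, where opposite classes
  -- exclude merges and zeros. They turn out to be exactly the pairs below `B` that reach the fixed
  -- pair.
  record Good (x y : ℕ) : Set where
    constructor good
    field
      {x₀ y₀} : ℕ
      x≡  : x ≡ m * x₀
      y≡  : y ≡ m * y₀
      cx  : cls x₀ ≢ 0
      cy  : cls y₀ ≢ 0
      x≢y : cls x₀ ≢ cls y₀

  m*-≢0 : ∀ {z} → z ≢ 0 → m * z ≢ 0
  m*-≢0 z≢0 eq = z≢0 (m*n≡0⇒n≡0′ (m*n≡0⇒m≡0∨n≡0 m eq))
    where
    m*n≡0⇒n≡0′ : ∀ {z} → m ≡ 0 ⊎ z ≡ 0 → z ≡ 0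
    m*n≡0⇒n≡0′ (inj₁ eq) = contradiction eq (≢-nonZero⁻¹ m)
    m*n≡0⇒n≡0′ (inj₂ eq) = eq

  G^-good : ∀ i x y → cls x ≢ 0 → cls y ≢ 0 → cls x ≢ cls y →
            G^ B i (m * x , m * y) ≡ (m * τ i x , m * τ i y)
  G^-good i x y cx cy x≢y = trans (G^-pure i (m * x) (m * y) pure) (cong₂ _,_ (T^-m* i x) (T^-m* i y))
    where
    pure : ∀ j → j < i → T^ B j (m * x) ≢ 0 × T^ B j (m * y) ≢ 0 × T^ B (suc j) (m * x) ≢ T^ B (suc j) (m * y)
    pure j _ with opposite-pure n x y cx cy x≢y j
    ... | x≢0 , y≢0 , t≢t = ≡⇒≢ (T^-m* j x) (m*-≢0 x≢0) , ≡⇒≢ (T^-m* j y) (m*-≢0 y≢0) ,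
      λ eq → t≢t (*-cancelˡ-≡ _ _ m (trans (sym (T^-m* (suc j) x)) (trans eq (T^-m* (suc j) y))))

  3k≡ : m * (3 * k₀) ≡ 3 * k
  3k≡ = lemma m k₀
    where
    lemma : ∀ a b → a * (3 * b) ≡ 3 * (a * b)
    lemma = solve-∀

  fixed-m* : ∀ {x y} → Fixed k₀ (x , y) → Fixed k (m * x , m * y)
  fixed-m* (inj₁ refl) = inj₁ (cong (_, k) 3k≡)
  fixed-m* (inj₂ refl) = inj₂ (cong (k ,_) 3k≡)

  fixed-m*⁻¹ : ∀ {x y} → Fixed k (m * x , m * y) → Fixed k₀ (x , y)
  fixed-m*⁻¹ {x} {y} (inj₁ eq) = inj₁ (cong₂ _,_
    (*-cancelˡ-≡ x (3 * k₀) m (trans (cong proj₁ eq) (sym 3k≡))) (*-cancelˡ-≡ y k₀ m (cong proj₂ eq)))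
  fixed-m*⁻¹ {x} {y} (inj₂ eq) = inj₂ (cong₂ _,_
    (*-cancelˡ-≡ x k₀ m (cong proj₁ eq)) (*-cancelˡ-≡ y (3 * k₀) m (trans (cong proj₂ eq) (sym 3k≡))))

  good-reach : ∀ {x y} → x < B → y < B → Good x y → Fixed k (G^ B (suc n) (x , y))
  good-reach x<B y<B (good {x₀} {y₀} refl refl cx cy x≢y) =
    subst (Fixed k) (sym (G^-good (suc n) x₀ y₀ cx cy x≢y)) (fixed-m*
      (opposite-end n (cancel x<B) (cancel y<B) cx cy x≢y))
    where
    cancel : ∀ {z} → m * z < B → z < B₀
    cancel {z} lt = *-cancelˡ-< m z B₀ (subst (m * z <_) B≡ lt)

  -- With `m = 1 + 2 h`, the multiple `m x` is `h (2 x) + x`.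
  m∣2*⇒m∣ : ∀ x → m ∣ 2 * x → m ∣ x
  m∣2*⇒m∣ x m∣2x = ∣m+n∣m⇒∣n (subst (m ∣_) (sym eq) (m∣m*n x)) (∣n⇒∣m*n (m / 2) m∣2x)
    where
    lemma : ∀ h x → h * (2 * x) + x ≡ (1 + h * 2) * x
    lemma = solve-∀
    eq : m / 2 * (2 * x) + x ≡ m * x
    eq = trans (lemma (m / 2) x) (cong (_* x)
      (trans (cong (_+ m / 2 * 2) (sym m-odd)) (sym (m≡m%n+[m/n]*n m 2))))

  m∣T⇒m∣ : ∀ x → m ∣ T B x → m ∣ x
  m∣T⇒m∣ x m∣T with T-cases B x
  ... | inj₁ eq = m∣2*⇒m∣ x (subst (m ∣_) (sym eq) (∣m∣n⇒∣m+n m∣B m∣T))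
  ... | inj₂ eq = m∣2*⇒m∣ x (∣m+n∣m⇒∣n (subst (m ∣_) (trans (sym eq) (+-comm (2 * x) (T B x))) m∣B) m∣T)

  m∤1 : ¬ m ∣ 1
  m∤1 m∣1 = contradiction (∣1⇒≡1 m∣1) (≢-sym (<⇒≢ 1<m))

  m∤2 : ¬ m ∣ 2
  m∤2 m∣2 with ≤-antisym (∣⇒≤ m∣2) 1<m
  ... | refl = contradiction m-odd λ ()

  -- As `m` divides `B`, it would divide both a number and its predecessor. For a merge, it would
  -- divide the difference 2 of the entries, or the entry 1.
  bounce-not-good : ∀ p → suc p ≤ B → ¬ Good p (B ∸ suc p)
  bounce-not-good p p<B (good {x₀} {y₀} x≡ y≡ _ _ _) = m∤1 (∣m+n∣m⇒∣n {m} {p}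
    (subst (m ∣_) (+-comm 1 p) (∣m+n∣m⇒∣n {m} {B ∸ suc p} (subst (m ∣_) (sym (m∸n+n≡m p<B)) m∣B)
      (subst (m ∣_) (sym y≡) (m∣m*n y₀))))
    (subst (m ∣_) (sym x≡) (m∣m*n x₀)))

  merge-not-good : ∀ u → ¬ Good (proj₁ (merge u)) (proj₂ (merge u))
  merge-not-good zero    (good {x₀} x≡ _ _ _ _)      = m∤1 (subst (m ∣_) (sym x≡) (m∣m*n x₀))
  merge-not-good (suc w) (good {x₀} {y₀} x≡ y≡ _ _ _) = m∤2 (∣m+n∣m⇒∣n {m} {w}
    (subst (m ∣_) (trans (sym x≡) (+-comm 2 w)) (m∣m*n x₀)) (subst (m ∣_) (sym y≡) (m∣m*n y₀)))

  cls-T⁻¹ : ∀ z → cls (T B₀ z) ≢ 0 → cls z ≢ 0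
  cls-T⁻¹ z c≢0 eq = c≢0 (trans (cls-T z (5∣B n)) (cong neg eq))

  T-good : ∀ x y → Good (T B x) (T B y) → Good x y
  T-good x y (good {x₀} {y₀} x≡ y≡ cx cy x≢y)
    with m∣T⇒m∣ x (subst (m ∣_) (sym x≡) (m∣m*n x₀)) | m∣T⇒m∣ y (subst (m ∣_) (sym y≡) (m∣m*n y₀))
  ... | divides u refl | divides v refl = good {x₀ = u} {y₀ = v} (*-comm u m) (*-comm v m)
    (cls-T⁻¹ u (subst (λ z → cls z ≢ 0) (sym Tu) cx)) (cls-T⁻¹ v (subst (λ z → cls z ≢ 0) (sym Tv) cy))
    (λ eq → x≢y (trans (cong cls (sym Tu)) (trans (cls-T u (5∣B n)) (trans (cong neg eq)
      (trans (sym (cls-T v (5∣B n))) (cong cls Tv))))))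
    where
    Tu : T B₀ u ≡ x₀
    Tu = *-cancelˡ-≡ _ _ m (trans (sym (T-m* u)) (trans (cong (T B) (*-comm m u)) x≡))
    Tv : T B₀ v ≡ y₀
    Tv = *-cancelˡ-≡ _ _ m (trans (sym (T-m* v)) (trans (cong (T B) (*-comm m v)) y≡))

  -- The exceptional moves of G never lead to multiples of m, so all orbits
  -- that end in the fixed pair consist of multiples of m.
  G-good : ∀ x y → x ≤ B → y ≤ B → Good (proj₁ (G B (x , y))) (proj₂ (G B (x , y))) → Good x y
  G-good zero    zero    _   _   g = g
  G-good zero    (suc y) _   y≤B g = contradiction g (bounce-not-good y y≤B)
  G-good (suc x) zero    x≤B _   g = contradiction g (bounce-not-good x x≤B)
  G-good (suc x) (suc y) _   _   g with T B (suc x) ≟ T B (suc y)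
  ... | yes _ = contradiction g (merge-not-good (T B (suc x)))
  ... | no  _ = T-good (suc x) (suc y) g

  merge-< : ∀ u → 2 + u ≤ B → proj₁ (merge u) < B × proj₂ (merge u) < B
  merge-< zero    2≤B = 2≤B , 2≤B
  merge-< (suc u) u+3≤B = u+3≤B , ≤-trans (m≤n+m (suc u) 2) u+3≤B

  G-< : ∀ x y → x < B → y < B → proj₁ (G B (x , y)) < B × proj₂ (G B (x , y)) < B
  G-< zero    zero    0<B _   = 0<B , 0<B
  G-< zero    (suc y) _   y<B = <-trans (n<1+n y) y<B , ∸-monoʳ-< {B} {suc y} {0} z<s (<⇒≤ y<B)
  G-< (suc x) zero    x<B _   = <-trans (n<1+n x) x<B , ∸-monoʳ-< {B} {suc x} {0} z<s (<⇒≤ x<B)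
  G-< (suc x) (suc y) x<B y<B with T B (suc x) ≟ T B (suc y)
  ... | yes _ = merge-< (T B (suc x)) (2+T≤ z<s x<B)
  ... | no  _ = T-< z<s x<B , T-< z<s y<B

  cls-k₀ : cls k₀ ≢ 0
  cls-k₀ eq with cls-k n
  ... | inj₁ c = contradiction (trans (sym c) eq) λ ()
  ... | inj₂ c = contradiction (trans (sym c) eq) λ ()

  cls-3k₀ : cls (3 * k₀) ≢ 0
  cls-3k₀ eq = neg-cls≢0 k₀ cls-k₀ (trans (sym (cls-* 3 k₀)) eq)

  cls-3k₀≢ : cls (3 * k₀) ≢ cls k₀
  cls-3k₀≢ eq with cls k₀ | cls-k n | trans (sym (cls-* 3 k₀)) eq
  ... | _ | inj₁ refl | ()
  ... | _ | inj₂ refl | ()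

  fixed-good : ∀ {x y} → Fixed k (x , y) → Good x y
  fixed-good (inj₁ refl) = good (sym 3k≡) refl cls-3k₀ cls-k₀ cls-3k₀≢
  fixed-good (inj₂ refl) = good refl (sym 3k≡) cls-k₀ cls-3k₀ (≢-sym cls-3k₀≢)

  reaches-good : ∀ t x y → x < B → y < B → Fixed k (G^ B t (x , y)) → Good x y
  reaches-good zero    x y _   _   fx = fixed-good fx
  reaches-good (suc t) x y x<B y<B fx with G-< x y x<B y<B
  ... | x′<B , y′<B = G-good x y (<⇒≤ x<B) (<⇒≤ y<B) (reaches-good t _ _ x′<B y′<B fx)

  -- The pair `(1 , 2)` has opposite classes and an odd entry, so for `n > 0` it is not yet fixed
  -- after `n` steps; for `n = 0` it is `(1 , 2)` itself, which is not fixed.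
  unreached : ¬ Fixed k₀ (τ n 1 , τ n 2)
  unreached fx with m≤n⇒m<n∨m≡n (z≤n {n})
  ... | inj₁ 0<n = [ (λ eq → odd-not-cycle {1} 3 refl refl (cong proj₁ eq))
                   , (λ eq → odd-not-cycle {1} 1 refl refl (trans (cong proj₁ eq) (sym (*-identityˡ k₀)))) ]′ fx
    where open Cases n 0<n
  ... | inj₂ refl = [ (λ { () }) , (λ { () }) ]′ fx

  isM-scaled : IsM B (n + 2)
  isM-scaled = isM-exactly {k} {n} {suc n} {x = m * 1} {y = m * 2} refl (+-comm n 2)
    (λ x y x<B y<B → within λ t fx → good-reach x<B y<B (reaches-good t x y x<B y<B fx))
    (m*<B (s≤s (s≤s z≤n))) (m*<B (s≤s (s≤s (s≤s z≤n))))
    (exactly (λ fx → unreached (fixed-m*⁻¹ (subst (Fixed k) (G^-good n 1 2 (λ ()) (λ ()) (λ ())) fx)))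
      (good-reach (m*<B (s≤s (s≤s z≤n))) (m*<B (s≤s (s≤s (s≤s z≤n)))) (good refl refl (λ ()) (λ ()) (λ ()))))
    where
    m*<B : ∀ {c} → c < 5 → m * c < B
    m*<B {c} c<5 = subst (m * c <_) (sym B≡) (*-monoʳ-< m (<-≤-trans c<5 (*-monoʳ-≤ 5 (>-nonZero⁻¹ k₀))))

-- Small bases

_≟ₛ_ : DecidableEquality State
_≟ₛ_ = ≡-dec _≟_ _≟_

fixed? : ∀ k s → Dec (Fixed k s)
fixed? k s = (s ≟ₛ (3 * k , k)) ⊎-dec (s ≟ₛ (k , 3 * k))

-- A decidable substitute for `Within`: `suc r` is a common period of all cycles other than the
-- fixed pair, and is given as a parameter.
Settled : ℕ → ℕ → State → Set
Settled k r s = Fixed k s ⊎ (¬ Fixed k s × G^ (5 * k) (suc r) s ≡ s)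

settled? : ∀ k r s → Dec (Settled k r s)
settled? k r s = fixed? k s ⊎-dec (¬? (fixed? k s) ×-dec (G^ (5 * k) (suc r) s ≟ₛ s))

within-settled : ∀ {k} .{{_ : NonZero k}} N r s → Settled k r (G^ (5 * k) N s) → Within k N s
within-settled N r s (inj₁ fx)        = within-reach fx
within-settled N r s (inj₂ (¬fx , c)) = subst (λ N → Within _ N s) (+-identityʳ N)
  (within-G^ N refl (within-cycle r c ¬fx))

AllSettled : ℕ → ℕ → ℕ → Set
AllSettled k r N = ∀ {x} → x < 5 * k → ∀ {y} → y < 5 * k → Settled k r (G^ (5 * k) N (x , y))

allSettled? : ∀ k r N → Dec (AllSettled k r N)
allSettled? k r N = allUpTo? (λ x → allUpTo? (λ y → settled? k r (G^ (5 * k) N (x , y))) (5 * k)) (5 * k)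

exactly? : ∀ k N s → Dec (¬ Fixed k (G^ (5 * k) N s) × Fixed k (G^ (5 * k) (suc N) s))
exactly? k N s = ¬? (fixed? k (G^ (5 * k) N s)) ×-dec fixed? k (G^ (5 * k) (suc N) s)

isM-by-computation : ∀ b M k r N x y .{{_ : NonZero b}} .{{_ : NonZero k}} → b ≡ 5 * k → M ≡ 2 + N →
  True (allSettled? k r (suc N)) → True (x <? 5 * k) → True (y <? 5 * k) →
  True (exactly? k N (x , y)) → IsM b M
isM-by-computation _ _ k r N x y refl refl settled x< y< exact = isM N
  (λ x y x<B y<B → within-settled (suc N) r (x , y) (toWitness settled x<B y<B))
  x y (toWitness x<) (toWitness y<) (proj₁ (toWitness exact)) (proj₂ (toWitness exact))

-- Bases 2 and 4, evaluated on numbers, and the three smallest bases `5 * 2 ^ n`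

M₂ : IsM 2 1
M₂ = stable , least
  where
  stable : StableAt 2 1
  stable x (x<16 , _) = toWitness {a? = allUpTo? (λ x → K^ 2 1 x ≟ K^ 2 2 x) 16} tt x<16
  least : ∀ m → StableAt 2 m → 1 ≤ m
  least zero    st = contradiction (st 1 (s≤s (s≤s z≤n) , 7 , (λ ()) , 1 , K^-constant 2 1 refl refl)) λ ()
  least (suc m) _  = s≤s z≤n

-- In base 4 every orbit has reached a fixed number or a 2-cycle after three steps; members of a
-- proper 2-cycle are not in `S`.
Periodic : (ℕ → ℕ) → ℕ → Set
Periodic f y = y ≡ f y ⊎ (y ≢ f y × f (f y) ≡ y)

periodic? : ∀ f y → Dec (Periodic f y)
periodic? f y = (y ≟ f y) ⊎-dec (¬? (y ≟ f y) ×-dec (f (f y) ≟ y))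

constant∧periodic : ∀ b .{{_ : NonZero b}} i x → S b x → Periodic (K b) (K^ b i x) →
                    K^ b i x ≡ K^ b (suc i) x
constant∧periodic b i x _ (inj₁ eq) = trans eq (sym (iterate-suc (K b) x i))
constant∧periodic b i x (_ , c , _ , t₀ , const) (inj₂ (y≢fy , p)) =
  contradiction (trans y≡c (sym fy≡c)) y≢fy
  where
  f = K b
  y = iterate f x i
  2-periodic : ∀ j → iterate f y (j * 2) ≡ y
  2-periodic zero    = refl
  2-periodic (suc j) = trans (cong (λ z → iterate f z (j * 2)) p) (2-periodic j)
  at : iterate f x (i + t₀ * 2) ≡ y
  at = trans (iterate-+ f x i (t₀ * 2)) (2-periodic t₀)
  t₀≤ : t₀ ≤ i + t₀ * 2
  t₀≤ = ≤-trans (m≤m*n t₀ 2) (m≤n+m (t₀ * 2) i)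
  y≡c : y ≡ c
  y≡c = trans (sym at) (const (i + t₀ * 2) t₀≤)
  fy≡c : f y ≡ c
  fy≡c = trans (cong f (sym at)) (trans (sym (iterate-suc f x (i + t₀ * 2)))
    (const (suc (i + t₀ * 2)) (≤-trans t₀≤ (n≤1+n _))))

M₄ : IsM 4 3
M₄ = stable , least
  where
  all-periodic : ∀ {x} → x < 256 → Periodic (K 4) (K^ 4 3 x)
  all-periodic = toWitness {a? = allUpTo? (λ x → periodic? (K 4) (K^ 4 3 x)) 256} tt
  stable : StableAt 4 3
  stable x x∈S = constant∧periodic 4 3 x x∈S (all-periodic (proj₁ x∈S))
  10∈S : S 4 10
  -- The orbit of 10 is 10, 150, 75, 201, with 201 fixed.
  10∈S = toWitness {a? = 10 <? 256} tt , 201 , (λ ()) , 3 , K^-constant 4 3 refl refl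
  least : ∀ m → StableAt 4 m → 3 ≤ m
  least 0 st = contradiction (st 10 10∈S) λ ()
  least 1 st = contradiction (st 10 10∈S) λ ()
  least 2 st = contradiction (st 10 10∈S) λ ()
  least (suc (suc (suc m))) _ = s≤s (s≤s (s≤s z≤n))

M₅ : IsM 5 4
M₅ = isM-by-computation 5 4 1 0 2 0 3 refl refl tt tt tt tt

M₁₀ : IsM 10 7
M₁₀ = isM-by-computation 10 7 2 0 5 1 4 refl refl tt tt tt tt

-- 6 = suc 5 is the length of the only further cycle in base 20.
M₂₀ : IsM 20 10
M₂₀ = isM-by-computation 20 10 4 5 8 1 5 refl refl tt tt tt tt

M-5*m*2^ : ∀ (b m n : ℕ) .{{_ : NonZero b}} → m % 2 ≡ 1 → 1 < m → b ≡ 5 * m * 2 ^ n → IsM b (n + 2)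
M-5*m*2^ b m n m-odd 1<m b≡ with trans b≡ (*-assoc 5 m (2 ^ n))
... | refl = Scaled.isM-scaled m n m-odd 1<m

M-5*2^ : ∀ (b n : ℕ) .{{_ : NonZero b}} → b ≡ 5 * 2 ^ n → 3 ≤ n →
  (n % 4 ≡ 0 → IsM b (4 * n + 6)) ×
  (n % 4 ≡ 1 → IsM b (3 * n + 5)) ×
  (n % 4 ≡ 2 → IsM b (3 * n + 5)) ×
  (n % 4 ≡ 3 → IsM b (5 * n + 6))
M-5*2^ b n refl 3≤n = M-0 (suc (n ∸ 3)) n≡ , M-1 (n ∸ 3) n≡ , M-2 (n ∸ 3) n≡ , M-3
  where
  open Powers n 3≤n
  n≡ : 3 + (n ∸ 3) ≡ n
  n≡ = m+[n∸m]≡n 3≤n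


theorem1p1 : (IsM 2 1 × IsM 4 3 × IsM 5 4 × IsM 10 7 × IsM 20 10)
    × (∀ (b m n : ℕ) .{{_ : NonZero b}} → m % 2 ≡ 1 → 1 < m →
    b ≡ 5 * m * 2 ^ n → IsM b (n + 2))
    × (∀ (b n : ℕ) .{{_ : NonZero b}} → b ≡ 5 * 2 ^ n → 3 ≤ n →
    (n % 4 ≡ 0 → IsM b (4 * n + 6))
    × (n % 4 ≡ 1 → IsM b (3 * n + 5))
    × (n % 4 ≡ 2 → IsM b (3 * n + 5))
    × (n % 4 ≡ 3 → IsM b (5 * n + 6)))
theorem1p1 = (M₂ , M₄ , M₅ , M₁₀ , M₂₀) , M-5*m*2^ , M-5*2^
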